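{- Let $m\geqslant 1$ and $n\geqslant 1$ be integers. Let ${}^{(m)}\mathrm{Sh}_{1,n-1}\in\mathbb{Z}G(m,1,n)$ be the 1-shuffle element $${}^{(m)}\mathrm{Sh}_{1,n-1}=\left(1+s_{n-1}+s_{n-2}s_{n-1}+\dots+s_1s_2\cdots s_{n-1}\right)\left(1+t_n+t_n^2+\dots+t_n^{m-1}\right),$$ and let $L:\mathbb{Z}G(m,1,n)\to\mathbb{Z}G(m,1,n)$, $y\mapsto {}^{(m)}\mathrm{Sh}_{1,n-1}\,y$, be the operator of left multiplication by it. Then $L$ is diagonalizable (over $\mathbb{Q}$, i.e. after extension of scalars to $\mathbb{Q}G(m,1,n)$) with eigenvalues $im$, $i=0,1,\dots,n-1,n$. For each $i\in\{0,1,\dots,n\}$ the multiplicity of the eigenvalue $im$ equals $\binom{n}{i}d_{m,n-i}$, which is the number of elements of $G(m,1,n)$ with exactly $i$ fixed points (a multiplicity equal to $0$ means that $im$ is not an eigenvalue).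
   Context: Let $C_m$ be the cyclic group of order $m$ with generator $\gamma$, and let $E=\{(x,\rho): x\in\{1,\dots,n\},\ \rho\in C_m\}$, with $C_m$ acting on $E$ by $\rho\cdot(x,\rho')=(x,\rho\rho')$. The complex reflection group $G(m,1,n)$ is identified with the group of all permutations $\pi$ of the set $E$ such that $\pi(x,\rho)=\rho\cdot\pi(x,1)$ for all $x\in\{1,\dots,n\}$, $\rho\in C_m$. (Equivalently, it is the group of $n\times n$ complex matrices with exactly one nonzero entry in each row and column, the nonzero entries being $m$-th roots of unity.) It has order $m^n n!$; $G(m,1,0)$ is the trivial group. The elements $s_1,\dots,s_{n-1},t$ of $G(m,1,n)$ are given by $s_i(x,1)=(\pi_i(x),1)$, where $\pi_i$ is the transposition $(i,i+1)$, and $t(1,1)=(1,\gamma)$, $t(x,1)=(x,1)$ for $x\neq1$. One sets $t_1=t$ and $t_{i+1}=s_it_is_i$ for $i=1,\dots,n-1$; thus $t_i$ sends $(i,\rho)$ to $(i,\gamma\rho)$ and fixes $(x,\rho)$ for $x\ne i$. An element $g\in G(m,1,n)$ has $i$ fixed points if there are exactly $i$ values $x\in\{1,\dots,n\}$ with $g(x,1)=(x,1)$ (in matrix terms, exactly $i$ diagonal entries equal to $1$). The $m$-derangement number $d_{m,n}$ is the number of elements of $G(m,1,n)$ with no fixed points; $d_{m,0}=1$. $\mathbb{Z}G(m,1,n)$ denotes the integral group ring and $\mathbb{Q}G(m,1,n)$ the rational group algebra. -}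

module Defs where

open import Algebra.Bundles using (CommutativeRing; Group; Ring)
open import Algebra.Module.Bundles using (LeftModule)
open import Data.Fin.Base as Fin using (Fin; zero; suc; toℕ; inject₁; fold′; fromℕ; combine; remQuot; finToFun; funToFin)
open import Data.Fin.Permutation as Perm using (Permutation′; transpose; _⟨$⟩ʳ_; _⟨$⟩ˡ_)
import Data.Fin.Properties as Finₚ
open import Data.Integer.Base as ℤ using (ℤ; +_)
import Data.Integer.Properties as ℤₚ
open import Data.List.Base using (List; []; _∷_; _++_; [_]; map; concatMap; foldr; filter; length; deduplicate; cartesianProduct; allFin; tabulate; tails; applyUpTo)
open import Data.List.Membership.Propositional.Properties using (∈-allFin; ∈-cartesianProduct⁺)
import Data.List.Relation.Unary.Any as Any
import Data.List.Relation.Unary.Any.Properties as Anyₚ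
import Data.List.Relation.Unary.Enumerates.Setoid as Enumerates
import Data.List.Relation.Unary.Enumerates.Setoid.Properties as Enumeratesₚ
import Data.List.Relation.Unary.Unique.Setoid as Unique
import Data.List.Relation.Unary.Unique.DecSetoid.Properties as Uniqueₚ
open import Data.Nat.Base as ℕ using (ℕ; zero; suc; NonZero)
import Data.Nat.DivMod as ℕ
import Data.Nat.Properties as ℕₚ
open import Data.Product.Base using (∃; ∃-syntax; _×_; _,_; proj₁; proj₂; map₁)
import Data.Product.Properties as ×ₚ
open import Data.Rational.Base as ℚ using (ℚ)
import Data.Rational.Properties as ℚₚ
open import Data.Unit.Polymorphic.Base using (⊤)
open import Data.Vec.Functional using (Vector)
open import Data.Bool.Base using (if_then_else_; true; false)
open import Function.Base using (id; _∘_)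
open import Function.Bundles using (_↔_; mk↔ₛ′; Inverse)
open import Function.Construct.Composition using (_↔-∘_)
open import Function.Construct.Identity using (↔-id)
open import Function.Construct.Symmetry using (↔-sym)
open import Level using (Level; _⊔_; 0ℓ)
open import Relation.Binary.Bundles using (DecSetoid; Setoid)
open import Relation.Binary.Definitions using (Decidable)
open import Relation.Binary.PropositionalEquality
  using (_≡_; refl; sym; trans; cong; cong₂; isEquivalence; module ≡-Reasoning)
open import Relation.Nullary.Decidable using (Dec; yes; no; does; map′; _×-dec_)
open import Relation.Nullary.Negation using (contradiction)
open import Relation.Unary using (Pred)

private
  variable
    a b c ℓ ℓ′ p : Level

module LinearAlgebra {R : Ring a ℓ} (M : LeftModule R b ℓ′) where

  open Ring R using (_≈_; 0#) renaming (Carrier to K)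
  open LeftModule M using (_≈ᴹ_; _≉ᴹ_; _*ₗ_; 0ᴹ; +ᴹ-rawMonoid) renaming (Carrierᴹ to V)
  open import Algebra.Definitions.RawMonoid +ᴹ-rawMonoid using (sum)

  linearCombination : ∀ {k} → Vector K k → Vector V k → V
  linearCombination coeffs vs = sum (λ j → coeffs j *ₗ vs j)

  LinearlyIndependent : ∀ {k} → Vector V k → Set (a ⊔ ℓ ⊔ ℓ′)
  LinearlyIndependent vs =
    ∀ coeffs → linearCombination coeffs vs ≈ᴹ 0ᴹ → ∀ j → coeffs j ≈ 0#

  record IsBasisOf (U : Pred V p) {k : ℕ} (vs : Vector V k) : Set (a ⊔ ℓ ⊔ b ⊔ ℓ′ ⊔ p) where
    field
      inside      : ∀ j → U (vs j)
      independent : LinearlyIndependent vs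
      spanning    : ∀ v → U v → ∃[ coeffs ] v ≈ᴹ linearCombination coeffs vs

  IsBasis : ∀ {k} → Vector V k → Set (a ⊔ ℓ ⊔ b ⊔ ℓ′)
  IsBasis = IsBasisOf {p = 0ℓ} (λ _ → ⊤)

  HasDimension : Pred V p → ℕ → Set (a ⊔ ℓ ⊔ b ⊔ ℓ′ ⊔ p)
  HasDimension U k = ∃[ vs ] IsBasisOf U {k} vs

  module _ (f : V → V) where

    Eigenspace : K → Pred V ℓ′
    Eigenspace μ v = f v ≈ᴹ μ *ₗ v

    IsEigenvector : K → Pred V ℓ′
    IsEigenvector μ v = v ≉ᴹ 0ᴹ × Eigenspace μ v

    IsEigenvalue : Pred K (b ⊔ ℓ′)
    IsEigenvalue μ = ∃[ v ] IsEigenvector μ v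

    Diagonalizable : Set (a ⊔ ℓ ⊔ b ⊔ ℓ′)
    Diagonalizable = ∃[ k ] ∃[ vs ] IsBasis {k} vs × (∀ j → ∃[ μ ] IsEigenvector μ (vs j))

    -- For a diagonalizable operator this agrees with the algebraic multiplicity.
    HasMultiplicity : K → ℕ → Set (a ⊔ ℓ ⊔ b ⊔ ℓ′)
    HasMultiplicity μ = HasDimension (Eigenspace μ)

-- An element Σ rᵢ gᵢ of the group ring is a list of pairs (rᵢ , gᵢ) in which a
-- group element may occur several times; two lists are equal when all their
-- coefficients are.
module GroupRing (R : CommutativeRing a ℓ) (G : Group b ℓ′) (_≟_ : Decidable (Group._≈_ G)) where

  private
    module R = CommutativeRing R
    module G = Group G
    open R using (_≈_; _+_; _*_; -_; 0#; 1#)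
    open import Relation.Binary.Reasoning.Setoid R.setoid
    open import Algebra.Properties.Ring R.ring using (-0#≈0#; -‿+-comm)

  infix  4 _≈ᴳ_
  infixl 7 _*ᴳ_
  infixr 7 _·_

  R[G] : Set (a ⊔ b)
  R[G] = List (R.Carrier × G.Carrier)

  coefficient : G.Carrier → R[G] → R.Carrier
  coefficient g []             = 0#
  coefficient g ((r , h) ∷ xs) = (if does (h ≟ g) then r else 0#) + coefficient g xs

  _≈ᴳ_ : R[G] → R[G] → Set (b ⊔ ℓ)
  xs ≈ᴳ ys = ∀ g → coefficient g xs ≈ coefficient g ys

  _·_ : R.Carrier → R[G] → R[G]
  r · xs = map (map₁ (r *_)) xs

  -ᴳ_ : R[G] → R[G]
  -ᴳ_ = map (map₁ -_)

  _*ᴳ_ : R[G] → R[G] → R[G]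
  xs *ᴳ ys = concatMap (λ (r , g) → map (λ (s , h) → r * s , g G.∙ h) ys) xs

  ⟦_⟧ : G.Carrier → R[G]
  ⟦ g ⟧ = [ (1# , g) ]

  Σᴳ : List G.Carrier → R[G]
  Σᴳ = concatMap ⟦_⟧

  coefficient-++ : ∀ g xs ys → coefficient g (xs ++ ys) ≈ coefficient g xs + coefficient g ys
  coefficient-++ g []             ys = R.sym (R.+-identityˡ _)
  coefficient-++ g ((r , h) ∷ xs) ys =
    R.trans (R.+-congˡ (coefficient-++ g xs ys)) (R.sym (R.+-assoc _ _ _))

  coefficient-· : ∀ g r xs → coefficient g (r · xs) ≈ r * coefficient g xs
  coefficient-· g r []             = R.sym (R.zeroʳ r)
  coefficient-· g r ((s , h) ∷ xs) =
    R.trans (R.+-cong (head (does (h ≟ g))) (coefficient-· g r xs)) (R.sym (R.distribˡ r _ _))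
    where
    head : ∀ t → (if t then r * s else 0#) ≈ r * (if t then s else 0#)
    head true  = R.refl
    head false = R.sym (R.zeroʳ r)

  coefficient-neg : ∀ g xs → coefficient g (-ᴳ xs) ≈ - coefficient g xs
  coefficient-neg g []             = R.sym -0#≈0#
  coefficient-neg g ((s , h) ∷ xs) =
    R.trans (R.+-cong (head (does (h ≟ g))) (coefficient-neg g xs)) (-‿+-comm _ _)
    where
    head : ∀ t → (if t then - s else 0#) ≈ - (if t then s else 0#)
    head true  = R.refl
    head false = R.sym -0#≈0#

  leftModule : LeftModule R.ring (a ⊔ b) (b ⊔ ℓ)
  leftModule = record
    { Carrierᴹ = R[G]
    ; _≈ᴹ_     = _≈ᴳ_
    ; _+ᴹ_     = _++_
    ; _*ₗ_     = _·_
    ; 0ᴹ       = []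
    ; -ᴹ_      = -ᴳ_
    ; isLeftModule = record
      { isLeftSemimodule = record
        { +ᴹ-isCommutativeMonoid = record
          { isMonoid = record
            { isSemigroup = record
              { isMagma = record
                { isEquivalence = record
                  { refl  = λ _ → R.refl
                  ; sym   = λ p g → R.sym (p g)
                  ; trans = λ p q g → R.trans (p g) (q g)
                  }
                ; ∙-cong = λ {x} {y} {u} {v} p q g → begin
                    coefficient g (x ++ u)             ≈⟨ coefficient-++ g x u ⟩
                    coefficient g x + coefficient g u  ≈⟨ R.+-cong (p g) (q g) ⟩
                    coefficient g y + coefficient g v  ≈⟨ coefficient-++ g y v ⟨
                    coefficient g (y ++ v)             ∎
                }
              ; assoc = λ x y z g → begin
                  coefficient g ((x ++ y) ++ z)                              ≈⟨ coefficient-++ g (x ++ y) z ⟩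
                  coefficient g (x ++ y) + coefficient g z                   ≈⟨ R.+-congʳ (coefficient-++ g x y) ⟩
                  (coefficient g x + coefficient g y) + coefficient g z      ≈⟨ R.+-assoc _ _ _ ⟩
                  coefficient g x + (coefficient g y + coefficient g z)      ≈⟨ R.+-congˡ (coefficient-++ g y z) ⟨
                  coefficient g x + coefficient g (y ++ z)                   ≈⟨ coefficient-++ g x (y ++ z) ⟨
                  coefficient g (x ++ (y ++ z))                              ∎
              }
            ; identity = (λ x g → R.refl)
                       , (λ x g → R.trans (coefficient-++ g x []) (R.+-identityʳ _))
            }
          ; comm = λ x y g → begin
              coefficient g (x ++ y)             ≈⟨ coefficient-++ g x y ⟩
              coefficient g x + coefficient g y  ≈⟨ R.+-comm _ _ ⟩
              coefficient g y + coefficient g x  ≈⟨ coefficient-++ g y x ⟨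
              coefficient g (y ++ x)             ∎
          }
        ; isPreleftSemimodule = record
          { *ₗ-cong = λ {r} {s} {x} {y} p q g → begin
              coefficient g (r · x)  ≈⟨ coefficient-· g r x ⟩
              r * coefficient g x    ≈⟨ R.*-cong p (q g) ⟩
              s * coefficient g y    ≈⟨ coefficient-· g s y ⟨
              coefficient g (s · y)  ∎
          ; *ₗ-zeroˡ = λ x g → R.trans (coefficient-· g 0# x) (R.zeroˡ _)
          ; *ₗ-distribʳ = λ x r s g → begin
              coefficient g ((r + s) · x)                    ≈⟨ coefficient-· g (r + s) x ⟩
              (r + s) * coefficient g x                      ≈⟨ R.distribʳ _ r s ⟩
              r * coefficient g x + s * coefficient g x      ≈⟨ R.+-cong (coefficient-· g r x) (coefficient-· g s x) ⟨
              coefficient g (r · x) + coefficient g (s · x)  ≈⟨ coefficient-++ g (r · x) (s · x) ⟨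
              coefficient g (r · x ++ s · x)                 ∎
          ; *ₗ-identityˡ = λ x g → R.trans (coefficient-· g 1# x) (R.*-identityˡ _)
          ; *ₗ-assoc = λ r s x g → begin
              coefficient g ((r * s) · x)  ≈⟨ coefficient-· g (r * s) x ⟩
              (r * s) * coefficient g x    ≈⟨ R.*-assoc r s _ ⟩
              r * (s * coefficient g x)    ≈⟨ R.*-congˡ (coefficient-· g s x) ⟨
              r * coefficient g (s · x)    ≈⟨ coefficient-· g r (s · x) ⟨
              coefficient g (r · (s · x))  ∎
          ; *ₗ-zeroʳ = λ r g → R.refl
          ; *ₗ-distribˡ = λ r x y g → begin
              coefficient g (r · (x ++ y))                   ≈⟨ coefficient-· g r (x ++ y) ⟩
              r * coefficient g (x ++ y)                     ≈⟨ R.*-congˡ (coefficient-++ g x y) ⟩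
              r * (coefficient g x + coefficient g y)        ≈⟨ R.distribˡ r _ _ ⟩
              r * coefficient g x + r * coefficient g y      ≈⟨ R.+-cong (coefficient-· g r x) (coefficient-· g r y) ⟨
              coefficient g (r · x) + coefficient g (r · y)  ≈⟨ coefficient-++ g (r · x) (r · y) ⟨
              coefficient g (r · x ++ r · y)                 ∎
          }
        }
      ; -ᴹ‿cong = λ {x} {y} p g → begin
          coefficient g (-ᴳ x)  ≈⟨ coefficient-neg g x ⟩
          - coefficient g x     ≈⟨ R.-‿cong (p g) ⟩
          - coefficient g y     ≈⟨ coefficient-neg g y ⟨
          coefficient g (-ᴳ y)  ∎
      ; -ᴹ‿inverse =
            (λ x g → begin
              coefficient g (-ᴳ x ++ x)               ≈⟨ coefficient-++ g (-ᴳ x) x ⟩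
              coefficient g (-ᴳ x) + coefficient g x  ≈⟨ R.+-congʳ (coefficient-neg g x) ⟩
              - coefficient g x + coefficient g x     ≈⟨ R.-‿inverseˡ _ ⟩
              0#                                      ∎)
          , (λ x g → begin
              coefficient g (x ++ -ᴳ x)               ≈⟨ coefficient-++ g x (-ᴳ x) ⟩
              coefficient g x + coefficient g (-ᴳ x)  ≈⟨ R.+-congˡ (coefficient-neg g x) ⟩
              coefficient g x + - coefficient g x     ≈⟨ R.-‿inverseʳ _ ⟩
              0#                                      ∎)
      }
    }

-- ℤ/mℤ, written multiplicatively.
module Cyclic (m : ℕ) .{{_ : NonZero m}} where

  C : Set
  C = Fin m

  infixl 7 _∙ᶜ_

  _∙ᶜ_ : C → C → C
  ρ ∙ᶜ σ = (toℕ ρ ℕ.+ toℕ σ) ℕ.mod m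

  1ᶜ γ : C
  1ᶜ = 0 ℕ.mod m
  γ  = 1 ℕ.mod m

  _⁻¹ᶜ : C → C
  ρ ⁻¹ᶜ = (m ℕ.∸ toℕ ρ) ℕ.mod m

  private
    open ≡-Reasoning

    toℕ-mod : ∀ k → toℕ (k ℕ.mod m) ≡ k ℕ.% m
    toℕ-mod k = Finₚ.toℕ-fromℕ< _

    toℕ-% : ∀ (ρ : C) → toℕ ρ ℕ.% m ≡ toℕ ρ
    toℕ-% ρ = ℕ.m<n⇒m%n≡m (Finₚ.toℕ<n ρ)

    mod-cong : ∀ {j k} → j ℕ.% m ≡ k ℕ.% m → j ℕ.mod m ≡ k ℕ.mod m
    mod-cong {j} {k} p = Finₚ.toℕ-injective (trans (toℕ-mod j) (trans p (sym (toℕ-mod k))))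

    mod-toℕ : ∀ (ρ : C) → toℕ ρ ℕ.mod m ≡ ρ
    mod-toℕ ρ = Finₚ.toℕ-injective (trans (toℕ-mod _) (toℕ-% ρ))

    %-+ˡ : ∀ j k → (j ℕ.% m ℕ.+ k) ℕ.% m ≡ (j ℕ.+ k) ℕ.% m
    %-+ˡ j k = begin
      (j ℕ.% m ℕ.+ k) ℕ.% m                  ≡⟨ ℕ.%-distribˡ-+ (j ℕ.% m) k m ⟩
      (j ℕ.% m ℕ.% m ℕ.+ k ℕ.% m) ℕ.% m      ≡⟨ cong (λ z → (z ℕ.+ k ℕ.% m) ℕ.% m) (ℕ.m%n%n≡m%n j m) ⟩
      (j ℕ.% m ℕ.+ k ℕ.% m) ℕ.% m            ≡⟨ ℕ.%-distribˡ-+ j k m ⟨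
      (j ℕ.+ k) ℕ.% m                        ∎

    mod-+ˡ : ∀ j (ρ : C) → (j ℕ.mod m) ∙ᶜ ρ ≡ (j ℕ.+ toℕ ρ) ℕ.mod m
    mod-+ˡ j ρ = mod-cong (trans (cong (λ z → (z ℕ.+ toℕ ρ) ℕ.% m) (toℕ-mod j)) (%-+ˡ j (toℕ ρ)))

    comm : ∀ ρ σ → ρ ∙ᶜ σ ≡ σ ∙ᶜ ρ
    comm ρ σ = cong (ℕ._mod m) (ℕₚ.+-comm (toℕ ρ) (toℕ σ))

    assoc : ∀ ρ σ τ → (ρ ∙ᶜ σ) ∙ᶜ τ ≡ ρ ∙ᶜ (σ ∙ᶜ τ)
    assoc ρ σ τ = begin
      (ρ ∙ᶜ σ) ∙ᶜ τ                              ≡⟨ mod-+ˡ (toℕ ρ ℕ.+ toℕ σ) τ ⟩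
      (toℕ ρ ℕ.+ toℕ σ ℕ.+ toℕ τ) ℕ.mod m        ≡⟨ cong (ℕ._mod m) (trans (ℕₚ.+-assoc (toℕ ρ) _ _) (ℕₚ.+-comm (toℕ ρ) _)) ⟩
      (toℕ σ ℕ.+ toℕ τ ℕ.+ toℕ ρ) ℕ.mod m        ≡⟨ mod-+ˡ (toℕ σ ℕ.+ toℕ τ) ρ ⟨
      (σ ∙ᶜ τ) ∙ᶜ ρ                              ≡⟨ comm (σ ∙ᶜ τ) ρ ⟩
      ρ ∙ᶜ (σ ∙ᶜ τ)                              ∎

    identityˡ : ∀ ρ → 1ᶜ ∙ᶜ ρ ≡ ρ
    identityˡ ρ = trans (mod-+ˡ 0 ρ) (mod-toℕ ρ)

    inverseˡ : ∀ ρ → ρ ⁻¹ᶜ ∙ᶜ ρ ≡ 1ᶜ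
    inverseˡ ρ = trans (mod-+ˡ (m ℕ.∸ toℕ ρ) ρ) (mod-cong (begin
      (m ℕ.∸ toℕ ρ ℕ.+ toℕ ρ) ℕ.% m  ≡⟨ cong (ℕ._% m) (ℕₚ.m∸n+n≡m (ℕₚ.<⇒≤ (Finₚ.toℕ<n ρ))) ⟩
      m ℕ.% m                        ≡⟨ ℕ.n%n≡0 m ⟩
      0                              ≡⟨ ℕ.m<n⇒m%n≡m (ℕ.>-nonZero⁻¹ m) ⟨
      0 ℕ.% m                        ∎))

  cyclicGroup : Group 0ℓ 0ℓ
  cyclicGroup = record
    { Carrier = C
    ; _≈_     = _≡_
    ; _∙_     = _∙ᶜ_
    ; ε       = 1ᶜ
    ; _⁻¹     = _⁻¹ᶜ
    ; isGroup = record
      { isMonoid = record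
        { isSemigroup = record
          { isMagma = record { isEquivalence = isEquivalence ; ∙-cong = cong₂ _∙ᶜ_ }
          ; assoc   = assoc
          }
        ; identity = identityˡ , λ ρ → trans (comm ρ 1ᶜ) (identityˡ ρ)
        }
      ; inverse = inverseˡ , λ ρ → trans (comm ρ (ρ ⁻¹ᶜ)) (inverseˡ ρ)
      ; ⁻¹-cong = cong _⁻¹ᶜ
      }
    }

module ReflectionGroup (m : ℕ) .{{_ : NonZero m}} (n : ℕ) where

  open Cyclic m public
  private module C = Group cyclicGroup

  E : Set
  E = Fin n × C

  infixr 7 _▹_

  _▹_ : C → E → E
  ρ ▹ (x , σ) = x , ρ ∙ᶜ σ

  ▹-assoc : ∀ ρ σ e → (ρ ∙ᶜ σ) ▹ e ≡ ρ ▹ σ ▹ e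
  ▹-assoc ρ σ (x , τ) = cong (x ,_) (C.assoc ρ σ τ)

  ▹-identity : ∀ e → 1ᶜ ▹ e ≡ e
  ▹-identity (x , τ) = cong (x ,_) (C.identityˡ τ)

  record G : Set where
    field
      permutation : E ↔ E
    open Inverse permutation public using (to; from; strictlyInverseˡ; strictlyInverseʳ)
    field
      equivariant : ∀ x ρ → to (x , ρ) ≡ ρ ▹ to (x , 1ᶜ)

    equivariant′ : ∀ ρ e → to (ρ ▹ e) ≡ ρ ▹ to e
    equivariant′ ρ (x , σ) = begin
      to (x , ρ ∙ᶜ σ)         ≡⟨ equivariant x (ρ ∙ᶜ σ) ⟩
      (ρ ∙ᶜ σ) ▹ to (x , 1ᶜ)  ≡⟨ ▹-assoc ρ σ _ ⟩
      ρ ▹ σ ▹ to (x , 1ᶜ)     ≡⟨ cong (ρ ▹_) (equivariant x σ) ⟨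
      ρ ▹ to (x , σ)          ∎
      where open ≡-Reasoning

  open G public using (to; from)

  infix  4 _≈_ _≟_
  infixl 7 _∙_

  _≈_ : G → G → Set
  g ≈ h = ∀ e → to g e ≡ to h e

  ε : G
  ε = record
    { permutation = ↔-id E
    ; equivariant = λ x ρ → cong (x ,_) (sym (C.identityʳ ρ))
    }

  _∙_ : G → G → G
  g ∙ h = record
    { permutation = G.permutation g ↔-∘ G.permutation h
    ; equivariant = λ x ρ → trans (cong (to g) (G.equivariant h x ρ)) (G.equivariant′ g ρ _)
    }

  _⁻¹ : G → G
  g ⁻¹ = record
    { permutation = ↔-sym (G.permutation g)
    ; equivariant = λ x ρ → begin
        from g (x , ρ)                           ≡⟨ cong (λ σ → from g (x , σ)) (C.identityʳ ρ) ⟨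
        from g (ρ ▹ (x , 1ᶜ))                    ≡⟨ cong (λ e → from g (ρ ▹ e)) (G.strictlyInverseˡ g _) ⟨
        from g (ρ ▹ to g (from g (x , 1ᶜ)))      ≡⟨ cong (from g) (G.equivariant′ g ρ _) ⟨
        from g (to g (ρ ▹ from g (x , 1ᶜ)))      ≡⟨ G.strictlyInverseʳ g _ ⟩
        ρ ▹ from g (x , 1ᶜ)                      ∎
    }
    where open ≡-Reasoning

  group : Group 0ℓ 0ℓ
  group = record
    { Carrier = G
    ; _≈_     = _≈_
    ; _∙_     = _∙_
    ; ε       = ε
    ; _⁻¹     = _⁻¹
    ; isGroup = record
      { isMonoid = record
        { isSemigroup = record
          { isMagma = record
            { isEquivalence = record
              { refl  = λ _ → refl
              ; sym   = λ p e → sym (p e)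
              ; trans = λ p q e → trans (p e) (q e)
              }
            ; ∙-cong = λ {g} p q e → trans (cong (to g) (q e)) (p _)
            }
          ; assoc = λ _ _ _ _ → refl
          }
        ; identity = (λ _ _ → refl) , (λ _ _ → refl)
        }
      ; inverse = G.strictlyInverseʳ , G.strictlyInverseˡ
      ; ⁻¹-cong = λ {g} {h} p e → begin
          from g e                    ≡⟨ cong (from g) (G.strictlyInverseˡ h e) ⟨
          from g (to h (from h e))    ≡⟨ cong (from g) (p (from h e)) ⟨
          from g (to g (from h e))    ≡⟨ G.strictlyInverseʳ g _ ⟩
          from h e                    ∎
      }
    }
    where open ≡-Reasoning

  open import Algebra.Definitions.RawMonoid (Group.rawMonoid group) using () renaming (_×_ to _times_)

  infixr 8 _^_

  _^_ : G → ℕ → G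
  g ^ k = k times g

  product : List G → G
  product = foldr _∙_ ε

  _≟ᴱ_ : (e e′ : E) → Dec (e ≡ e′)
  _≟ᴱ_ = ×ₚ.≡-dec Finₚ._≟_ Finₚ._≟_

  allᴱ? : ∀ {P : E → Set} → (∀ e → Dec (P e)) → Dec (∀ e → P e)
  allᴱ? P? = map′ (λ f (x , ρ) → f x ρ) (λ f x ρ → f (x , ρ))
                  (Finₚ.all? λ x → Finₚ.all? λ ρ → P? (x , ρ))

  _≟_ : (g h : G) → Dec (g ≈ h)
  g ≟ h = allᴱ? λ e → to g e ≟ᴱ to h e

  decSetoid : DecSetoid 0ℓ 0ℓ
  decSetoid = record
    { isDecEquivalence = record { isEquivalence = Group.isEquivalence group ; _≟_ = _≟_ } }

  fixedPoints : G → ℕ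
  fixedPoints g = length (filter (λ x → to g (x , 1ᶜ) ≟ᴱ (x , 1ᶜ)) (allFin n))

  -- The element is determined by the images v x of the (x , 1), and is a
  -- permutation as soon as it has an inverse, which is similarly given by w.
  private
    extend : (Fin n → E) → E → E
    extend v (x , ρ) = ρ ▹ v x

    Code : Set
    Code = Fin ((n ℕ.* m) ℕ.^ n)

    images : Code → Fin n → E
    images k = remQuot m ∘ finToFun k

    code : G → Code
    code g = funToFin (λ x → let (y , ρ) = to g (x , 1ᶜ) in combine y ρ)

    extend-code : ∀ g e → extend (images (code g)) e ≡ to g e
    extend-code g (x , ρ) = begin
      ρ ▹ remQuot m (finToFun (code g) x)  ≡⟨ cong (λ k → ρ ▹ remQuot m k) (Finₚ.finToFun-funToFin _ x) ⟩
      ρ ▹ remQuot m (combine (proj₁ (to g (x , 1ᶜ))) (proj₂ (to g (x , 1ᶜ))))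
                                           ≡⟨ cong (ρ ▹_) (Finₚ.remQuot-combine {n} {m} (proj₁ (to g (x , 1ᶜ))) _) ⟩
      ρ ▹ to g (x , 1ᶜ)                    ≡⟨ G.equivariant g x ρ ⟨
      to g (x , ρ)                         ∎
      where open ≡-Reasoning

    MutuallyInverse : Code × Code → Set
    MutuallyInverse (k , l) =
      (∀ e → extend (images k) (extend (images l) e) ≡ e) ×
      (∀ e → extend (images l) (extend (images k) e) ≡ e)

    mutuallyInverse? : ∀ kl → Dec (MutuallyInverse kl)
    mutuallyInverse? (k , l) =
      allᴱ? (λ e → extend (images k) (extend (images l) e) ≟ᴱ e) ×-dec
      allᴱ? (λ e → extend (images l) (extend (images k) e) ≟ᴱ e)

    decode : Code × Code → G
    decode (k , l) with mutuallyInverse? (k , l)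
    ... | no  _       = ε
    ... | yes (p , q) = record
      { permutation = mk↔ₛ′ (extend (images k)) (extend (images l)) p q
      ; equivariant = λ x ρ → cong (ρ ▹_) (sym (▹-identity _))
      }

    decode-code : ∀ g → g ≈ decode (code g , code (g ⁻¹))
    decode-code g with mutuallyInverse? (code g , code (g ⁻¹))
    ... | yes _ = λ e → sym (extend-code g e)
    ... | no ¬p = contradiction
      ( (λ e → trans (extend-code g _) (trans (cong (to g) (extend-code (g ⁻¹) e)) (G.strictlyInverseˡ g e)))
      , (λ e → trans (extend-code (g ⁻¹) _) (trans (cong (from g) (extend-code g e)) (G.strictlyInverseʳ g e)))
      ) ¬p

    decoded : List G
    decoded = map decode (cartesianProduct (allFin _) (allFin _))

  elements : List G
  elements = deduplicate _≟_ decoded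

  elements-enumeration : Enumerates.IsEnumeration (Group.setoid group) elements
  elements-enumeration = Enumeratesₚ.deduplicate⁺ decSetoid λ g →
    Anyₚ.map⁺ (Any.map (λ { refl → decode-code g })
      (∈-cartesianProduct⁺ (∈-allFin (code g)) (∈-allFin (code (g ⁻¹)))))

  elements-unique : Unique.Unique (Group.setoid group) elements
  elements-unique = Uniqueₚ.deduplicate-! decSetoid decoded

  #withFixedPoints : ℕ → ℕ
  #withFixedPoints i = length (filter (λ g → fixedPoints g ℕₚ.≟ i) elements)

  -- (x , 1) ↦ (π x , c x)
  monomial : Permutation′ n → (Fin n → C) → G
  monomial π c = record
    { permutation = mk↔ₛ′
        (λ (x , ρ) → π ⟨$⟩ʳ x , ρ ∙ᶜ c x)
        (λ (y , ρ) → π ⟨$⟩ˡ y , ρ ∙ᶜ c (π ⟨$⟩ˡ y) ⁻¹ᶜ)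
        (λ (y , ρ) → cong₂ _,_ (Perm.inverseʳ π) (cancelʳ ρ _))
        (λ (x , ρ) → cong₂ _,_ (Perm.inverseˡ π)
          (trans (cong (λ z → ρ ∙ᶜ c x ∙ᶜ c z ⁻¹ᶜ) (Perm.inverseˡ π)) (cancelˡ ρ (c x))))
    ; equivariant = λ x ρ → cong (π ⟨$⟩ʳ x ,_) (cong (ρ ∙ᶜ_) (sym (C.identityˡ (c x))))
    }
    where
    cancelʳ : ∀ ρ σ → ρ ∙ᶜ σ ⁻¹ᶜ ∙ᶜ σ ≡ ρ
    cancelʳ ρ σ = trans (C.assoc ρ _ σ) (trans (cong (ρ ∙ᶜ_) (C.inverseˡ σ)) (C.identityʳ ρ))

    cancelˡ : ∀ ρ σ → ρ ∙ᶜ σ ∙ᶜ σ ⁻¹ᶜ ≡ ρ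
    cancelˡ ρ σ = trans (C.assoc ρ σ _) (trans (cong (ρ ∙ᶜ_) (C.inverseʳ σ)) (C.identityʳ ρ))

d : (m : ℕ) .{{_ : NonZero m}} → ℕ → ℕ
d m n = ReflectionGroup.#withFixedPoints m n 0

-- With 1-based numbering, s i and t i are s_{i+1} and t_{i+1}.
module Generators (m : ℕ) .{{_ : NonZero m}} (n : ℕ) where

  open ReflectionGroup m (suc n)

  s : Fin n → G
  s i = monomial (transpose (inject₁ i) (suc i)) (λ _ → 1ᶜ)

  t₁ : G
  t₁ = monomial Perm.id λ { zero → γ ; (suc _) → 1ᶜ }

  t : Fin (suc n) → G
  t = fold′ (λ _ → G) (λ i tᵢ → s i ∙ tᵢ ∙ s i) t₁

module _ (m : ℕ) .{{_ : NonZero m}} (n : ℕ) where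

  private
    module RG = ReflectionGroup m n
    module ℤ[] = GroupRing ℤₚ.+-*-commutativeRing RG.group RG._≟_
    module ℚ[] = GroupRing ℚₚ.+-*-commutativeRing RG.group RG._≟_

  ℤG : Set
  ℤG = ℤ[].R[G]

  ℚG : Set
  ℚG = ℚ[].R[G]

  ℚG-leftModule : LeftModule ℚₚ.+-*-ring 0ℓ 0ℓ
  ℚG-leftModule = ℚ[].leftModule

  ℤG⇒ℚG : ℤG → ℚG
  ℤG⇒ℚG = map (map₁ (ℚ._/ 1))

  -- The ℚ-linear extension of a ℤ-linear operator.
  extendScalars : (ℤG → ℤG) → ℚG → ℚG
  extendScalars f = concatMap λ (q , g) → q ℚ[].· ℤG⇒ℚG (f ℤ[].⟦ g ⟧)

module _ (m : ℕ) .{{_ : NonZero m}} where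

  -- The suffixes of s₁ ⋯ s_{n-1} are 1, s_{n-1}, s_{n-2} s_{n-1}, …, s₁ ⋯ s_{n-1}.
  Sh : (n : ℕ) .{{_ : NonZero n}} → ℤG m n
  Sh (suc n) = Σᴳ (map product (tails (tabulate s))) *ᴳ Σᴳ (applyUpTo (t (fromℕ n) ^_) m)
    where
    open ReflectionGroup m (suc n)
    open Generators m n
    open GroupRing ℤₚ.+-*-commutativeRing group _≟_

  L : (n : ℕ) .{{_ : NonZero n}} → ℤG m n → ℤG m n
  L n y = Sh n *ᴳ y
    where
    open ReflectionGroup m n using (group; _≟_)
    open GroupRing ℤₚ.+-*-commutativeRing group _≟_

{-# OPTIONS --safe #-}

-- Write h(p,ρ) for the element s_p ⋯ s_{n-1} t_nʲ with γʲ = ρ, so that left multiplication by the shuffle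
-- element sends f : G → ℚ to g ↦ Σ f (h(p,ρ)⁻¹ g).  Let bₖ be the sum of all g for which (1 , 1), …, (n-k , 1)
-- have uncoloured images in increasing order.  Moving one card shows Sh bₖ = km bₖ + bₖ₊₁ for k < n and
-- Sh bₙ = nm bₙ, while b₀ = 1; hence the pᵢ = Σₖ (-1)^(k-i) (k C i) / (mᵏ k!) bₖ satisfy Sh pᵢ = im pᵢ and
-- Σᵢ pᵢ = 1.  The right translates of the pᵢ therefore span the group algebra, the eigenspace of im is the
-- image of left multiplication by pᵢ, and its dimension is the trace |G| pᵢ(1) of that idempotent.
--
-- Counting pairs of an element and one of its fixed points shows that the number Nᵢ(n) of elements with i fixed
-- points satisfies (i+1) Nᵢ₊₁(n+1) = (n+1) Nᵢ(n).  The traces satisfy the same recurrence and, for every n, have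
-- the same sum |G| over all i, so they agree with the Nᵢ(n); the recurrence also gives Nᵢ(n) = (n C i) d(m,n-i).
module Submission where

open import Defs using (module LinearAlgebra; module GroupRing; module Cyclic; module ReflectionGroup; module Generators)
open import Algebra.Bundles using (CommutativeRing; Group)
import Algebra.Definitions.RawMonoid
open import Algebra.Module.Bundles using (LeftModule)
open import Data.Bool.Base using (Bool; true; false; if_then_else_)
open import Data.Fin.Base as Fin using (Fin; zero; suc; toℕ; fromℕ; fromℕ<; inject₁; punchIn; punchOut; splitAt; fold′; _↑ˡ_; _↑ʳ_)
open import Data.Fin.Induction using (<-weakInduction; >-weakInduction)
open import Data.Fin.Permutation as Perm using (Permutation′; transpose; permutation; _⟨$⟩ʳ_)
import Data.Fin.Properties as Finₚ
open import Data.Integer.Base as ℤ using (ℤ; +_)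
import Data.Integer.Properties as ℤₚ
open import Data.List.Base as List using (List; []; _∷_; length; filter; lookup; tabulate; map; tails; applyUpTo; allFin)
open import Data.List.Membership.Propositional.Properties using (∈-lookup)
import Data.List.Properties as Listₚ
import Data.List.Relation.Unary.All as All
open import Data.List.Relation.Unary.AllPairs using (_∷_)
import Data.List.Relation.Unary.Any as Any
import Data.List.Relation.Unary.Any.Properties as Anyₚ
import Data.List.Relation.Unary.Enumerates.Setoid as Enumerates
import Data.List.Relation.Unary.Unique.Setoid as Unique
open import Data.Nat.Base as ℕ using (ℕ; zero; suc; NonZero)
import Data.Nat.DivMod as ℕ
import Data.Nat.Properties as ℕₚ
open import Data.Product.Base using (∃-syntax; Σ-syntax; _×_; _,_; proj₁; proj₂)
open import Data.Rational.Base as ℚ using (ℚ; 0ℚ; 1ℚ)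
import Data.Rational.Properties as ℚₚ
import Data.Rational.Unnormalised.Base as ℚᵘ
import Data.Rational.Unnormalised.Properties as ℚᵘₚ
open import Data.Sum.Base using (_⊎_; inj₁; inj₂; [_,_]′)
open import Data.Vec.Functional as Vector using (Vector; _++_; removeAt; insertAt)
import Data.Vec.Functional.Properties as Vectorₚ
open import Function.Base using (_∘_; id; case_of_)
open import Function.Bundles using (_⇔_; mk⇔)
open import Level using (Level; _⊔_; 0ℓ)
open import Relation.Binary.Bundles using (DecSetoid)
open import Relation.Binary.Definitions using (Decidable)
open import Relation.Binary.PropositionalEquality using (_≡_; _≢_; module ≡-Reasoning)
import Relation.Binary.PropositionalEquality as ≡
open import Relation.Nullary using (¬_; Dec; does; yes; no; ¬?; contradiction; decidable-stable; _×-dec_; _→-dec_)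
open import Relation.Nullary.Decidable using (dec-true; dec-false; does-⇔)
open import Relation.Unary using (Pred)
import Relation.Unary

private
  variable
    a b ℓ ℓ′ ℓ₁ : Level
    n : ℕ

-- The pᵢ are never multiplied with one another. That they act as projections comes from Σᵢ pᵢ = 1
-- together with the independence of eigenvectors for distinct eigenvalues, so a basis of each
-- eigenspace can be extracted from translates by elimination. Closed forms are avoided too: neither
-- |G| = mⁿ n! nor an alternating sum for pᵢ(1) or for the derangement numbers is evaluated. A
-- recurrence that raises n and i together never reaches i = 0, which is why totals over i are
-- compared. It descends to the trivial group G(m,1,0), so the counting includes n = 0 although the
-- operator starts at n = 1. The field is abstract: decidable equality finds pivots, inverses define
-- the coefficients, and characteristic zero keeps the numbers im apart and lets identities between
-- natural numbers be proved in the field.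

record Field (a ℓ : Level) : Set (Level.suc (a ⊔ ℓ)) where
  field
    commutativeRing : CommutativeRing a ℓ
  open CommutativeRing commutativeRing public hiding (zero)
  field
    _≟_                 : Decidable _≈_
    inverse             : ∀ x → ¬ x ≈ 0# → ∃[ y ] (y * x ≈ 1#)
    characteristic-zero : ∀ k → Algebra.Definitions.RawMonoid._×_ +-rawMonoid k 1# ≈ 0# → k ≡ 0
  open import Algebra.Properties.Semiring.Mult semiring public
    using (×-homo-+; ×1-homo-*) renaming (_×_ to _times_)
  open import Algebra.Properties.Semiring.Sum semiring public
    using (sum; sum-cong-≋; ∑-distrib-+; ∑-comm; sum-remove; sum-permute; sum-replicate; sum-replicate-zero;
           sum-init-last; *-distribˡ-sum; *-distribʳ-sum)

-- Indicators and finite sums in a commutative ring.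

module _ {R : CommutativeRing a ℓ} where
  open CommutativeRing R hiding (zero)
  open import Algebra.Properties.Semiring.Sum semiring
  open import Algebra.Properties.Ring ring using (-‿distribˡ-*)
  open import Relation.Binary.Reasoning.Setoid setoid

  -- Branching on `does` gives it the shape of the summands of `coefficient`, so coefficients of
  -- lists and sums of indicators can be matched.
  indicator : ∀ {P : Set ℓ₁} → Dec P → Carrier
  indicator P? = if does P? then 1# else 0#

  sum-zero : ∀ {n} {f : Vector Carrier n} → (∀ i → f i ≈ 0#) → sum f ≈ 0#
  sum-zero {n} f≈0 = trans (sum-cong-≋ f≈0) (sum-replicate-zero n)

  sum-single : ∀ {n} {f : Vector Carrier n} i → (∀ j → j ≢ i → f j ≈ 0#) → sum f ≈ f i
  sum-single {suc n} {f} i f≈0 = begin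
    sum f                      ≈⟨ sum-remove {i = i} f ⟩
    f i + sum (removeAt f i)   ≈⟨ +-congˡ (sum-zero λ j → f≈0 _ (Finₚ.punchInᵢ≢i i j)) ⟩
    f i + 0#                   ≈⟨ +-identityʳ (f i) ⟩
    f i                        ∎

  indicator-yes : ∀ {P : Set ℓ₁} (P? : Dec P) → P → indicator P? ≈ 1#
  indicator-yes (yes _) _ = refl
  indicator-yes (no ¬p) p = contradiction p ¬p

  indicator-no : ∀ {P : Set ℓ₁} (P? : Dec P) → ¬ P → indicator P? ≈ 0#
  indicator-no (yes p) ¬p = contradiction p ¬p
  indicator-no (no _)  _  = refl

  kronecker : ∀ {n} → Fin n → Fin n → Carrier
  kronecker i j = indicator (i Finₚ.≟ j)

  -- The pivot step of elimination: `p` is the pivot entry, `s` its inverse, and `x * s` the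
  -- multiple of the pivot that clears the entry `x`.
  x+-[xs]p≈0 : ∀ {p s} x → s * p ≈ 1# → x + - (x * s) * p ≈ 0#
  x+-[xs]p≈0 {p} {s} x sp≈1 = begin
    x + - (x * s) * p    ≈⟨ +-congˡ (-‿distribˡ-* _ _) ⟨
    x + - (x * s * p)    ≈⟨ +-congˡ (-‿cong (trans (*-assoc _ _ _) (trans (*-congˡ sp≈1) (*-identityʳ x)))) ⟩
    x + - x              ≈⟨ -‿inverseʳ x ⟩
    0#                   ∎

  *-cancelʳ-invertible : ∀ {p s} x → s * p ≈ 1# → x * p ≈ 0# → x ≈ 0#
  *-cancelʳ-invertible {p} {s} x sp≈1 xp≈0 = begin
    x            ≈⟨ *-identityʳ x ⟨
    x * 1#       ≈⟨ *-congˡ (trans (*-comm p s) sp≈1) ⟨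
    x * (p * s)  ≈⟨ *-assoc x p s ⟨
    x * p * s    ≈⟨ *-congʳ xp≈0 ⟩
    0# * s       ≈⟨ zeroˡ s ⟩
    0#           ∎

-- Linear combinations, functionals and operators.

module Combinations {R : CommutativeRing a ℓ} (M : LeftModule (CommutativeRing.ring R) b ℓ′) where

  open CommutativeRing R hiding (zero)
  open LeftModule M renaming (Carrierᴹ to V)
  open LinearAlgebra M public
  open import Algebra.Properties.Semiring.Sum semiring
  import Algebra.Properties.CommutativeMonoid.Sum +ᴹ-commutativeMonoid as Sumᴹ
  open import Relation.Binary.Reasoning.Setoid ≈ᴹ-setoid

  record Subspace (U : Pred V ℓ₁) : Set (a ⊔ b ⊔ ℓ₁) where
    field
      +-closed : ∀ {u v} → U u → U v → U (u +ᴹ v)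
      *-closed : ∀ {v} r → U v → U (r *ₗ v)

  record Functional (φ : V → Carrier) : Set (a ⊔ ℓ ⊔ b ⊔ ℓ′) where
    field
      φ-cong : ∀ {u v} → u ≈ᴹ v → φ u ≈ φ v
      φ-+    : ∀ u v → φ (u +ᴹ v) ≈ φ u + φ v
      φ-*    : ∀ r v → φ (r *ₗ v) ≈ r * φ v

    φ-0 : φ 0ᴹ ≈ 0#
    φ-0 = trans (φ-cong (≈ᴹ-sym (*ₗ-zeroˡ 0ᴹ))) (trans (φ-* 0# 0ᴹ) (zeroˡ _))

    φ-sum : ∀ {k} (vs : Vector V k) → φ (Sumᴹ.sum vs) ≈ sum (φ ∘ vs)
    φ-sum {zero}  vs = φ-0
    φ-sum {suc k} vs = trans (φ-+ _ _) (+-congˡ (φ-sum (vs ∘ suc)))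

    φ-combination : ∀ {k} c (vs : Vector V k) → φ (linearCombination c vs) ≈ sum (λ j → c j * φ (vs j))
    φ-combination c vs = trans (φ-sum (λ j → c j *ₗ vs j)) (sum-cong-≋ λ j → φ-* (c j) (vs j))

  record Operator (f : V → V) : Set (a ⊔ b ⊔ ℓ′) where
    field
      f-cong : ∀ {u v} → u ≈ᴹ v → f u ≈ᴹ f v
      f-+    : ∀ u v → f (u +ᴹ v) ≈ᴹ f u +ᴹ f v
      f-*    : ∀ r v → f (r *ₗ v) ≈ᴹ r *ₗ f v

    f-0 : f 0ᴹ ≈ᴹ 0ᴹ
    f-0 = ≈ᴹ-trans (f-cong (≈ᴹ-sym (*ₗ-zeroˡ 0ᴹ))) (≈ᴹ-trans (f-* 0# 0ᴹ) (*ₗ-zeroˡ _))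

    f-sum : ∀ {k} (vs : Vector V k) → f (Sumᴹ.sum vs) ≈ᴹ Sumᴹ.sum (f ∘ vs)
    f-sum {zero}  vs = f-0
    f-sum {suc k} vs = ≈ᴹ-trans (f-+ _ _) (+ᴹ-congˡ (f-sum (vs ∘ suc)))

  *ₗ-comm : ∀ r s v → r *ₗ s *ₗ v ≈ᴹ s *ₗ r *ₗ v
  *ₗ-comm r s v = ≈ᴹ-trans (≈ᴹ-sym (*ₗ-assoc r s v)) (≈ᴹ-trans (*ₗ-congʳ (*-comm r s)) (*ₗ-assoc s r v))

  combination-cong : ∀ {k} {c d : Vector Carrier k} {vs ws : Vector V k} →
    (∀ j → c j ≈ d j) → (∀ j → vs j ≈ᴹ ws j) → linearCombination c vs ≈ᴹ linearCombination d ws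
  combination-cong c≈d vs≈ws = Sumᴹ.sum-cong-≋ λ j → *ₗ-cong (c≈d j) (vs≈ws j)

  combination-zero : ∀ {k} {c : Vector Carrier k} (vs : Vector V k) → (∀ j → c j ≈ 0#) → linearCombination c vs ≈ᴹ 0ᴹ
  combination-zero {zero}  vs c≈0 = ≈ᴹ-refl
  combination-zero {suc k} vs c≈0 =
    ≈ᴹ-trans (+ᴹ-cong (≈ᴹ-trans (*ₗ-congʳ (c≈0 zero)) (*ₗ-zeroˡ _)) (combination-zero (vs ∘ suc) (c≈0 ∘ suc))) (+ᴹ-identityˡ _)

  combination-+ : ∀ {k} (c d : Vector Carrier k) (vs : Vector V k) →
    linearCombination (λ j → c j + d j) vs ≈ᴹ linearCombination c vs +ᴹ linearCombination d vs
  combination-+ c d vs = ≈ᴹ-trans (Sumᴹ.sum-cong-≋ λ j → *ₗ-distribʳ (vs j) (c j) (d j)) (Sumᴹ.∑-distrib-+ (λ j → c j *ₗ vs j) (λ j → d j *ₗ vs j))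

  *ₗ-sum : ∀ {k} r (vs : Vector V k) → r *ₗ Sumᴹ.sum vs ≈ᴹ Sumᴹ.sum (λ j → r *ₗ vs j)
  *ₗ-sum {zero}  r vs = *ₗ-zeroʳ r
  *ₗ-sum {suc k} r vs = ≈ᴹ-trans (*ₗ-distribˡ r _ _) (+ᴹ-congˡ (*ₗ-sum r (vs ∘ suc)))

  sum-*ₗ : ∀ {k} (c : Vector Carrier k) v → sum c *ₗ v ≈ᴹ Sumᴹ.sum (λ j → c j *ₗ v)
  sum-*ₗ {zero}  c v = *ₗ-zeroˡ v
  sum-*ₗ {suc k} c v = ≈ᴹ-trans (*ₗ-distribʳ v _ _) (+ᴹ-congˡ (sum-*ₗ (c ∘ suc) v))

  combination-* : ∀ {k} r (c : Vector Carrier k) (vs : Vector V k) →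
    linearCombination (λ j → r * c j) vs ≈ᴹ r *ₗ linearCombination c vs
  combination-* r c vs = ≈ᴹ-trans (Sumᴹ.sum-cong-≋ λ j → *ₗ-assoc r (c j) (vs j)) (≈ᴹ-sym (*ₗ-sum r (λ j → c j *ₗ vs j)))

  combination-kronecker : ∀ {k} (vs : Vector V k) i → linearCombination (kronecker {R = R} i) vs ≈ᴹ vs i
  combination-kronecker {suc k} vs i = begin
    linearCombination (kronecker {R = R} i) vs                    ≈⟨ Sumᴹ.sum-remove {i = i} (λ j → kronecker {R = R} i j *ₗ vs j) ⟩
    kronecker {R = R} i i *ₗ vs i +ᴹ linearCombination (kronecker {R = R} i ∘ punchIn i) (removeAt vs i)
      ≈⟨ +ᴹ-cong (≈ᴹ-trans (*ₗ-congʳ (indicator-yes {R = R} (i Finₚ.≟ i) ≡.refl)) (*ₗ-identityˡ _))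
                 (combination-zero (removeAt vs i) λ j → indicator-no {R = R} (i Finₚ.≟ _) (Finₚ.punchInᵢ≢i i j ∘ ≡.sym)) ⟩
    vs i +ᴹ 0ᴹ                                            ≈⟨ +ᴹ-identityʳ _ ⟩
    vs i                                                  ∎

  combination-combination : ∀ {k l} (x : Vector Carrier k) (C : Fin k → Vector Carrier l) (ws : Vector V l) →
    linearCombination x (λ i → linearCombination (C i) ws) ≈ᴹ linearCombination (λ j → sum (λ i → x i * C i j)) ws
  combination-combination x C ws = begin
    linearCombination x (λ i → linearCombination (C i) ws)       ≈⟨ Sumᴹ.sum-cong-≋ (λ i → ≈ᴹ-sym (combination-* (x i) (C i) ws)) ⟩
    Sumᴹ.sum (λ i → linearCombination (λ j → x i * C i j) ws)    ≈⟨ Sumᴹ.∑-comm (λ i j → (x i * C i j) *ₗ ws j) ⟩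
    Sumᴹ.sum (λ j → Sumᴹ.sum λ i → (x i * C i j) *ₗ ws j)        ≈⟨ Sumᴹ.sum-cong-≋ (λ j → ≈ᴹ-sym (sum-*ₗ (λ i → x i * C i j) (ws j))) ⟩
    linearCombination (λ j → sum (λ i → x i * C i j)) ws         ∎

  _∈Span_ : ∀ {k} → V → Vector V k → Set (a ⊔ ℓ′)
  v ∈Span vs = ∃[ c ] v ≈ᴹ linearCombination c vs

  combination∈Span : ∀ {k l} (x : Vector Carrier k) {vs : Vector V k} {ws : Vector V l} →
    (∀ i → vs i ∈Span ws) → linearCombination x vs ∈Span ws
  combination∈Span x vs∈ws = _ ,
    ≈ᴹ-trans (combination-cong (λ _ → refl) (proj₂ ∘ vs∈ws)) (combination-combination x (proj₁ ∘ vs∈ws) _)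

  combination∈U : ∀ {U : Pred V ℓ₁} → Subspace U → U 0ᴹ → ∀ {k} (x : Vector Carrier k) {vs : Vector V k} →
    (∀ j → U (vs j)) → U (linearCombination x vs)
  combination∈U S U0 {zero}  x vs∈U = U0
  combination∈U S U0 {suc k} x vs∈U =
    Subspace.+-closed S (Subspace.*-closed S _ (vs∈U zero)) (combination∈U S U0 (x ∘ suc) (vs∈U ∘ suc))

  independent-unique : ∀ {k} {vs : Vector V k} → LinearlyIndependent vs → ∀ c d →
    linearCombination c vs ≈ᴹ linearCombination d vs → ∀ j → c j ≈ d j
  independent-unique {vs = vs} ind c d eq j =
    trans (inverseˡ-unique (c j) (- d j) (trans (+-congˡ (sym (-1*x≈-x (d j)))) (ind _ difference j)))
          (⁻¹-involutive (d j))
    where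
    open import Algebra.Properties.Ring ring using (-1*x≈-x)
    open import Algebra.Properties.Group +-group using (inverseˡ-unique; ⁻¹-involutive)
    -- The factor `- 1#` makes the subtracted family a scalar multiple, so that `combination-*` can
    -- pull it out.
    difference : linearCombination (λ i → c i + - 1# * d i) vs ≈ᴹ 0ᴹ
    difference = begin
      linearCombination (λ i → c i + - 1# * d i) vs                     ≈⟨ combination-+ c _ vs ⟩
      linearCombination c vs +ᴹ linearCombination (λ i → - 1# * d i) vs ≈⟨ +ᴹ-cong eq (combination-* (- 1#) d vs) ⟩
      linearCombination d vs +ᴹ - 1# *ₗ linearCombination d vs          ≈⟨ +ᴹ-congʳ (*ₗ-identityˡ _) ⟨
      1# *ₗ linearCombination d vs +ᴹ - 1# *ₗ linearCombination d vs    ≈⟨ *ₗ-distribʳ _ 1# (- 1#) ⟨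
      (1# + - 1#) *ₗ linearCombination d vs                             ≈⟨ *ₗ-congʳ (-‿inverseʳ 1#) ⟩
      0# *ₗ linearCombination d vs                                      ≈⟨ *ₗ-zeroˡ _ ⟩
      0ᴹ                                                                ∎

-- Elimination and decomposition into eigenspaces.

module Eigenspaces (F : Field a ℓ) (M : LeftModule (Field.ring F) b ℓ′) where

  open Field F
  open LeftModule M renaming (Carrierᴹ to V)
  open Combinations {R = commutativeRing} M public
  import Algebra.Properties.CommutativeMonoid.Sum +ᴹ-commutativeMonoid as Sumᴹ
  open import Algebra.Properties.Ring ring using (x∙y⁻¹≈ε⇒x≈y)
  open import Relation.Binary.Reasoning.Setoid ≈ᴹ-setoid

  1≉0 : ¬ 1# ≈ 0#
  1≉0 1≈0 with () ← characteristic-zero 1 (trans (+-identityʳ 1#) 1≈0)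

  *ₗ-cancel : ∀ {r v} → ¬ r ≈ 0# → r *ₗ v ≈ᴹ 0ᴹ → v ≈ᴹ 0ᴹ
  *ₗ-cancel {r} {v} r≉0 rv≈0 = let (s , sr≈1) = inverse r r≉0 in begin
    v             ≈⟨ *ₗ-identityˡ v ⟨
    1# *ₗ v       ≈⟨ *ₗ-congʳ sr≈1 ⟨
    (s * r) *ₗ v  ≈⟨ *ₗ-assoc s r v ⟩
    s *ₗ r *ₗ v   ≈⟨ *ₗ-congˡ rv≈0 ⟩
    s *ₗ 0ᴹ       ≈⟨ *ₗ-zeroʳ s ⟩
    0ᴹ            ∎

  independent⇒nonzero : ∀ {k} {vs : Vector V k} → LinearlyIndependent vs → ∀ j → vs j ≉ᴹ 0ᴹ
  independent⇒nonzero {vs = vs} ind j vsⱼ≈0 =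
    1≉0 (trans (sym (indicator-yes {R = commutativeRing} (j Finₚ.≟ j) ≡.refl))
               (ind (kronecker {R = commutativeRing} j) (≈ᴹ-trans (combination-kronecker vs j) vsⱼ≈0) j))

  hasDimension⇒nonzero : ∀ {U : Pred V ℓ₁} {k} → HasDimension U k → k ≢ 0 → ∃[ v ] (v ≉ᴹ 0ᴹ × U v)
  hasDimension⇒nonzero {k = zero}  _            k≢0 = contradiction ≡.refl k≢0
  hasDimension⇒nonzero {k = suc k} (vs , basis) _   =
    vs zero , independent⇒nonzero {vs = vs} (IsBasisOf.independent basis) zero , IsBasisOf.inside basis zero

  nonzero⇒dimension≢0 : ∀ {U : Pred V ℓ₁} {k v} → HasDimension U k → v ≉ᴹ 0ᴹ → U v → k ≢ 0
  nonzero⇒dimension≢0 {v = v} (vs , basis) v≉0 v∈U ≡.refl =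
    v≉0 (proj₂ (IsBasisOf.spanning basis v v∈U))

  -- Gaussian elimination, one coordinate functional at a time.
  extract-basis : ∀ n (φ : Fin n → V → Carrier) → (∀ i → Functional (φ i)) →
    (U : Pred V ℓ₁) → Subspace U → (∀ {u} → U u → (∀ i → φ i u ≈ 0#) → u ≈ᴹ 0ᴹ) →
    ∀ {k} (vs : Vector V k) → (∀ i → U (vs i)) →
    ∃[ l ] Σ[ ws ∈ Vector V l ] ((∀ j → U (ws j)) × LinearlyIndependent ws × (∀ i → vs i ∈Span ws))
  extract-basis zero φ lin U S faithful vs vs∈U =
    0 , (λ ()) , (λ ()) , (λ _ _ ()) , λ i → (λ ()) , faithful (vs∈U i) λ ()
  extract-basis (suc n) φ lin U S faithful {k} vs vs∈U = go (Finₚ.any? λ i → ¬? (φ zero (vs i) ≟ 0#))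
    where
    open Functional (lin zero)
    -- After the pivot everything happens in the kernel of `φ zero`, on which the remaining
    -- functionals still detect zero.
    U′ : Pred V _
    U′ v = U v × φ zero v ≈ 0#
    S′ : Subspace U′
    S′ = record
      { +-closed = λ (u , p) (v , q) → Subspace.+-closed S u v ,
                     trans (φ-+ _ _) (trans (+-cong p q) (+-identityˡ 0#))
      ; *-closed = λ r (v , p) → Subspace.*-closed S r v , trans (φ-* r _) (trans (*-congˡ p) (zeroʳ r))
      }
    recurse : ∀ {k} (vs : Vector V k) → (∀ i → U′ (vs i)) →
      ∃[ l ] Σ[ ws ∈ Vector V l ] ((∀ j → U′ (ws j)) × LinearlyIndependent ws × (∀ i → vs i ∈Span ws))
    recurse = extract-basis n (φ ∘ suc) (lin ∘ suc) U′ S′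
      (λ (u , p) q → faithful u λ { zero → p ; (suc i) → q i })
    go : Dec (∃[ i ] ¬ φ zero (vs i) ≈ 0#) → _
    go (no ¬pivot) =
      let (l , ws , ws∈U′ , rest) = recurse vs λ i → vs∈U i , decidable-stable (_ ≟ 0#) λ q → ¬pivot (i , q)
      in l , ws , proj₁ ∘ ws∈U′ , rest
    go (yes (i₀ , φv≉0)) = suc l , ws , ws∈U , ind , spans
      where
      v = vs i₀
      r = proj₁ (inverse _ φv≉0)
      q : Vector Carrier k
      q i = φ zero (vs i) * r
      reduced : Vector V k
      reduced i = vs i +ᴹ (- q i) *ₗ v
      reduced∈U′ : ∀ i → U′ (reduced i)
      reduced∈U′ i = Subspace.+-closed S (vs∈U i) (Subspace.*-closed S _ (vs∈U i₀)) ,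
        trans (trans (φ-+ _ _) (+-congˡ (φ-* _ _)))
              (x+-[xs]p≈0 {R = commutativeRing} _ (proj₂ (inverse _ φv≉0)))
      recursion = recurse reduced reduced∈U′
      l = proj₁ recursion
      ws′ = proj₁ (proj₂ recursion)
      ws′∈U′ = proj₁ (proj₂ (proj₂ recursion))
      ind′ = proj₁ (proj₂ (proj₂ (proj₂ recursion)))
      spans′ = proj₂ (proj₂ (proj₂ (proj₂ recursion)))
      ws : Vector V (suc l)
      ws = v Vector.∷ ws′
      ws∈U : ∀ j → U (ws j)
      ws∈U zero    = vs∈U i₀
      ws∈U (suc j) = proj₁ (ws′∈U′ j)
      ind : LinearlyIndependent ws
      ind c eq = λ { zero → c₀≈0 ; (suc j) → ind′ (c ∘ suc) tail≈0 j }
        where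
        -- `φ zero` kills every vector of `ws′`, so applying it to the relation leaves only `c zero`
        -- times the pivot entry.
        c₀≈0 : c zero ≈ 0#
        c₀≈0 = *-cancelʳ-invertible {R = commutativeRing} _ (proj₂ (inverse _ φv≉0))
          (trans (sym (+-identityʳ _))
          (trans (+-congˡ (sym (sum-zero {R = commutativeRing} λ j → trans (*-congˡ (proj₂ (ws′∈U′ j))) (zeroʳ _))))
          (trans (sym (φ-combination c ws)) (trans (φ-cong eq) φ-0))))
        tail≈0 : linearCombination (c ∘ suc) ws′ ≈ᴹ 0ᴹ
        tail≈0 = begin
          linearCombination (c ∘ suc) ws′                    ≈⟨ +ᴹ-identityˡ _ ⟨
          0ᴹ +ᴹ linearCombination (c ∘ suc) ws′              ≈⟨ +ᴹ-congʳ (≈ᴹ-trans (*ₗ-congʳ c₀≈0) (*ₗ-zeroˡ v)) ⟨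
          linearCombination c ws                             ≈⟨ eq ⟩
          0ᴹ                                                 ∎
      spans : ∀ i → vs i ∈Span ws
      spans i = q i Vector.∷ proj₁ (spans′ i) , (begin
        vs i                                     ≈⟨ +ᴹ-identityˡ _ ⟨
        0ᴹ +ᴹ vs i                               ≈⟨ +ᴹ-congʳ (≈ᴹ-trans (*ₗ-congʳ (-‿inverseʳ (q i))) (*ₗ-zeroˡ v)) ⟨
        (q i + - q i) *ₗ v +ᴹ vs i               ≈⟨ +ᴹ-congʳ (*ₗ-distribʳ v _ _) ⟩
        (q i *ₗ v +ᴹ (- q i) *ₗ v) +ᴹ vs i       ≈⟨ +ᴹ-assoc _ _ _ ⟩
        q i *ₗ v +ᴹ ((- q i) *ₗ v +ᴹ vs i)       ≈⟨ +ᴹ-congˡ (+ᴹ-comm _ _) ⟩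
        q i *ₗ v +ᴹ reduced i                    ≈⟨ +ᴹ-congˡ (proj₂ (spans′ i)) ⟩
        q i *ₗ v +ᴹ linearCombination (proj₁ (spans′ i)) ws′ ∎)

  -- Membership is existential in both directions, so no later argument computes with offsets. The
  -- last component cuts a coefficient vector into blocks and recovers its vanishing from that of
  -- the blocks, as the independence of a union of eigenbases requires.
  concatenate : ∀ {r} {l : Fin r → ℕ} (ws : ∀ i → Vector V (l i)) → ∃[ L ] Σ[ vs ∈ Vector V L ]
      ((∀ j → ∃[ i ] ∃[ j′ ] vs j ≡ ws i j′)
    × (∀ i j′ → ∃[ j ] vs j ≡ ws i j′)
    × (∀ c → Σ[ d ∈ (∀ i → Vector Carrier (l i)) ]
         (linearCombination c vs ≈ᴹ Sumᴹ.sum (λ i → linearCombination (d i) (ws i))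
        × ((∀ i j′ → d i j′ ≈ 0#) → ∀ j → c j ≈ 0#))))
  concatenate {zero}  ws = 0 , (λ ()) , (λ ()) , (λ ()) , λ c → (λ ()) , ≈ᴹ-refl , λ _ ()
  concatenate {suc r} {l} ws = l zero ℕ.+ L , vs , from-ws , to-ws , split
    where
    recursion = concatenate (λ i → ws (suc i))
    L = proj₁ recursion
    vs′ = proj₁ (proj₂ recursion)
    from-ws′ = proj₁ (proj₂ (proj₂ recursion))
    to-ws′ = proj₁ (proj₂ (proj₂ (proj₂ recursion)))
    split′ = proj₂ (proj₂ (proj₂ (proj₂ recursion)))
    vs : Vector V (l zero ℕ.+ L)
    vs = ws zero ++ vs′
    from-ws : ∀ j → ∃[ i ] ∃[ j′ ] vs j ≡ ws i j′
    from-ws j with splitAt (l zero) j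
    ... | inj₁ j′ = zero , j′ , ≡.refl
    ... | inj₂ j′ = let (i , k , eq) = from-ws′ j′ in suc i , k , eq
    to-ws : ∀ i j′ → ∃[ j ] vs j ≡ ws i j′
    to-ws zero    j′ = j′ ↑ˡ L , ≡.cong [ ws zero , vs′ ]′ (Finₚ.splitAt-↑ˡ (l zero) j′ L)
    to-ws (suc i) j′ = let (k , eq) = to-ws′ i j′ in
      l zero ↑ʳ k , ≡.trans (≡.cong [ ws zero , vs′ ]′ (Finₚ.splitAt-↑ʳ (l zero) L k)) eq
    combination-++ : ∀ {k k′} c (us : Vector V k) (us′ : Vector V k′) →
      linearCombination c (us ++ us′) ≈ᴹ
      linearCombination (λ j → c (j ↑ˡ k′)) us +ᴹ linearCombination (λ j → c (k ↑ʳ j)) us′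
    combination-++ {zero}  c us us′ = ≈ᴹ-sym (+ᴹ-identityˡ _)
    combination-++ {suc k} {k′} c us us′ = begin
      c zero *ₗ us zero +ᴹ linearCombination (c ∘ suc) (λ j → (us ++ us′) (suc j))
        ≈⟨ +ᴹ-congˡ (combination-cong (λ _ → refl) (λ j → ≈ᴹ-reflexive (tail-++ j))) ⟩
      c zero *ₗ us zero +ᴹ linearCombination (c ∘ suc) (us ∘ suc ++ us′)
        ≈⟨ +ᴹ-congˡ (combination-++ (c ∘ suc) (us ∘ suc) us′) ⟩
      c zero *ₗ us zero +ᴹ (_ +ᴹ _)
        ≈⟨ +ᴹ-assoc _ _ _ ⟨
      linearCombination (λ j → c (j ↑ˡ k′)) us +ᴹ linearCombination (λ j → c (suc k ↑ʳ j)) us′ ∎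
      where
      tail-++ : ∀ j → (us ++ us′) (suc j) ≡ (us ∘ suc ++ us′) j
      tail-++ j with splitAt k j
      ... | inj₁ _ = ≡.refl
      ... | inj₂ _ = ≡.refl
    split : ∀ c → _
    split c = d , ≈ᴹ-trans (combination-++ c (ws zero) vs′) (+ᴹ-congˡ (proj₁ (proj₂ (split′ _)))) , vanish
      where
      d : ∀ i → Vector Carrier (l i)
      d zero    j = c (j ↑ˡ L)
      d (suc i) = proj₁ (split′ (λ j → c (l zero ↑ʳ j))) i
      vanish : (∀ i j′ → d i j′ ≈ 0#) → ∀ j → c j ≈ 0#
      vanish d≈0 j with splitAt (l zero) j in eq
      ... | inj₁ k = ≡.subst (λ j → c j ≈ 0#) (Finₚ.splitAt⁻¹-↑ˡ eq) (d≈0 zero k)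
      ... | inj₂ k = ≡.subst (λ j → c j ≈ 0#) (Finₚ.splitAt⁻¹-↑ʳ eq)
                       (proj₂ (proj₂ (split′ (λ j → c (l zero ↑ʳ j)))) (λ i → d≈0 (suc i)) k)

  module _ {f : V → V} (f-operator : Operator f) where

    open Operator f-operator

    eigenspace-subspace : ∀ μ → Subspace (Eigenspace f μ)
    eigenspace-subspace μ = record
      { +-closed = λ {u} {v} fu fv → ≈ᴹ-trans (f-+ u v) (≈ᴹ-trans (+ᴹ-cong fu fv) (≈ᴹ-sym (*ₗ-distribˡ μ u v)))
      ; *-closed = λ {v} r fv → ≈ᴹ-trans (f-* r v) (≈ᴹ-trans (*ₗ-congˡ fv) (*ₗ-comm r μ v))
      }

    eigenspace-0 : ∀ μ → Eigenspace f μ 0ᴹ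
    eigenspace-0 μ = ≈ᴹ-trans f-0 (≈ᴹ-sym (*ₗ-zeroʳ μ))

    -- The operator `f - μ` scales the i-th eigenvector by `λs i - μ`.
    sum-shifted : ∀ {k} {λs : Vector Carrier k} {us : Vector V k} → (∀ i → Eigenspace f (λs i) (us i)) → ∀ μ →
      linearCombination (λ i → λs i - μ) us ≈ᴹ f (Sumᴹ.sum us) +ᴹ (- μ) *ₗ Sumᴹ.sum us
    sum-shifted {λs = λs} {us} eigen μ = begin
      linearCombination (λ i → λs i - μ) us                             ≈⟨ combination-+ λs (λ _ → - μ) us ⟩
      linearCombination λs us +ᴹ linearCombination (λ _ → - μ) us
        ≈⟨ +ᴹ-cong (Sumᴹ.sum-cong-≋ eigen) (*ₗ-sum (- μ) us) ⟨
      Sumᴹ.sum (f ∘ us) +ᴹ (- μ) *ₗ Sumᴹ.sum us                         ≈⟨ +ᴹ-congʳ (f-sum us) ⟨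
      f (Sumᴹ.sum us) +ᴹ (- μ) *ₗ Sumᴹ.sum us                           ∎

    cancel : ∀ μ v → μ *ₗ v +ᴹ (- μ) *ₗ v ≈ᴹ 0ᴹ
    cancel μ v = ≈ᴹ-trans (≈ᴹ-sym (*ₗ-distribʳ v μ (- μ))) (≈ᴹ-trans (*ₗ-congʳ (-‿inverseʳ μ)) (*ₗ-zeroˡ v))

    -- Applying `f - λs zero` to the vanishing sum deletes the first vector and rescales the others
    -- by nonzero differences. The others vanish by induction, and then so does the first.
    eigenspaces-independent : ∀ {k} {λs : Vector Carrier k} → (∀ {i j} → λs i ≈ λs j → i ≡ j) →
      ∀ {us : Vector V k} → (∀ i → Eigenspace f (λs i) (us i)) → Sumᴹ.sum us ≈ᴹ 0ᴹ → ∀ i → us i ≈ᴹ 0ᴹ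
    eigenspaces-independent {suc k} {λs} distinct {us} eigen sum≈0 = λ { zero → head≈0 ; (suc i) → tail≈0 i }
      where
      shifted≈0 : linearCombination (λ i → λs (suc i) - λs zero) (us ∘ suc) ≈ᴹ 0ᴹ
      shifted≈0 = begin
        linearCombination (λ i → λs (suc i) - λs zero) (us ∘ suc)      ≈⟨ +ᴹ-identityˡ _ ⟨
        0ᴹ +ᴹ linearCombination (λ i → λs (suc i) - λs zero) (us ∘ suc)
          ≈⟨ +ᴹ-congʳ (≈ᴹ-trans (*ₗ-congʳ (-‿inverseʳ (λs zero))) (*ₗ-zeroˡ _)) ⟨
        linearCombination (λ i → λs i - λs zero) us                    ≈⟨ sum-shifted eigen (λs zero) ⟩
        f (Sumᴹ.sum us) +ᴹ (- λs zero) *ₗ Sumᴹ.sum us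
          ≈⟨ +ᴹ-cong (≈ᴹ-trans (f-cong sum≈0) f-0) (≈ᴹ-trans (*ₗ-congˡ sum≈0) (*ₗ-zeroʳ _)) ⟩
        0ᴹ +ᴹ 0ᴹ                                                       ≈⟨ +ᴹ-identityˡ _ ⟩
        0ᴹ                                                             ∎
      tail≈0 : ∀ i → us (suc i) ≈ᴹ 0ᴹ
      tail≈0 i = *ₗ-cancel
        (λ eq → case distinct {suc i} {zero} (x∙y⁻¹≈ε⇒x≈y _ _ eq) of λ ())
        (eigenspaces-independent (λ eq → Finₚ.suc-injective (distinct eq))
          (λ i → Subspace.*-closed (eigenspace-subspace _) _ (eigen (suc i))) shifted≈0 i)
      head≈0 : us zero ≈ᴹ 0ᴹ
      head≈0 = begin
        us zero                          ≈⟨ +ᴹ-identityʳ _ ⟨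
        us zero +ᴹ 0ᴹ                    ≈⟨ +ᴹ-congˡ (Sumᴹ.sum-replicate-zero k) ⟨
        us zero +ᴹ Sumᴹ.sum {k} (λ _ → 0ᴹ)  ≈⟨ +ᴹ-congˡ (Sumᴹ.sum-cong-≋ tail≈0) ⟨
        Sumᴹ.sum us                      ≈⟨ sum≈0 ⟩
        0ᴹ                               ∎

    -- In the application the `φ a` are the coordinates of a vector and `P i a` is the image of the
    -- a-th basis vector under the i-th projection; `resolution` says that the projections add up to
    -- the identity. Idempotency and orthogonality come out in `component-self` and
    -- `component-vanishes`.
    module Decomposition {N} (φ : Fin N → V → Carrier) (φ-functional : ∀ a → Functional (φ a))
        (faithful : ∀ {u} → (∀ a → φ a u ≈ 0#) → u ≈ᴹ 0ᴹ)
        {r} (λs : Vector Carrier r) (distinct : ∀ {i j} → λs i ≈ λs j → i ≡ j)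
        (P : Fin r → Vector V N) (P-eigen : ∀ i a → Eigenspace f (λs i) (P i a))
        (resolution : ∀ v → v ≈ᴹ Sumᴹ.sum (λ i → linearCombination (λ a → φ a v) (P i)))
        where

      component : Fin r → V → V
      component i v = linearCombination (λ a → φ a v) (P i)

      component-eigen : ∀ i v → Eigenspace f (λs i) (component i v)
      component-eigen i v = combination∈U (eigenspace-subspace _) (eigenspace-0 _) _ (P-eigen i)

      -- Applying `f - μ` to the resolution of `v` gives zero, written as a sum of the eigenvectors
      -- `(λs i - μ) *ₗ component i v`. Independence kills each of them, and a nonzero factor can be
      -- cancelled.
      component-vanishes : ∀ {μ v} → Eigenspace f μ v → ∀ i → ¬ λs i ≈ μ → component i v ≈ᴹ 0ᴹ
      component-vanishes {μ} {v} fv i λ≉μ = *ₗ-cancel (λ eq → λ≉μ (x∙y⁻¹≈ε⇒x≈y _ _ eq))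
        (eigenspaces-independent distinct
          {us = λ i → (λs i - μ) *ₗ component i v}
          (λ i → Subspace.*-closed (eigenspace-subspace _) _ (component-eigen i v)) (begin
          linearCombination (λ i → λs i - μ) (λ i → component i v)   ≈⟨ sum-shifted (λ i → component-eigen i v) μ ⟩
          f (Sumᴹ.sum (λ i → component i v)) +ᴹ (- μ) *ₗ Sumᴹ.sum (λ i → component i v)
            ≈⟨ +ᴹ-cong (f-cong (resolution v)) (*ₗ-congˡ (resolution v)) ⟨
          f v +ᴹ (- μ) *ₗ v                                          ≈⟨ +ᴹ-congʳ fv ⟩
          μ *ₗ v +ᴹ (- μ) *ₗ v                                       ≈⟨ cancel μ v ⟩
          0ᴹ                                                         ∎) i)

      component-self : ∀ {i v} → Eigenspace f (λs i) v → v ≈ᴹ component i v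
      component-self {i} {v} fv = begin
        v                                     ≈⟨ resolution v ⟩
        Sumᴹ.sum (λ j → component j v)        ≈⟨ Sumᴹ.sum-cong-≋ scale ⟩
        linearCombination (kronecker {R = commutativeRing} i) (λ j → component j v)
                                              ≈⟨ combination-kronecker _ i ⟩
        component i v                         ∎
        where
        scale : ∀ j → component j v ≈ᴹ kronecker {R = commutativeRing} i j *ₗ component j v
        scale j with i Finₚ.≟ j
        ... | yes _  = ≈ᴹ-sym (*ₗ-identityˡ _)
        ... | no i≢j = ≈ᴹ-trans (component-vanishes fv j (λ eq → i≢j (≡.sym (distinct eq)))) (≈ᴹ-sym (*ₗ-zeroˡ _))

      eigenvalue-listed : ∀ {μ} → IsEigenvalue f μ → ∃[ i ] λs i ≈ μ
      eigenvalue-listed {μ} (v , v≉0 , fv) with Finₚ.any? (λ i → λs i ≟ μ)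
      ... | yes found = found
      ... | no ¬found = contradiction
        (≈ᴹ-trans (resolution v) (≈ᴹ-trans
          (Sumᴹ.sum-cong-≋ λ i → component-vanishes fv i λ eq → ¬found (i , eq))
          (Sumᴹ.sum-replicate-zero r))) v≉0

      private
        extracted : ∀ i → _
        extracted i = extract-basis N φ φ-functional (Eigenspace f (λs i)) (eigenspace-subspace _)
                        (λ _ → faithful) (P i) (P-eigen i)

      dimension : Fin r → ℕ
      dimension i = proj₁ (extracted i)

      basis : ∀ i → Vector V (dimension i)
      basis i = proj₁ (proj₂ (extracted i))

      private
        coordinates : ∀ i (a : Fin N) → P i a ∈Span basis i
        coordinates i = proj₂ (proj₂ (proj₂ (proj₂ (extracted i))))

      -- Elimination only guarantees that the family `P i` is spanned; by `component-self` this
      -- family generates the whole eigenspace.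
      basis-isBasis : ∀ i → IsBasisOf (Eigenspace f (λs i)) (basis i)
      basis-isBasis i = record
        { inside      = proj₁ (proj₂ (proj₂ (extracted i)))
        ; independent = proj₁ (proj₂ (proj₂ (proj₂ (extracted i))))
        ; spanning    = λ v fv → let (c , eq) = combination∈Span (λ a → φ a v) (coordinates i)
                                 in c , ≈ᴹ-trans (component-self fv) eq
        }

      -- Let C hold the coordinates of the `P i a` in the basis and Φ the values `φ a (basis i j)`.
      -- The right side is the trace of CΦ, hence that of ΦC, which is an identity matrix because
      -- the i-th projection fixes the basis.
      dimension≈trace : ∀ i → dimension i times 1# ≈ sum (λ a → φ a (P i a))
      dimension≈trace i = sym (trans (sum-cong-≋ diagonal) (trans (∑-comm (λ a j → C a j * φ a (basis i j)))
        (trans (sum-cong-≋ {dimension i} inverse-diagonal) (sum-replicate (dimension i)))))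
        where
        open IsBasisOf (basis-isBasis i)
        C : Fin N → Vector Carrier (dimension i)
        C a = proj₁ (coordinates i a)
        diagonal : ∀ a → φ a (P i a) ≈ sum (λ j → C a j * φ a (basis i j))
        diagonal a = trans (Functional.φ-cong (φ-functional a) (proj₂ (coordinates i a)))
                           (Functional.φ-combination (φ-functional a) (C a) (basis i))
        inverse-diagonal : ∀ j → sum (λ a → C a j * φ a (basis i j)) ≈ 1#
        inverse-diagonal j = trans (sum-cong-≋ (λ a → *-comm (C a j) _)) (trans
          -- Row `j` of ΦC and the Kronecker vector are both coordinate vectors of `basis i j`.
          (independent-unique independent (λ j′ → sum (λ a → φ a (basis i j) * C a j′)) (kronecker {R = commutativeRing} j) (begin
            linearCombination (λ j′ → sum (λ a → φ a (basis i j) * C a j′)) (basis i)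
              ≈⟨ combination-combination (λ a → φ a (basis i j)) C (basis i) ⟨
            linearCombination (λ a → φ a (basis i j)) (λ a → linearCombination (C a) (basis i))
              ≈⟨ combination-cong (λ _ → refl) (λ a → proj₂ (coordinates i a)) ⟨
            component i (basis i j)                                     ≈⟨ component-self (inside j) ⟨
            basis i j                                                   ≈⟨ combination-kronecker (basis i) j ⟨
            linearCombination (kronecker {R = commutativeRing} j) (basis i) ∎) j)
          (indicator-yes {R = commutativeRing} (j Finₚ.≟ j) ≡.refl))

      diagonalizable : Diagonalizable f
      diagonalizable = L , vs ,
          record { inside = λ _ → _ ; independent = ind ; spanning = λ v _ → spans v }
        , λ j → let (i , j′ , eq) = from-basis j in
            λs i , independent⇒nonzero ind j , ≡.subst (Eigenspace f (λs i)) (≡.sym eq) (IsBasisOf.inside (basis-isBasis i) j′)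
        where
        concatenation = concatenate basis
        L = proj₁ concatenation
        vs = proj₁ (proj₂ concatenation)
        from-basis = proj₁ (proj₂ (proj₂ concatenation))
        to-basis = proj₁ (proj₂ (proj₂ (proj₂ concatenation)))
        split = proj₂ (proj₂ (proj₂ (proj₂ concatenation)))
        ind : LinearlyIndependent vs
        ind c eq = let (d , c≈d , vanish) = split c in vanish λ i →
          IsBasisOf.independent (basis-isBasis i) (d i)
            (eigenspaces-independent distinct
              (λ i → combination∈U (eigenspace-subspace _) (eigenspace-0 _) (d i) (IsBasisOf.inside (basis-isBasis i)))
              (≈ᴹ-trans (≈ᴹ-sym c≈d) eq) i)
        basis∈Span : ∀ i j → basis i j ∈Span vs
        basis∈Span i j = let (k , eq) = to-basis i j in
          kronecker {R = commutativeRing} k , ≈ᴹ-trans (≈ᴹ-reflexive (≡.sym eq)) (≈ᴹ-sym (combination-kronecker vs k))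
        component∈Span : ∀ v i → component i v ∈Span vs
        component∈Span v i =
          let (c , eq)  = IsBasisOf.spanning (basis-isBasis i) _ (component-eigen i v)
              (c′ , eq′) = combination∈Span c (basis∈Span i)
          in c′ , ≈ᴹ-trans eq eq′
        spans : ∀ v → v ∈Span vs
        spans v = let (c , eq) = combination∈Span (λ _ → 1#) (component∈Span v) in
          c , ≈ᴹ-trans (resolution v) (≈ᴹ-trans (Sumᴹ.sum-cong-≋ λ i → ≈ᴹ-sym (*ₗ-identityˡ (component i v))) eq)

-- Counting and summing over enumerated setoids.

module FieldProperties (F : Field a ℓ) where

  open Field F
  open import Algebra.Properties.Group +-group using (∙-cancelˡ)
  open import Relation.Binary.Reasoning.Setoid setoid

  [_] : ∀ {P : Set ℓ₁} → Dec P → Carrier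
  [_] = indicator {R = commutativeRing}

  cast : ℕ → Carrier
  cast k = k times 1#

  -- Counts are compared inside the field, as sums of indicators; this brings the result back to ℕ.
  cast-injective : ∀ j k → cast j ≈ cast k → j ≡ k
  cast-injective zero    k       eq = ≡.sym (characteristic-zero k (sym eq))
  cast-injective (suc j) zero    eq = characteristic-zero (suc j) eq
  cast-injective (suc j) (suc k) eq = ≡.cong suc (cast-injective j k (∙-cancelˡ 1# _ _ eq))

  indicator-⇔ : ∀ {P : Set ℓ₁} {Q : Set ℓ′} (P? : Dec P) (Q? : Dec Q) → (P → Q) → (Q → P) → [ P? ] ≈ [ Q? ]
  indicator-⇔ P? (yes q) P⇒Q Q⇒P = indicator-yes {R = commutativeRing} P? (Q⇒P q)
  indicator-⇔ P? (no ¬q) P⇒Q Q⇒P = indicator-no {R = commutativeRing} P? (¬q ∘ P⇒Q)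

  sum-const : ∀ k x → sum {k} (λ _ → x) ≈ cast k * x
  sum-const zero    x = sym (zeroˡ x)
  sum-const (suc k) x = begin
    x + sum {k} (λ _ → x)  ≈⟨ +-cong (*-identityˡ x) (sym (sum-const k x)) ⟨
    1# * x + cast k * x    ≈⟨ distribʳ x 1# (cast k) ⟨
    cast (suc k) * x       ∎

  cast-filter : ∀ {A : Set b} {P : Pred A ℓ₁} (P? : Relation.Unary.Decidable P) xs →
    cast (length (filter P? xs)) ≈ sum (λ i → [ P? (lookup xs i) ])
  cast-filter P? []       = refl
  cast-filter P? (x ∷ xs) with P? x
  ... | yes _ = +-congˡ (cast-filter P? xs)
  ... | no _  = trans (cast-filter P? xs) (sym (+-identityˡ _))

module Enumeration (F : Field a ℓ) (S : DecSetoid b ℓ′) (xs : List (DecSetoid.Carrier S))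
    (enumeration : Enumerates.IsEnumeration (DecSetoid.setoid S) xs)
    (unique : Unique.Unique (DecSetoid.setoid S) xs) where

  open Field F hiding (_≟_)
  open FieldProperties F
  open DecSetoid S using (_≟_) renaming (Carrier to A; _≈_ to _∼_)
  private module S = DecSetoid S

  order : ℕ
  order = length xs

  element : Fin order → A
  element = lookup xs

  index : A → Fin order
  index x = Any.index (enumeration x)

  element-index : ∀ x → element (index x) ∼ x
  element-index x = S.sym (Anyₚ.lookup-index (enumeration x))

  element-injective : ∀ {i j} → element i ∼ element j → i ≡ j
  element-injective = go unique
    where
    go : ∀ {ys} → Unique.Unique S.setoid ys → ∀ {i j} → lookup ys i ∼ lookup ys j → i ≡ j
    go (_ ∷ _)  {zero}  {zero}  _  = ≡.refl
    go (y≉ ∷ _) {zero}  {suc j} eq = contradiction eq (All.lookup y≉ (∈-lookup j))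
    go (y≉ ∷ _) {suc i} {zero}  eq = contradiction (S.sym eq) (All.lookup y≉ (∈-lookup i))
    go (_ ∷ u)  {suc i} {suc j} eq = ≡.cong suc (go u eq)

  Respectful : (A → Carrier) → Set _
  Respectful f = ∀ {x y} → x ∼ y → f x ≈ f y

  -- The list meets the class of `x` exactly once, but in a representative that is only equivalent
  -- to `x`; hence the condition on `f`.
  sum-delta : ∀ {f} → Respectful f → ∀ x → sum (λ i → [ element i ≟ x ] * f (element i)) ≈ f x
  sum-delta {f} f-cong x = trans
    (sum-single {R = commutativeRing} (index x) λ j j≢ →
      trans (*-congʳ (indicator-no {R = commutativeRing} (element j ≟ x)
        λ eq → j≢ (element-injective (S.trans eq (S.sym (element-index x)))))) (zeroˡ _))
    (trans (*-congʳ (indicator-yes {R = commutativeRing} (element (index x) ≟ x) (element-index x)))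
    (trans (*-identityˡ _) (f-cong (element-index x))))

module ChangeOfVariables (F : Field a ℓ)
    (S : DecSetoid b ℓ′) (xs : List (DecSetoid.Carrier S))
    (xs-enumeration : Enumerates.IsEnumeration (DecSetoid.setoid S) xs)
    (xs-unique : Unique.Unique (DecSetoid.setoid S) xs)
    (T : DecSetoid b ℓ′) (ys : List (DecSetoid.Carrier T))
    (ys-enumeration : Enumerates.IsEnumeration (DecSetoid.setoid T) ys)
    (ys-unique : Unique.Unique (DecSetoid.setoid T) ys) where

  open Field F hiding (_≟_)
  open FieldProperties F
  private
    module S = DecSetoid S
    module T = DecSetoid T
    module xs = Enumeration F S xs xs-enumeration xs-unique
    module ys = Enumeration F T ys ys-enumeration ys-unique
  open import Relation.Binary.Reasoning.Setoid setoid

  -- The number of listed `y` with `x` equivalent to `ι y` is the indicator of `P x`: one by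
  -- injectivity, none outside the image. Inserting this count, exchanging the sums and collapsing
  -- with `sum-delta` transports the sum along `ι`.
  sum-image : ∀ {P : Pred S.Carrier ℓ₁} (P? : ∀ x → Dec (P x)) (ι : T.Carrier → S.Carrier) →
    (∀ {y z} → ι y S.≈ ι z → y T.≈ z) → (∀ {y z} → y T.≈ z → ι y S.≈ ι z) →
    (∀ {x} → P x → ∃[ y ] x S.≈ ι y) → (∀ {x} y → x S.≈ ι y → P x) →
    ∀ {f} → xs.Respectful f →
    sum (λ i → [ P? (xs.element i) ] * f (xs.element i)) ≈ sum (λ j → f (ι (ys.element j)))
  sum-image {P = P} P? ι ι-injective ι-cong onto into {f} f-cong = begin
    sum (λ i → [ P? (xs.element i) ] * f (xs.element i))
      ≈⟨ sum-cong-≋ (λ i → *-congʳ (fibre (xs.element i))) ⟨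
    sum (λ i → sum (λ j → [ xs.element i S.≟ ι (ys.element j) ]) * f (xs.element i))
      ≈⟨ sum-cong-≋ (λ i → *-distribʳ-sum (f (xs.element i)) (λ j → [ xs.element i S.≟ ι (ys.element j) ])) ⟩
    sum (λ i → sum (λ j → [ xs.element i S.≟ ι (ys.element j) ] * f (xs.element i)))
      ≈⟨ ∑-comm (λ i j → [ xs.element i S.≟ ι (ys.element j) ] * f (xs.element i)) ⟩
    sum (λ j → sum (λ i → [ xs.element i S.≟ ι (ys.element j) ] * f (xs.element i)))
      ≈⟨ sum-cong-≋ (λ j → xs.sum-delta f-cong (ι (ys.element j))) ⟩
    sum (λ j → f (ι (ys.element j)))
      ∎
    where
    fibre : ∀ x → sum (λ j → [ x S.≟ ι (ys.element j) ]) ≈ [ P? x ]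
    fibre x with P? x
    ... | no ¬p = sum-zero {R = commutativeRing} {n = ys.order} λ j → indicator-no {R = commutativeRing} (x S.≟ ι (ys.element j)) (¬p ∘ into (ys.element j))
    ... | yes p = let (y , x≈ιy) = onto p in trans
      (sum-cong-≋ λ j → trans
        (indicator-⇔ (x S.≟ ι (ys.element j)) (ys.element j T.≟ y)
          (λ eq → ι-injective (S.trans (S.sym eq) x≈ιy)) (λ eq → S.trans x≈ιy (ι-cong (T.sym eq))))
        (sym (*-identityʳ _)))
      (ys.sum-delta {λ _ → 1#} (λ _ → refl) y)

-- Action of the generators and of the terms of the shuffle element.

transpose-ˡ : ∀ (i j : Fin n) → transpose i j ⟨$⟩ʳ i ≡ j
transpose-ˡ i j rewrite dec-true (i Finₚ.≟ i) ≡.refl = ≡.refl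

transpose-ʳ : ∀ (i j : Fin n) → transpose i j ⟨$⟩ʳ j ≡ i
transpose-ʳ i j with j Finₚ.≟ i
... | yes j≡i = j≡i
... | no _ rewrite dec-true (j Finₚ.≟ j) ≡.refl = ≡.refl

transpose-≢ : ∀ {i j k : Fin n} → k ≢ i → k ≢ j → transpose i j ⟨$⟩ʳ k ≡ k
transpose-≢ {i = i} {j} {k} k≢i k≢j rewrite dec-false (k Finₚ.≟ i) k≢i | dec-false (k Finₚ.≟ j) k≢j = ≡.refl

inject₁≢suc : ∀ (i : Fin n) → suc i ≢ inject₁ i
inject₁≢suc i eq = ℕₚ.1+n≢n (≡.trans (≡.cong toℕ eq) (Finₚ.toℕ-inject₁ i))

punchIn-fromℕ : ∀ n (y : Fin n) → punchIn (fromℕ n) y ≡ inject₁ y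
punchIn-fromℕ (suc n) zero    = ≡.refl
punchIn-fromℕ (suc n) (suc y) = ≡.cong suc (punchIn-fromℕ n y)

-- Swapping `i` and `i + 1` lowers the skipped place by one and keeps the order of all other places;
-- this is the inductive step for the cycles.
transpose-punchIn : ∀ (i y : Fin n) → transpose (inject₁ i) (suc i) ⟨$⟩ʳ punchIn (suc i) y ≡ punchIn (inject₁ i) y
transpose-punchIn zero    zero    = ≡.refl
transpose-punchIn zero    (suc y) = ≡.refl
transpose-punchIn (suc i) zero    = ≡.refl
transpose-punchIn (suc i) (suc y) =
  ≡.trans (Perm.lift₀-transpose (inject₁ i) (suc i) (suc (punchIn (suc i) y))) (≡.cong suc (transpose-punchIn i y))

punchIn-mono-< : ∀ i {j k : Fin n} → j Fin.< k → punchIn i j Fin.< punchIn i k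
punchIn-mono-< i {j} {k} j<k = ℕₚ.≰⇒> λ le → ℕₚ.<⇒≱ j<k (Finₚ.punchIn-cancel-≤ i k j le)

punchIn-cancel-< : ∀ i {j k : Fin n} → punchIn i j Fin.< punchIn i k → j Fin.< k
punchIn-cancel-< i {j} {k} lt = ℕₚ.≰⇒> λ k≤j → ℕₚ.<⇒≱ lt (Finₚ.punchIn-mono-≤ i k j k≤j)

-- At `suc i`, `fold′` unfolds to a fold of the step functions restricted along `inject₁`; in the
-- present form the recursion for `t` refers to `t` itself.
fold′-suc : ∀ {T : Set a} (f : Fin n → T → T) (x : T) i →
  fold′ (λ _ → T) f x (suc i) ≡ f i (fold′ (λ _ → T) f x (inject₁ i))
fold′-suc f x zero    = ≡.refl
fold′-suc f x (suc i) = ≡.cong (f (suc i)) (fold′-suc (f ∘ inject₁) x i)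

module _ (m : ℕ) .{{_ : NonZero m}} (n : ℕ) where

  open ReflectionGroup m (suc n)
  open Generators m n
  private module C = Group cyclicGroup
  open ≡-Reasoning

  mod-suc : ∀ k → (k ℕ.mod m) ∙ᶜ γ ≡ suc k ℕ.mod m
  mod-suc k = Finₚ.toℕ-injective (begin
    toℕ ((k ℕ.mod m) ∙ᶜ γ)                              ≡⟨ toℕ-mod _ ⟩
    (toℕ (k ℕ.mod m) ℕ.+ toℕ (1 ℕ.mod m)) ℕ.% m         ≡⟨ ≡.cong₂ (λ i j → (i ℕ.+ j) ℕ.% m) (toℕ-mod k) (toℕ-mod 1) ⟩
    (k ℕ.% m ℕ.+ 1 ℕ.% m) ℕ.% m                         ≡⟨ ℕ.%-distribˡ-+ k 1 m ⟨
    (k ℕ.+ 1) ℕ.% m                                     ≡⟨ ≡.cong (ℕ._% m) (ℕₚ.+-comm k 1) ⟩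
    suc k ℕ.% m                                         ≡⟨ toℕ-mod (suc k) ⟨
    toℕ (suc k ℕ.mod m)                                 ∎)
    where
    toℕ-mod : ∀ k → toℕ (k ℕ.mod m) ≡ k ℕ.% m
    toℕ-mod k = Finₚ.toℕ-fromℕ< _

  toℕ-mod-m : ∀ (ρ : C) → toℕ ρ ℕ.mod m ≡ ρ
  toℕ-mod-m ρ = Finₚ.toℕ-injective (≡.trans (Finₚ.toℕ-fromℕ< _) (ℕ.m<n⇒m%n≡m (Finₚ.toℕ<n ρ)))

  s-action : ∀ i x {y} σ → transpose (inject₁ i) (suc i) ⟨$⟩ʳ x ≡ y → to (s i) (x , σ) ≡ (y , σ)
  s-action i x σ eq = ≡.cong₂ _,_ eq (C.identityʳ σ)

  t-at : ∀ i σ → to (t i) (i , σ) ≡ (i , σ ∙ᶜ γ)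
  t-fixes : ∀ i {x} σ → x ≢ i → to (t i) (x , σ) ≡ (x , σ)
  t-at = <-weakInduction (λ i → ∀ σ → to (t i) (i , σ) ≡ (i , σ ∙ᶜ γ)) (λ _ → ≡.refl) λ i ih σ → begin
    to (t (suc i)) (suc i , σ)                          ≡⟨ ≡.cong (λ g → to g (suc i , σ)) (fold′-suc (λ i tᵢ → s i ∙ tᵢ ∙ s i) t₁ i) ⟩
    to (s i) (to (t (inject₁ i)) (to (s i) (suc i , σ)))  ≡⟨ ≡.cong (to (s i) ∘ to (t (inject₁ i))) (s-action i (suc i) σ (transpose-ʳ (inject₁ i) (suc i))) ⟩
    to (s i) (to (t (inject₁ i)) (inject₁ i , σ))       ≡⟨ ≡.cong (to (s i)) (ih σ) ⟩
    to (s i) (inject₁ i , σ ∙ᶜ γ)                       ≡⟨ s-action i (inject₁ i) _ (transpose-ˡ (inject₁ i) (suc i)) ⟩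
    (suc i , σ ∙ᶜ γ)                                    ∎
  t-fixes = <-weakInduction (λ i → ∀ {x} σ → x ≢ i → to (t i) (x , σ) ≡ (x , σ)) t₁-fixes
    λ i ih {x} σ x≢ → ≡.trans (≡.cong (λ g → to g (x , σ)) (fold′-suc (λ i tᵢ → s i ∙ tᵢ ∙ s i) t₁ i)) (step i ih σ x≢)
    where
    t₁-fixes : ∀ {x} σ → x ≢ zero → to t₁ (x , σ) ≡ (x , σ)
    t₁-fixes {zero}  σ x≢0 = contradiction ≡.refl x≢0
    t₁-fixes {suc x} σ x≢0 = ≡.cong (suc x ,_) (C.identityʳ σ)
    step : ∀ i → (∀ {x} σ → x ≢ inject₁ i → to (t (inject₁ i)) (x , σ) ≡ (x , σ)) →
      ∀ {x} σ → x ≢ suc i → to (s i) (to (t (inject₁ i)) (to (s i) (x , σ))) ≡ (x , σ)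
    step i ih {x} σ x≢ = case x Finₚ.≟ inject₁ i of λ where
     (yes ≡.refl) → begin
      to (s i) (to (t (inject₁ i)) (to (s i) (x , σ)))  ≡⟨ ≡.cong (to (s i) ∘ to (t (inject₁ i))) (s-action i (inject₁ i) σ (transpose-ˡ (inject₁ i) (suc i))) ⟩
      to (s i) (to (t (inject₁ i)) (suc i , σ))         ≡⟨ ≡.cong (to (s i)) (ih σ (inject₁≢suc i)) ⟩
      to (s i) (suc i , σ)                              ≡⟨ s-action i (suc i) σ (transpose-ʳ (inject₁ i) (suc i)) ⟩
      (x , σ)                                           ∎
     (no x≢′) → begin
      to (s i) (to (t (inject₁ i)) (to (s i) (x , σ)))  ≡⟨ ≡.cong (to (s i) ∘ to (t (inject₁ i))) (s-action i x σ (transpose-≢ x≢′ x≢)) ⟩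
      to (s i) (to (t (inject₁ i)) (x , σ))             ≡⟨ ≡.cong (to (s i)) (ih σ x≢′) ⟩
      to (s i) (x , σ)                                  ≡⟨ s-action i x σ (transpose-≢ x≢′ x≢) ⟩
      (x , σ)                                           ∎

  t^-at : ∀ i k σ → to (t i ^ k) (i , σ) ≡ (i , σ ∙ᶜ (k ℕ.mod m))
  t^-at i zero    σ = ≡.cong (i ,_) (≡.sym (C.identityʳ σ))
  t^-at i (suc k) σ = begin
    to (t i) (to (t i ^ k) (i , σ))    ≡⟨ ≡.cong (to (t i)) (t^-at i k σ) ⟩
    to (t i) (i , σ ∙ᶜ (k ℕ.mod m))    ≡⟨ t-at i _ ⟩
    (i , σ ∙ᶜ (k ℕ.mod m) ∙ᶜ γ)        ≡⟨ ≡.cong (i ,_) (≡.trans (C.assoc σ _ γ) (≡.cong (σ ∙ᶜ_) (mod-suc k))) ⟩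
    (i , σ ∙ᶜ (suc k ℕ.mod m))         ∎

  t^-fixes : ∀ i k {x} σ → x ≢ i → to (t i ^ k) (x , σ) ≡ (x , σ)
  t^-fixes i zero    σ x≢i = ≡.refl
  t^-fixes i (suc k) σ x≢i = ≡.trans (≡.cong (to (t i)) (t^-fixes i k σ x≢i)) (t-fixes i σ x≢i)

  -- The suffix product starting at factor `p`. Recursion on `p` runs parallel to `tails`;
  -- `productFrom-inject₁` supplies the descending recursion used for the cycles.
  productFrom : ∀ {k} → (Fin k → G) → Fin (suc k) → G
  productFrom f zero            = product (tabulate f)
  productFrom {suc k} f (suc p) = productFrom (f ∘ suc) p

  productFrom-fromℕ : ∀ {k} (f : Fin k → G) → productFrom f (fromℕ k) ≡ ε
  productFrom-fromℕ {zero}  f = ≡.refl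
  productFrom-fromℕ {suc k} f = productFrom-fromℕ (f ∘ suc)

  productFrom-inject₁ : ∀ {k} (f : Fin k → G) i → productFrom f (inject₁ i) ≡ f i ∙ productFrom f (suc i)
  productFrom-inject₁ f zero    = ≡.refl
  productFrom-inject₁ f (suc i) = productFrom-inject₁ (f ∘ suc) i

  cycle : Fin (suc n) → G
  cycle = productFrom s

  -- The induction goes downwards because the product grows on the left: at the last place it is the
  -- identity, and each further factor lowers the skipped place.
  cycle-inject₁ : ∀ p y σ → to (cycle p) (inject₁ y , σ) ≡ (punchIn p y , σ)
  cycle-inject₁ = >-weakInduction (λ p → ∀ y σ → to (cycle p) (inject₁ y , σ) ≡ (punchIn p y , σ))
    (λ y σ → ≡.trans (≡.cong (λ g → to g (inject₁ y , σ)) (productFrom-fromℕ s)) (≡.cong (_, σ) (≡.sym (punchIn-fromℕ n y))))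
    λ i ih y σ → begin
      to (cycle (inject₁ i)) (inject₁ y , σ)        ≡⟨ ≡.cong (λ g → to g (inject₁ y , σ)) (productFrom-inject₁ s i) ⟩
      to (s i) (to (cycle (suc i)) (inject₁ y , σ)) ≡⟨ ≡.cong (to (s i)) (ih y σ) ⟩
      to (s i) (punchIn (suc i) y , σ)              ≡⟨ s-action i (punchIn (suc i) y) σ (transpose-punchIn i y) ⟩
      (punchIn (inject₁ i) y , σ)                   ∎

  cycle-fromℕ : ∀ p σ → to (cycle p) (fromℕ n , σ) ≡ (p , σ)
  cycle-fromℕ = >-weakInduction (λ p → ∀ σ → to (cycle p) (fromℕ n , σ) ≡ (p , σ))
    (λ σ → ≡.cong (λ g → to g (fromℕ n , σ)) (productFrom-fromℕ s))
    λ i ih σ → begin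
      to (cycle (inject₁ i)) (fromℕ n , σ)        ≡⟨ ≡.cong (λ g → to g (fromℕ n , σ)) (productFrom-inject₁ s i) ⟩
      to (s i) (to (cycle (suc i)) (fromℕ n , σ)) ≡⟨ ≡.cong (to (s i)) (ih σ) ⟩
      to (s i) (suc i , σ)                        ≡⟨ s-action i (suc i) σ (transpose-ʳ (inject₁ i) (suc i)) ⟩
      (inject₁ i , σ)                             ∎

  -- As a move of cards: the last card is inserted at place `p` with its colour multiplied by `ρ`,
  -- and the others keep their colours and their order.
  shuffle : Fin (suc n) → C → G
  shuffle p ρ = cycle p ∙ t (fromℕ n) ^ toℕ ρ

  shuffle-inject₁ : ∀ p ρ y σ → to (shuffle p ρ) (inject₁ y , σ) ≡ (punchIn p y , σ)
  shuffle-inject₁ p ρ y σ = ≡.trans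
    (≡.cong (to (cycle p)) (t^-fixes (fromℕ n) (toℕ ρ) σ (Finₚ.fromℕ≢inject₁ ∘ ≡.sym)))
    (cycle-inject₁ p y σ)

  shuffle-fromℕ : ∀ p ρ σ → to (shuffle p ρ) (fromℕ n , σ) ≡ (p , σ ∙ᶜ ρ)
  shuffle-fromℕ p ρ σ = ≡.trans (≡.cong (to (cycle p)) (t^-at (fromℕ n) (toℕ ρ) σ))
    (≡.trans (cycle-fromℕ p _) (≡.cong (λ τ → p , σ ∙ᶜ τ) (toℕ-mod-m ρ)))

-- Coloured positions and ordered elements.

module Positions (m : ℕ) .{{_ : NonZero m}} (n : ℕ) where

  open ReflectionGroup m n
  private module C = Group cyclicGroup

  position : G → Fin n → Fin n
  position g x = proj₁ (to g (x , 1ᶜ))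

  colour : G → Fin n → C
  colour g x = proj₂ (to g (x , 1ᶜ))

  position-cong : ∀ {g h} → g ≈ h → ∀ x → position g x ≡ position h x
  position-cong g≈h x = ≡.cong proj₁ (g≈h (x , 1ᶜ))

  colour-cong : ∀ {g h} → g ≈ h → ∀ x → colour g x ≡ colour h x
  colour-cong g≈h x = ≡.cong proj₂ (g≈h (x , 1ᶜ))

  position-equivariant : ∀ g x ρ → proj₁ (to g (x , ρ)) ≡ position g x
  position-equivariant g x ρ = ≡.cong proj₁ (G.equivariant g x ρ)

  position-inverse : ∀ g x → position (g ⁻¹) (position g x) ≡ x
  position-inverse g x = ≡.trans (≡.sym (position-equivariant (g ⁻¹) _ (colour g x)))
    (≡.cong proj₁ (G.strictlyInverseʳ g (x , 1ᶜ)))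

  position-injective : ∀ g {x y} → position g x ≡ position g y → x ≡ y
  position-injective g {x} {y} eq =
    ≡.trans (≡.sym (position-inverse g x)) (≡.trans (≡.cong (position (g ⁻¹)) eq) (position-inverse g y))

  positions : G → Permutation′ n
  positions g = permutation (position g) (position (g ⁻¹)) (position-inverse (g ⁻¹)) (position-inverse g)

  ≈-ext : ∀ {g h} → (∀ x → to g (x , 1ᶜ) ≡ to h (x , 1ᶜ)) → g ≈ h
  ≈-ext {g} {h} eq (x , ρ) = ≡.trans (G.equivariant g x ρ) (≡.trans (≡.cong (ρ ▹_) (eq x)) (≡.sym (G.equivariant h x ρ)))

  Ordered : ℕ → G → Set
  Ordered l g = (∀ x → toℕ x ℕ.< l → colour g x ≡ 1ᶜ)
              × (∀ x y → toℕ x ℕ.< toℕ y → toℕ y ℕ.< l → position g x Fin.< position g y)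

  ordered? : ∀ l g → Dec (Ordered l g)
  ordered? l g = Finₚ.all? (λ x → (toℕ x ℕₚ.<? l) →-dec (colour g x Finₚ.≟ 1ᶜ))
           ×-dec Finₚ.all? (λ x → Finₚ.all? λ y → (toℕ x ℕₚ.<? toℕ y) →-dec (toℕ y ℕₚ.<? l) →-dec
                   (position g x Finₚ.<? position g y))

  ordered-cong : ∀ {l g h} → g ≈ h → Ordered l g → Ordered l h
  ordered-cong {l} {g} {h} g≈h (c , p) =
    (λ x x<l → ≡.trans (≡.sym (colour-cong {g} {h} g≈h x)) (c x x<l)) ,
    (λ x y x<y y<l → ≡.subst₂ Fin._<_ (position-cong {g} {h} g≈h x) (position-cong {g} {h} g≈h y) (p x y x<y y<l))

  ordered-0 : ∀ g → Ordered 0 g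
  ordered-0 g = (λ _ ()) , (λ _ _ _ ())

  ordered-ε : ∀ l → Ordered l ε
  ordered-ε l = (λ _ _ → ≡.refl) , (λ _ _ x<y _ → x<y)

-- Each step to the right raises the value by at least one. Used for a permutation and for its
-- inverse, this squeezes both to the identity.
increasing⇒inflationary : ∀ (f : Fin n → Fin n) → (∀ x y → x Fin.< y → f x Fin.< f y) → ∀ x → x Fin.≤ f x
increasing⇒inflationary {suc n} f increasing = <-weakInduction (λ x → x Fin.≤ f x) ℕ.z≤n λ i i≤fi →
  ℕₚ.≤-<-trans (≡.subst (ℕ._≤ toℕ (f (inject₁ i))) (Finₚ.toℕ-inject₁ i) i≤fi)
               (increasing _ _ (≡.subst (ℕ._< suc (toℕ i)) (≡.sym (Finₚ.toℕ-inject₁ i)) ℕₚ.≤-refl))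

module _ (m : ℕ) .{{_ : NonZero m}} (n : ℕ) where
  open ReflectionGroup m n
  open Positions m n

  -- With every place constrained, `position g` and its inverse are both increasing, hence
  -- inflationary, and no colour is left.
  ordered-n : ∀ {g} → Ordered n g → g ≈ ε
  ordered-n {g} (uncoloured , ordered) = ≈-ext {g} {ε} λ x → ≡.cong₂ _,_
    (Finₚ.toℕ-injective (ℕₚ.≤-antisym (≡.subst (position g x Fin.≤_) (position-inverse g x) (below (position g x))) (above x)))
    (uncoloured x (Finₚ.toℕ<n x))
    where
    increasing : ∀ x y → x Fin.< y → position g x Fin.< position g y
    increasing x y x<y = ordered x y x<y (Finₚ.toℕ<n y)
    above = increasing⇒inflationary (position g) increasing
    nondecreasing : ∀ x y → x Fin.≤ y → position g x Fin.≤ position g y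
    nondecreasing x y x≤y with x Finₚ.≟ y
    ... | yes ≡.refl = ℕₚ.≤-refl
    ... | no x≢y = ℕₚ.<⇒≤ (increasing x y (ℕₚ.≤∧≢⇒< x≤y (x≢y ∘ Finₚ.toℕ-injective)))
    below = increasing⇒inflationary (position (g ⁻¹)) λ x y x<y → ℕₚ.≰⇒> λ le → ℕₚ.<⇒≱ x<y
      (≡.subst₂ Fin._≤_ (position-inverse (g ⁻¹) y) (position-inverse (g ⁻¹) x) (nondecreasing _ _ le))

-- The effect of moving one card on the ordering.

module Unshuffled (m : ℕ) .{{_ : NonZero m}} (n : ℕ) where
  open ReflectionGroup m (suc n)
  open Positions m (suc n)
  private module C = Group cyclicGroup
  open import Algebra.Properties.Group cyclicGroup using (∙-cancelʳ)

  from-unique : ∀ h {e e′} → to h e ≡ e′ → from h e′ ≡ e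
  from-unique h {e} eq = ≡.trans (≡.cong (from h) (≡.sym eq)) (G.strictlyInverseʳ h e)

  module _ (g : G) (x₀ : Fin (suc n)) (ρ : C) where

    private
      p = position g x₀
      h = shuffle m n p ρ

    -- The shuffle is chosen by the place of card `x₀` in `g`. Its inverse takes `x₀` out of that
    -- place to the end of the deck and divides its colour by `ρ`, while the other cards close the
    -- gap.
    unshuffled : G
    unshuffled = h ⁻¹ ∙ g

    unshuffled-at : to unshuffled (x₀ , 1ᶜ) ≡ (fromℕ n , colour g x₀ ∙ᶜ ρ ⁻¹ᶜ)
    unshuffled-at = from-unique h (≡.trans (shuffle-fromℕ m n p ρ _) (≡.cong (p ,_)
      (≡.trans (C.assoc (colour g x₀) _ ρ) (≡.trans (≡.cong (colour g x₀ ∙ᶜ_) (C.inverseˡ ρ)) (C.identityʳ _)))))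

    unshuffled-other : ∀ {x} → x ≢ x₀ →
      ∃[ y ] (punchIn p y ≡ position g x × to unshuffled (x , 1ᶜ) ≡ (inject₁ y , colour g x))
    unshuffled-other {x} x≢x₀ = y , eq , from-unique h (≡.trans (shuffle-inject₁ m n p ρ y _) (≡.cong (_, colour g x) eq))
      where
      p≢ : p ≢ position g x
      p≢ p≡ = x≢x₀ (≡.sym (position-injective g p≡))
      y = punchOut p≢
      eq = Finₚ.punchIn-punchOut p≢

    colour-other : ∀ {x} → x ≢ x₀ → colour unshuffled x ≡ colour g x
    colour-other x≢ = ≡.cong proj₂ (proj₂ (proj₂ (unshuffled-other x≢)))

    position-<fromℕ : ∀ {x} → x ≢ x₀ → position unshuffled x Fin.< fromℕ n
    position-<fromℕ x≢ = let (y , _ , eq) = unshuffled-other x≢ in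
      ≡.subst (Fin._< fromℕ n) (≡.sym (≡.cong proj₁ eq))
        (≡.subst₂ ℕ._<_ (≡.sym (Finₚ.toℕ-inject₁ y)) (≡.sym (Finₚ.toℕ-fromℕ n)) (Finₚ.toℕ<n y))

    module _ {x y} (x≢ : x ≢ x₀) (y≢ : y ≢ x₀) where

      private
        x′ = unshuffled-other x≢
        y′ = unshuffled-other y≢
        inject₁-< : ∀ {i j : Fin n} → i Fin.< j → inject₁ i Fin.< inject₁ j
        inject₁-< {i} {j} = ≡.subst₂ ℕ._<_ (≡.sym (Finₚ.toℕ-inject₁ i)) (≡.sym (Finₚ.toℕ-inject₁ j))
        inject₁-<⁻ : ∀ {i j : Fin n} → inject₁ i Fin.< inject₁ j → i Fin.< j
        inject₁-<⁻ {i} {j} = ≡.subst₂ ℕ._<_ (Finₚ.toℕ-inject₁ i) (Finₚ.toℕ-inject₁ j)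

      position-<⁺ : position g x Fin.< position g y → position unshuffled x Fin.< position unshuffled y
      position-<⁺ lt = ≡.subst₂ Fin._<_ (≡.sym (≡.cong proj₁ (proj₂ (proj₂ x′)))) (≡.sym (≡.cong proj₁ (proj₂ (proj₂ y′))))
        (inject₁-< (punchIn-cancel-< p (≡.subst₂ Fin._<_ (≡.sym (proj₁ (proj₂ x′))) (≡.sym (proj₁ (proj₂ y′))) lt)))

      position-<⁻ : position unshuffled x Fin.< position unshuffled y → position g x Fin.< position g y
      position-<⁻ lt = ≡.subst₂ Fin._<_ (proj₁ (proj₂ x′)) (proj₁ (proj₂ y′))
        (punchIn-mono-< p (inject₁-<⁻ (≡.subst₂ Fin._<_ (≡.cong proj₁ (proj₂ (proj₂ x′))) (≡.cong proj₁ (proj₂ (proj₂ y′))) lt)))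

    private
      <⇒≢ : ∀ {l x} → l ℕ.≤ toℕ x₀ → toℕ x ℕ.< l → x ≢ x₀
      <⇒≢ l≤ x<l ≡.refl = ℕₚ.<⇒≱ x<l l≤

    -- Card `x₀` lies outside the constrained prefix, and closing the gap preserves the colours and
    -- the order of the other cards.
    ordered-beyond⁺ : ∀ {l} → l ℕ.≤ toℕ x₀ → Ordered l g → Ordered l unshuffled
    ordered-beyond⁺ l≤ (c , o) =
      (λ x x<l → ≡.trans (colour-other (<⇒≢ l≤ x<l)) (c x x<l)) ,
      (λ x y x<y y<l → position-<⁺ (<⇒≢ l≤ (ℕₚ.<-trans x<y y<l)) (<⇒≢ l≤ y<l) (o x y x<y y<l))

    ordered-beyond⁻ : ∀ {l} → l ℕ.≤ toℕ x₀ → Ordered l unshuffled → Ordered l g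
    ordered-beyond⁻ l≤ (c , o) =
      (λ x x<l → ≡.trans (≡.sym (colour-other (<⇒≢ l≤ x<l))) (c x x<l)) ,
      (λ x y x<y y<l → position-<⁻ (<⇒≢ l≤ (ℕₚ.<-trans x<y y<l)) (<⇒≢ l≤ y<l) (o x y x<y y<l))

    ordered-pred : ∀ {l k} → Ordered (suc l) k → Ordered l k
    ordered-pred (c , o) = (λ x x<l → c x (ℕₚ.m<n⇒m<1+n x<l)) , (λ x y x<y y<l → o x y x<y (ℕₚ.m<n⇒m<1+n y<l))

    -- At the end of the deck `x₀` comes after all other cards automatically, and its colour cancels
    -- against `ρ`. So the result meets the constraints for one label more than `g` has to; this is
    -- the source of the term bₖ₊₁.
    ordered-at⁺ : ρ ≡ colour g x₀ → Ordered (toℕ x₀) g → Ordered (suc (toℕ x₀)) unshuffled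
    ordered-at⁺ ρ≡ ord = (λ x x<l → colour-1 x (x Finₚ.≟ x₀) x<l) , (λ x y x<y y<l → increasing x y (y Finₚ.≟ x₀) x<y y<l)
      where
      ord′ = ordered-beyond⁺ ℕₚ.≤-refl ord
      smaller : ∀ {x} → x ≢ x₀ → toℕ x ℕ.< suc (toℕ x₀) → toℕ x ℕ.< toℕ x₀
      smaller x≢ x<l = ℕₚ.≤∧≢⇒< (ℕ.s≤s⁻¹ x<l) (x≢ ∘ Finₚ.toℕ-injective)
      colour-1 : ∀ x → Dec (x ≡ x₀) → toℕ x ℕ.< suc (toℕ x₀) → colour unshuffled x ≡ 1ᶜ
      colour-1 x (yes ≡.refl) _   = ≡.trans (≡.cong proj₂ unshuffled-at)
        (≡.trans (≡.cong (λ σ → σ ∙ᶜ ρ ⁻¹ᶜ) (≡.sym ρ≡)) (C.inverseʳ ρ))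
      colour-1 x (no x≢)      x<l = proj₁ ord′ x (smaller x≢ x<l)
      increasing : ∀ x y → Dec (y ≡ x₀) → toℕ x ℕ.< toℕ y → toℕ y ℕ.< suc (toℕ x₀) →
        position unshuffled x Fin.< position unshuffled y
      increasing x y (yes ≡.refl) x<y _ = ≡.subst (position unshuffled x Fin.<_) (≡.sym (≡.cong proj₁ unshuffled-at))
        (position-<fromℕ λ { ≡.refl → ℕₚ.<-irrefl ≡.refl x<y })
      increasing x y (no y≢) x<y y<l = proj₂ ord′ x y x<y (smaller y≢ y<l)

    -- Only `ρ` equal to the old colour of `x₀` leaves that card uncoloured, so a single `ρ` can
    -- contribute.
    ordered-at⁻ : Ordered (suc (toℕ x₀)) unshuffled → ρ ≡ colour g x₀ × Ordered (toℕ x₀) g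
    ordered-at⁻ ord@(c , _) =
      ≡.sym (∙-cancelʳ (ρ ⁻¹ᶜ) _ _ (≡.trans (≡.trans (≡.sym (≡.cong proj₂ unshuffled-at)) (c x₀ ℕₚ.≤-refl)) (≡.sym (C.inverseʳ ρ)))) ,
      ordered-beyond⁻ ℕₚ.≤-refl (ordered-pred {k = unshuffled} ord)

    -- The next label `x₁` is still constrained and would have to lie beyond `x₀`, which already
    -- occupies the last place.
    ¬ordered-before : ∀ {l} → suc (toℕ x₀) ℕ.< l → l ℕ.≤ suc n → ¬ Ordered l unshuffled
    ¬ordered-before {l} x₀<l l≤n (_ , o) = ℕₚ.<-asym
      (position-<fromℕ x₁≢x₀)
      (≡.subst (Fin._< position unshuffled x₁) (≡.cong proj₁ unshuffled-at)
        (o x₀ x₁ (ℕₚ.≤-reflexive (≡.sym toℕ-x₁)) (≡.subst (ℕ._< l) (≡.sym toℕ-x₁) x₀<l)))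
      where
      x₁ = fromℕ< (ℕₚ.<-≤-trans x₀<l l≤n)
      toℕ-x₁ : toℕ x₁ ≡ suc (toℕ x₀)
      toℕ-x₁ = Finₚ.toℕ-fromℕ< (ℕₚ.<-≤-trans x₀<l l≤n)
      x₁≢x₀ : x₁ ≢ x₀
      x₁≢x₀ eq = ℕₚ.1+n≢n (≡.trans (≡.sym toℕ-x₁) (≡.cong toℕ eq))

-- Sums across a threshold and along a bidiagonal matrix.

module Sums (F : Field a ℓ) where

  open Field F
  open FieldProperties F public
  open import Relation.Binary.Reasoning.Setoid setoid

  sum-snoc : ∀ n (f : ℕ → Carrier) → sum {suc n} (f ∘ toℕ) ≈ sum {n} (f ∘ toℕ) + f n
  sum-snoc n f = trans (sum-init-last {n} (f ∘ toℕ)) (+-cong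
    (sum-cong-≋ {n} λ i → reflexive (≡.cong f (Finₚ.toℕ-inject₁ i)))
    (reflexive (≡.cong f (Finₚ.toℕ-fromℕ n))))

  -- The shape of a sum over the moved card: its label lies inside the ordered prefix, at the end of
  -- it, or beyond it.
  sum-threshold : ∀ {n} l → l ℕ.< n → (f : Fin n → Carrier) → ∀ {x y} →
    (∀ i → toℕ i ℕ.< l → f i ≈ 0#) → (∀ i → toℕ i ≡ l → f i ≈ y) → (∀ i → l ℕ.< toℕ i → f i ≈ x) →
    sum f ≈ cast (n ℕ.∸ suc l) * x + y
  sum-threshold {suc n} zero _ f {x} {y} below at above = begin
    f zero + sum (f ∘ suc)      ≈⟨ +-cong (at zero ≡.refl) (sum-cong-≋ λ i → above (suc i) (ℕ.s≤s ℕ.z≤n)) ⟩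
    y + sum {n} (λ _ → x)       ≈⟨ +-congˡ (sum-const n x) ⟩
    y + cast n * x              ≈⟨ +-comm _ _ ⟩
    cast n * x + y              ∎
  sum-threshold {suc n} (suc l) (ℕ.s≤s l<n) f below at above = trans
    (+-cong (below zero (ℕ.s≤s ℕ.z≤n)) (sum-threshold l l<n (f ∘ suc)
      (λ i i<l → below (suc i) (ℕ.s≤s i<l)) (λ i eq → at (suc i) (≡.cong suc eq)) (λ i l<i → above (suc i) (ℕ.s≤s l<i))))
    (+-identityˡ _)

  -- The hypotheses make `c` a left eigenvector of the bidiagonal matrix that sends `B k` to
  -- `κ k * B k + B (suc k)`. Truncation at `n` leaves the one term whose partner would carry the
  -- next coefficient.
  sum-shift : ∀ n {μ} (c κ B : ℕ → Carrier) → κ 0 * c 0 ≈ μ * c 0 →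
    (∀ k → c k + κ (suc k) * c (suc k) ≈ μ * c (suc k)) →
    sum {suc n} (λ k → c (toℕ k) * (κ (toℕ k) * B (toℕ k) + B (suc (toℕ k)))) ≈
    μ * sum {suc n} (λ k → c (toℕ k) * B (toℕ k)) + c n * B (suc n)
  sum-shift zero {μ} c κ B base step = begin
    c 0 * (κ 0 * B 0 + B 1) + 0#         ≈⟨ solve 4 (λ c κ B B′ → c :* (κ :* B :+ B′) :+ con 0 := (κ :* c) :* B :+ c :* B′) refl (c 0) (κ 0) (B 0) (B 1) ⟩
    (κ 0 * c 0) * B 0 + c 0 * B 1        ≈⟨ +-congʳ (*-congʳ base) ⟩
    (μ * c 0) * B 0 + c 0 * B 1          ≈⟨ solve 4 (λ c μ B B′ → (μ :* c) :* B :+ c :* B′ := μ :* (c :* B :+ con 0) :+ c :* B′) refl (c 0) μ (B 0) (B 1) ⟩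
    μ * (c 0 * B 0 + 0#) + c 0 * B 1     ∎
    where open import Algebra.Solver.Ring.NaturalCoefficients.Default commutativeSemiring
  sum-shift (suc n) {μ} c κ B base step = begin
    sum {suc (suc n)} (f ∘ toℕ)                  ≈⟨ sum-snoc (suc n) f ⟩
    sum {suc n} (f ∘ toℕ) + f (suc n)            ≈⟨ +-congʳ (sum-shift n c κ B base step) ⟩
    (μ * S + c n * B′) + c′ * (κ′ * B′ + B″)
      ≈⟨ solve 7 (λ μS c B′ c′ κ′ B″ _ → (μS :+ c :* B′) :+ c′ :* (κ′ :* B′ :+ B″) := (μS :+ (c :+ κ′ :* c′) :* B′) :+ c′ :* B″)
           refl (μ * S) (c n) B′ c′ κ′ B″ 0# ⟩
    (μ * S + (c n + κ′ * c′) * B′) + c′ * B″     ≈⟨ +-congʳ (+-congˡ (*-congʳ (step n))) ⟩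
    (μ * S + (μ * c′) * B′) + c′ * B″            ≈⟨ +-congʳ (trans (+-congˡ (*-assoc μ c′ B′)) (sym (distribˡ μ S (c′ * B′)))) ⟩
    μ * (S + c′ * B′) + c′ * B″                  ≈⟨ +-congʳ (*-congˡ (sum-snoc (suc n) (λ k → c k * B k))) ⟨
    μ * sum {suc (suc n)} (λ k → c (toℕ k) * B (toℕ k)) + c′ * B″ ∎
    where
    open import Algebra.Solver.Ring.NaturalCoefficients.Default commutativeSemiring
    f = λ k → c k * (κ k * B k + B (suc k))
    S = sum {suc n} (λ k → c (toℕ k) * B (toℕ k))
    c′ = c (suc n)
    κ′ = κ (suc n)
    B′ = B (suc n)
    B″ = B (suc (suc n))

-- Coefficients of the eigenprojections.

module Coefficients (F : Field a ℓ) (m : ℕ) .{{_ : NonZero m}} where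

  open Field F
  open Sums F
  open import Relation.Binary.Reasoning.Setoid setoid
  open import Algebra.Properties.Ring ring using (-‿distribʳ-*)
  open import Algebra.Solver.Ring.NaturalCoefficients.Default commutativeSemiring

  eigenvalue : ℕ → Carrier
  eigenvalue i = cast (i ℕ.* m)

  eigenvalue-suc : ∀ i → eigenvalue (suc i) ≈ cast m + eigenvalue i
  eigenvalue-suc i = ×-homo-+ 1# m (i ℕ.* m)

  eigenvalue-injective : ∀ {i j} → eigenvalue i ≈ eigenvalue j → i ≡ j
  eigenvalue-injective {i} {j} eq = ℕₚ.*-cancelʳ-≡ i j m (cast-injective _ _ eq)

  private
    invertible : ∀ i → ∃[ y ] (y * eigenvalue (suc i) ≈ 1#)
    invertible i = inverse _ λ eq → case eigenvalue-injective {suc i} {0} eq of λ ()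

    r : ℕ → Carrier
    r i = proj₁ (invertible i)

  -- c i k = (-1)^(k-i) (k C i) / (mᵏ k!)
  c : ℕ → ℕ → Carrier
  c zero    zero    = 1#
  c (suc i) zero    = 0#
  c zero    (suc k) = - (r k * c zero k)
  c (suc i) (suc k) = r i * c i k

  -- The absorption identity of binomial coefficients, built into the recursion for `c` so that
  -- neither binomials nor factorials occur. The same factor later drives the recurrence of the
  -- traces.
  eigenvalue-c-suc : ∀ i k → eigenvalue (suc i) * c (suc i) (suc k) ≈ c i k
  eigenvalue-c-suc i k = trans (sym (*-assoc _ _ _))
    (trans (*-congʳ (trans (*-comm _ _) (proj₂ (invertible i)))) (*-identityˡ _))

  *-cancelˡ-eigenvalue : ∀ i {x y} → eigenvalue (suc i) * x ≈ eigenvalue (suc i) * y → x ≈ y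
  *-cancelˡ-eigenvalue i {x} {y} eq = begin
    x                                ≈⟨ *-identityˡ x ⟨
    1# * x                           ≈⟨ *-congʳ (proj₂ (invertible i)) ⟨
    r i * eigenvalue (suc i) * x     ≈⟨ *-assoc _ _ _ ⟩
    r i * (eigenvalue (suc i) * x)   ≈⟨ *-congˡ eq ⟩
    r i * (eigenvalue (suc i) * y)   ≈⟨ *-assoc _ _ _ ⟨
    r i * eigenvalue (suc i) * y     ≈⟨ *-congʳ (proj₂ (invertible i)) ⟩
    1# * y                           ≈⟨ *-identityˡ y ⟩
    y                                ∎

  c-zero : ∀ i → eigenvalue 0 * c i 0 ≈ eigenvalue i * c i 0
  c-zero zero    = refl
  c-zero (suc i) = trans (zeroʳ _) (sym (zeroʳ _))

  -- The equation for bₖ₊₁ in Sh pᵢ = im pᵢ. For `suc i` both eigenvalues split off `cast m`, which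
  -- cancels, and `previous` is `r i` times the equation for `i` one column earlier.
  c-suc : ∀ i k → c i k + eigenvalue (suc k) * c i (suc k) ≈ eigenvalue i * c i (suc k)
  c-suc zero    k = trans
    (+-congˡ (trans (sym (-‿distribʳ-* _ _)) (-‿cong (trans (sym (*-assoc _ _ _))
      (trans (*-congʳ (trans (*-comm _ _) (proj₂ (invertible k)))) (*-identityˡ _))))))
    (trans (-‿inverseʳ _) (sym (zeroˡ _)))
  c-suc (suc i) k = begin
    c (suc i) k + eigenvalue (suc k) * (r i * c i k)          ≈⟨ +-congˡ (*-congʳ (eigenvalue-suc k)) ⟩
    c (suc i) k + (cast m + eigenvalue k) * (r i * c i k)
      ≈⟨ solve 5 (λ x M e r c → x :+ (M :+ e) :* (r :* c) := r :* (M :* c) :+ (x :+ r :* (e :* c))) refl (c (suc i) k) (cast m) (eigenvalue k) (r i) (c i k) ⟩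
    r i * (cast m * c i k) + (c (suc i) k + r i * (eigenvalue k * c i k))  ≈⟨ +-congˡ (previous k) ⟩
    r i * (cast m * c i k) + r i * (eigenvalue i * c i k)
      ≈⟨ solve 4 (λ M e r c → r :* (M :* c) :+ r :* (e :* c) := (M :+ e) :* (r :* c)) refl (cast m) (eigenvalue i) (r i) (c i k) ⟩
    (cast m + eigenvalue i) * (r i * c i k)                   ≈⟨ *-congʳ (eigenvalue-suc i) ⟨
    eigenvalue (suc i) * (r i * c i k)                        ∎
    where
    previous : ∀ k → c (suc i) k + r i * (eigenvalue k * c i k) ≈ r i * (eigenvalue i * c i k)
    previous zero    = trans (+-identityˡ _) (*-congˡ (c-zero i))
    previous (suc k) = trans (sym (distribˡ (r i) _ _)) (*-congˡ (c-suc i k))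

  c-vanishes : ∀ {i k} → k ℕ.< i → c i k ≈ 0#
  c-vanishes {suc i} {zero}  _           = refl
  c-vanishes {suc i} {suc k} (ℕ.s≤s k<i) = trans (*-congˡ (c-vanishes k<i)) (zeroʳ _)

  column-sum-0 : ∀ n → sum {suc n} (λ i → c (toℕ i) 0) ≈ 1#
  column-sum-0 n = trans (+-congˡ (sum-zero {R = commutativeRing} {n = n} λ _ → refl)) (+-identityʳ 1#)

  -- Summing `c-suc` over `i` and applying absorption on the right returns the previous column sum
  -- up to its last entry, which is zero for `k < n`. So the invertible `eigenvalue (suc k)`
  -- annihilates the new column sum; in binomial terms, (1 - 1)^(k+1) = 0.
  column-sum-suc : ∀ {n k} → k ℕ.< n → sum {suc n} (λ i → c (toℕ i) (suc k)) ≈ 0#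
  column-sum-suc {n} {k} k<n = *-cancelʳ-invertible {R = commutativeRing} _ (proj₂ (invertible k)) (trans (*-comm _ _) (∙-cancelˡ S _ _ (begin
    S + eigenvalue (suc k) * S′
      ≈⟨ +-congˡ (*-distribˡ-sum {suc n} _ (λ i → c (toℕ i) (suc k))) ⟩
    S + sum {suc n} (λ i → eigenvalue (suc k) * c (toℕ i) (suc k))
      ≈⟨ ∑-distrib-+ {suc n} (λ i → c (toℕ i) k) (λ i → eigenvalue (suc k) * c (toℕ i) (suc k)) ⟨
    sum {suc n} (λ i → c (toℕ i) k + eigenvalue (suc k) * c (toℕ i) (suc k))
      ≈⟨ sum-cong-≋ {suc n} (λ i → c-suc (toℕ i) k) ⟩
    eigenvalue 0 * c 0 (suc k) + sum {n} (λ i → eigenvalue (suc (toℕ i)) * c (suc (toℕ i)) (suc k))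
      ≈⟨ +-cong (zeroˡ _) (sum-cong-≋ {n} λ i → eigenvalue-c-suc (toℕ i) k) ⟩
    0# + sum {n} (λ i → c (toℕ i) k)          ≈⟨ +-comm _ _ ⟩
    sum {n} (λ i → c (toℕ i) k) + 0#          ≈⟨ +-congˡ (c-vanishes k<n) ⟨
    sum {n} (λ i → c (toℕ i) k) + c n k       ≈⟨ sum-snoc n (λ i → c i k) ⟨
    S                                         ≈⟨ +-identityʳ S ⟨
    S + 0#                                    ∎)))
    where
    open import Algebra.Properties.Group +-group using (∙-cancelˡ)
    S  = sum {suc n} (λ i → c (toℕ i) k)
    S′ = sum {suc n} (λ i → c (toℕ i) (suc k))

  -- The value pᵢ(1) in degree `n`, because the identity occurs once in every bₖ.
  rowSum : ℕ → ℕ → Carrier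
  rowSum i n = sum {suc n} (λ k → c i (toℕ k))

  rowSum-suc : ∀ i n → eigenvalue (suc i) * rowSum (suc i) (suc n) ≈ rowSum i n
  rowSum-suc i n = begin
    eigenvalue (suc i) * rowSum (suc i) (suc n)
      ≈⟨ *-congˡ (+-identityˡ _) ⟩
    eigenvalue (suc i) * sum {suc n} (λ k → c (suc i) (suc (toℕ k)))
      ≈⟨ *-distribˡ-sum {suc n} _ (λ k → c (suc i) (suc (toℕ k))) ⟩
    sum {suc n} (λ k → eigenvalue (suc i) * c (suc i) (suc (toℕ k)))
      ≈⟨ sum-cong-≋ {suc n} (λ k → eigenvalue-c-suc i (toℕ k)) ⟩
    rowSum i n ∎

  rowSum-total : ∀ n → sum {suc n} (λ i → rowSum (toℕ i) n) ≈ 1#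
  rowSum-total n = begin
    sum {suc n} (λ i → rowSum (toℕ i) n)                       ≈⟨ ∑-comm {suc n} {suc n} (λ i k → c (toℕ i) (toℕ k)) ⟩
    sum {suc n} (λ k → sum {suc n} (λ i → c (toℕ i) (toℕ k)))
      ≈⟨ +-cong (column-sum-0 n) (sum-zero {R = commutativeRing} {n = n} λ k → column-sum-suc (Finₚ.toℕ<n k)) ⟩
    1# + 0#                                                    ≈⟨ +-identityʳ 1# ⟩
    1#                                                         ∎

-- The shuffle operator on functions and its eigenfunctions.

module ShuffleOperator (F : Field a ℓ) (m : ℕ) .{{_ : NonZero m}} (n : ℕ) where

  open Field F hiding (_≟_)
    renaming (_≈_ to _≈ᶠ_; _+_ to _+ᶠ_; _*_ to _*ᶠ_; refl to reflᶠ; trans to transᶠ; sym to symᶠ)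
  open Sums F
  open Coefficients F m
  open ReflectionGroup m (suc n)
  open Positions m (suc n)
  open import Relation.Binary.Reasoning.Setoid setoid

  X : (G → Carrier) → G → Carrier
  X f g = sum {suc n} λ p → sum {m} λ ρ → f (shuffle m n p ρ ⁻¹ ∙ g)

  -- The place `p` is traded for the card that `g` sends there, since the ordering conditions are
  -- indexed by cards.
  X-positions : ∀ f g → X f g ≈ᶠ sum {suc n} λ x → sum {m} λ ρ → f (Unshuffled.unshuffled m n g x ρ)
  X-positions f g = sum-permute (λ p → sum {m} λ ρ → f (shuffle m n p ρ ⁻¹ ∙ g)) (positions g)

  χ : ℕ → G → Carrier
  χ l g = [ ordered? l g ]

  X-χ-zero : ∀ g → X (χ 0) g ≈ᶠ eigenvalue (suc n) *ᶠ χ 0 g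
  X-χ-zero g = begin
    X (χ 0) g                                   ≈⟨ sum-cong-≋ {suc n} (λ p → sum-cong-≋ {m} λ ρ → all-ordered (shuffle m n p ρ ⁻¹ ∙ g)) ⟩
    sum {suc n} (λ _ → sum {m} λ _ → 1#)        ≈⟨ sum-cong-≋ {suc n} (λ _ → sum-const m 1#) ⟩
    sum {suc n} (λ _ → cast m *ᶠ 1#)            ≈⟨ sum-const (suc n) _ ⟩
    cast (suc n) *ᶠ (cast m *ᶠ 1#)              ≈⟨ transᶠ (*-cong reflᶠ (*-identityʳ _)) (symᶠ (×1-homo-* (suc n) m)) ⟩
    cast (suc n ℕ.* m)                          ≈⟨ *-identityʳ _ ⟨
    cast (suc n ℕ.* m) *ᶠ 1#                    ≈⟨ *-congˡ (all-ordered g) ⟨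
    eigenvalue (suc n) *ᶠ χ 0 g                 ∎
    where
    all-ordered : ∀ g → χ 0 g ≈ᶠ 1#
    all-ordered g = indicator-yes {R = commutativeRing} (ordered? 0 g) (ordered-0 g)

  -- Moving a card inside the constrained prefix gives zero unless it is the last one there. That
  -- one gives `χ l g`, through the single colour `ρ = colour g x`; each of the `n ∸ l` cards beyond
  -- gives `χ (suc l) g` for all `m` colours.
  X-χ-suc : ∀ {l} → l ℕ.≤ n → ∀ g → X (χ (suc l)) g ≈ᶠ eigenvalue (n ℕ.∸ l) *ᶠ χ (suc l) g +ᶠ χ l g
  X-χ-suc {l} l≤n g = begin
    X (χ (suc l)) g                                                  ≈⟨ X-positions (χ (suc l)) g ⟩
    sum {suc n} inner                                                ≈⟨ sum-threshold l (ℕ.s≤s l≤n) inner before at beyond ⟩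
    cast (n ℕ.∸ l) *ᶠ (cast m *ᶠ χ (suc l) g) +ᶠ χ l g
      ≈⟨ +-congʳ (transᶠ (symᶠ (*-assoc _ _ _)) (*-congʳ (symᶠ (×1-homo-* (n ℕ.∸ l) m)))) ⟩
    eigenvalue (n ℕ.∸ l) *ᶠ χ (suc l) g +ᶠ χ l g                     ∎
    where
    open Unshuffled m n
    inner : Fin (suc n) → Carrier
    inner x = sum {m} λ ρ → χ (suc l) (unshuffled g x ρ)
    before : ∀ x → toℕ x ℕ.< l → inner x ≈ᶠ 0#
    before x x<l = sum-zero {R = commutativeRing} {n = m} λ ρ →
      indicator-no {R = commutativeRing} (ordered? (suc l) (unshuffled g x ρ)) (¬ordered-before g x ρ (ℕ.s≤s x<l) (ℕ.s≤s l≤n))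
    at : ∀ x → toℕ x ≡ l → inner x ≈ᶠ χ l g
    at x ≡.refl = transᶠ
      (sum-single {R = commutativeRing} {n = m} (colour g x) λ ρ ρ≢ →
        indicator-no {R = commutativeRing} (ordered? (suc (toℕ x)) (unshuffled g x ρ)) (ρ≢ ∘ proj₁ ∘ ordered-at⁻ g x ρ))
      (indicator-⇔ (ordered? (suc (toℕ x)) (unshuffled g x (colour g x))) (ordered? (toℕ x) g)
        (proj₂ ∘ ordered-at⁻ g x (colour g x)) (ordered-at⁺ g x (colour g x) ≡.refl))
    beyond : ∀ x → l ℕ.< toℕ x → inner x ≈ᶠ cast m *ᶠ χ (suc l) g
    beyond x l<x = transᶠ
      (sum-cong-≋ {m} λ ρ → indicator-⇔ (ordered? (suc l) (unshuffled g x ρ)) (ordered? (suc l) g)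
        (ordered-beyond⁻ g x ρ l<x) (ordered-beyond⁺ g x ρ l<x))
      (sum-const m _)

  -- The bₖ of the header, extended by 0 to k = 2+n so that X-support has no exceptional case.
  support : ℕ → G → Carrier
  support k g = [ k ℕₚ.≤? suc n ] *ᶠ χ (suc n ℕ.∸ k) g

  support-≤ : ∀ {k} → k ℕ.≤ suc n → ∀ g → support k g ≈ᶠ χ (suc n ℕ.∸ k) g
  support-≤ {k} k≤ g = transᶠ (*-congʳ (indicator-yes {R = commutativeRing} (k ℕₚ.≤? suc n) k≤)) (*-identityˡ (χ (suc n ℕ.∸ k) g))

  support-> : ∀ {k} → suc n ℕ.< k → ∀ g → support k g ≈ᶠ 0#
  support-> {k} k> g = transᶠ (*-congʳ (indicator-no {R = commutativeRing} (k ℕₚ.≤? suc n) (ℕₚ.<⇒≱ k>))) (zeroˡ (χ (suc n ℕ.∸ k) g))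

  X-cong : ∀ {f f′} → (∀ g → f g ≈ᶠ f′ g) → ∀ g → X f g ≈ᶠ X f′ g
  X-cong eq g = sum-cong-≋ {suc n} λ p → sum-cong-≋ {m} λ ρ → eq (shuffle m n p ρ ⁻¹ ∙ g)

  X-+ : ∀ f f′ g → X (λ h → f h +ᶠ f′ h) g ≈ᶠ X f g +ᶠ X f′ g
  X-+ f f′ g = transᶠ
    (sum-cong-≋ {suc n} λ p → ∑-distrib-+ {m} (λ ρ → f (shuffle m n p ρ ⁻¹ ∙ g)) (λ ρ → f′ (shuffle m n p ρ ⁻¹ ∙ g)))
    (∑-distrib-+ {suc n} (λ p → sum {m} λ ρ → f (shuffle m n p ρ ⁻¹ ∙ g)) (λ p → sum {m} λ ρ → f′ (shuffle m n p ρ ⁻¹ ∙ g)))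

  X-* : ∀ r f g → X (λ h → r *ᶠ f h) g ≈ᶠ r *ᶠ X f g
  X-* r f g = symᶠ (transᶠ
    (*-distribˡ-sum {suc n} r (λ p → sum {m} λ ρ → f (shuffle m n p ρ ⁻¹ ∙ g)))
    (sum-cong-≋ {suc n} λ p → *-distribˡ-sum {m} r (λ ρ → f (shuffle m n p ρ ⁻¹ ∙ g))))

  X-support : ∀ {k} → k ℕ.≤ suc n → ∀ g → X (support k) g ≈ᶠ eigenvalue k *ᶠ support k g +ᶠ support (suc k) g
  X-support {k} k≤ g = go (ℕₚ.m≤n⇒m<n∨m≡n k≤)
   where
   go : k ℕ.< suc n ⊎ k ≡ suc n → X (support k) g ≈ᶠ eigenvalue k *ᶠ support k g +ᶠ support (suc k) g
   go (inj₂ ≡.refl) = begin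
    X (support (suc n)) g                                  ≈⟨ X-cong (λ h → transᶠ (support-≤ ℕₚ.≤-refl h) (reflexive (≡.cong (λ l → χ l h) (ℕₚ.n∸n≡0 n)))) g ⟩
    X (χ 0) g                                        ≈⟨ X-χ-zero g ⟩
    eigenvalue (suc n) *ᶠ χ 0 g
      ≈⟨ *-congˡ (transᶠ (support-≤ ℕₚ.≤-refl g) (reflexive (≡.cong (λ l → χ l g) (ℕₚ.n∸n≡0 n)))) ⟨
    eigenvalue (suc n) *ᶠ support (suc n) g                ≈⟨ +-identityʳ _ ⟨
    eigenvalue (suc n) *ᶠ support (suc n) g +ᶠ 0#          ≈⟨ +-congˡ (support-> ℕₚ.≤-refl g) ⟨
    eigenvalue (suc n) *ᶠ support (suc n) g +ᶠ support (suc (suc n)) g ∎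
   go (inj₁ (ℕ.s≤s k≤n)) = begin
    X (support k) g                                        ≈⟨ X-cong support-suc g ⟩
    X (χ (suc (n ℕ.∸ k))) g                          ≈⟨ X-χ-suc (ℕₚ.m∸n≤m n k) g ⟩
    eigenvalue (n ℕ.∸ (n ℕ.∸ k)) *ᶠ χ (suc (n ℕ.∸ k)) g +ᶠ χ (n ℕ.∸ k) g
      ≈⟨ +-cong (*-cong (reflexive (≡.cong eigenvalue (ℕₚ.m∸[m∸n]≡n k≤n))) (symᶠ (support-suc g))) (symᶠ (support-≤ (ℕ.s≤s k≤n) g)) ⟩
    eigenvalue k *ᶠ support k g +ᶠ support (suc k) g             ∎
    where
    support-suc : ∀ h → support k h ≈ᶠ χ (suc (n ℕ.∸ k)) h
    support-suc h = transᶠ (support-≤ k≤ h) (reflexive (≡.cong (λ l → χ l h) (ℕₚ.+-∸-assoc 1 k≤n)))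

  projection : ℕ → G → Carrier
  projection i g = sum {suc (suc n)} λ k → c i (toℕ k) *ᶠ support (toℕ k) g

  X-projection : ∀ i g → X (projection i) g ≈ᶠ eigenvalue i *ᶠ projection i g
  X-projection i g = begin
    X (projection i) g
      ≈⟨ sum-cong-≋ {suc n} (λ p → ∑-comm {m} {suc (suc n)} (λ ρ k → c i (toℕ k) *ᶠ support (toℕ k) (shuffle m n p ρ ⁻¹ ∙ g))) ⟩
    (sum {suc n} λ p → sum {suc (suc n)} λ k → sum {m} λ ρ → c i (toℕ k) *ᶠ support (toℕ k) (shuffle m n p ρ ⁻¹ ∙ g))
      ≈⟨ ∑-comm {suc n} {suc (suc n)} (λ p k → sum {m} λ ρ → c i (toℕ k) *ᶠ support (toℕ k) (shuffle m n p ρ ⁻¹ ∙ g)) ⟩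
    (sum {suc (suc n)} λ k → sum {suc n} λ p → sum {m} λ ρ → c i (toℕ k) *ᶠ support (toℕ k) (shuffle m n p ρ ⁻¹ ∙ g))
      ≈⟨ sum-cong-≋ {suc (suc n)} (λ k → X-* (c i (toℕ k)) (support (toℕ k)) g) ⟩
    (sum {suc (suc n)} λ k → c i (toℕ k) *ᶠ X (support (toℕ k)) g)
      ≈⟨ sum-cong-≋ {suc (suc n)} (λ k → *-congˡ {x = c i (toℕ k)} (X-support (ℕ.s≤s⁻¹ (Finₚ.toℕ<n k)) g)) ⟩
    (sum {suc (suc n)} λ k → c i (toℕ k) *ᶠ (eigenvalue (toℕ k) *ᶠ support (toℕ k) g +ᶠ support (suc (toℕ k)) g))
      ≈⟨ sum-shift (suc n) (c i) eigenvalue (λ k → support k g) (c-zero i) (c-suc i) ⟩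
    -- The term left by truncation lies one step past the last index, where `support` is zero.
    eigenvalue i *ᶠ projection i g +ᶠ c i (suc n) *ᶠ support (suc (suc n)) g
      ≈⟨ +-congˡ (transᶠ (*-congˡ (support-> ℕₚ.≤-refl g)) (zeroʳ _)) ⟩
    eigenvalue i *ᶠ projection i g +ᶠ 0#
      ≈⟨ +-identityʳ _ ⟩
    eigenvalue i *ᶠ projection i g ∎

  support-cong : ∀ k {g h} → g ≈ h → support k g ≈ᶠ support k h
  support-cong k {g} {h} g≈h = *-congˡ (indicator-⇔ (ordered? (suc n ℕ.∸ k) g) (ordered? (suc n ℕ.∸ k) h)
    (ordered-cong {g = g} {h} g≈h) (ordered-cong {g = h} {g} (≡.sym ∘ g≈h)))

  projection-cong : ∀ i {g h} → g ≈ h → projection i g ≈ᶠ projection i h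
  projection-cong i {g} {h} g≈h = sum-cong-≋ {suc (suc n)} λ k → *-congˡ {x = c i (toℕ k)} (support-cong (toℕ k) {g} {h} g≈h)

  -- Exchanging the sums produces the column sums of `c`, which remove every `support k` but
  -- `support 0`, the indicator of the identity.
  projection-resolution : ∀ g → sum {suc (suc n)} (λ i → projection (toℕ i) g) ≈ᶠ [ g ≟ ε ]
  projection-resolution g = begin
    sum {suc (suc n)} (λ i → projection (toℕ i) g)
      ≈⟨ ∑-comm {suc (suc n)} {suc (suc n)} (λ i k → c (toℕ i) (toℕ k) *ᶠ support (toℕ k) g) ⟩
    (sum {suc (suc n)} λ k → sum {suc (suc n)} λ i → c (toℕ i) (toℕ k) *ᶠ support (toℕ k) g)
      ≈⟨ sum-cong-≋ {suc (suc n)} (λ k → *-distribʳ-sum (support (toℕ k) g) (λ i → c (toℕ {suc (suc n)} i) (toℕ k))) ⟨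
    (sum {suc (suc n)} λ k → (sum {suc (suc n)} λ i → c (toℕ i) (toℕ k)) *ᶠ support (toℕ k) g)
      ≈⟨ +-cong (transᶠ (*-congʳ (column-sum-0 (suc n))) (*-identityˡ _))
           (sum-zero {R = commutativeRing} {n = suc n} λ k → transᶠ (*-congʳ {x = support (suc (toℕ k)) g} (column-sum-suc (Finₚ.toℕ<n k))) (zeroˡ (support (suc (toℕ k)) g))) ⟩
    support 0 g +ᶠ 0#           ≈⟨ +-identityʳ _ ⟩
    support 0 g                 ≈⟨ support-≤ ℕ.z≤n g ⟩
    χ (suc n) g           ≈⟨ indicator-⇔ (ordered? (suc n) g) (g ≟ ε) (ordered-n m (suc n) {g})
                               (λ g≈ε → ordered-cong {g = ε} {g} (≡.sym ∘ g≈ε) (ordered-ε (suc n))) ⟩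
    [ g ≟ ε ]             ∎

  projection-ε : ∀ i → projection i ε ≈ᶠ rowSum i (suc n)
  projection-ε i = sum-cong-≋ {suc (suc n)} λ k → transᶠ
    (*-congˡ {x = c i (toℕ k)} (transᶠ (support-≤ (ℕ.s≤s⁻¹ (Finₚ.toℕ<n k)) ε) (indicator-yes {R = commutativeRing} (ordered? (suc n ℕ.∸ toℕ k) ε) (ordered-ε (suc n ℕ.∸ toℕ k)))))
    (*-identityʳ (c i (toℕ k)))

-- The group algebra: coordinates, translates and traces.

module RegularRepresentation (F : Field a ℓ) (m : ℕ) .{{_ : NonZero m}} (n : ℕ) where

  open Field F hiding (_≟_)
    renaming (_≈_ to _≈ᶠ_; _+_ to _+ᶠ_; _*_ to _*ᶠ_; refl to reflᶠ; trans to transᶠ; sym to symᶠ)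
  open Sums F
  open Coefficients F m
  open ReflectionGroup m (suc n)
  open ShuffleOperator F m n
  open GroupRing commutativeRing group _≟_
  open LeftModule leftModule using (+ᴹ-commutativeMonoid)
  open Eigenspaces F leftModule
  open Enumeration F decSetoid elements elements-enumeration elements-unique public
  import Algebra.Properties.CommutativeMonoid.Sum +ᴹ-commutativeMonoid as Sumᴹ
  open import Algebra.Properties.Group group using (x∙y⁻¹≈ε⇒x≈y; x≈y⇒x∙y⁻¹≈ε)
  open import Relation.Binary.Reasoning.Setoid setoid

  if-indicator : ∀ (t : Bool) x → (if t then x else 0#) ≈ᶠ (if t then 1# else 0#) *ᶠ x
  if-indicator true  x = symᶠ (*-identityˡ x)
  if-indicator false x = symᶠ (zeroˡ x)

  coefficient-cong : ∀ v {g h} → g ≈ h → coefficient g v ≈ᶠ coefficient h v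
  coefficient-cong []            g≈h = reflᶠ
  coefficient-cong ((r , u) ∷ v) {g} {h} g≈h = +-cong
    (reflexive (≡.cong (λ t → if t then r else 0#)
      (does-⇔ (mk⇔ (λ eq e → ≡.trans (eq e) (g≈h e)) (λ eq e → ≡.trans (eq e) (≡.sym (g≈h e)))) (u ≟ g) (u ≟ h))))
    (coefficient-cong v {g} {h} g≈h)

  fromFunction : (G → Carrier) → R[G]
  fromFunction f = tabulate λ i → f (element i) , element i

  coefficient-fromFunction : ∀ f → (∀ {g h} → g ≈ h → f g ≈ᶠ f h) → ∀ g → coefficient g (fromFunction f) ≈ᶠ f g
  coefficient-fromFunction f f-cong g = transᶠ (go element) (sum-delta {f} (λ {x} {y} → f-cong {x} {y}) g)
    where
    go : ∀ {k} (el : Fin k → G) →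
      coefficient g (tabulate λ i → f (el i) , el i) ≈ᶠ sum (λ i → [ el i ≟ g ] *ᶠ f (el i))
    go {zero}  el = reflᶠ
    go {suc k} el = +-cong (if-indicator (does (el zero ≟ g)) (f (el zero))) (go (el ∘ suc))

  coordinate : Fin order → R[G] → Carrier
  coordinate a = coefficient (element a)

  coefficient-functional : ∀ g → Functional (coefficient g)
  coefficient-functional g = record
    { φ-cong = λ eq → eq g
    ; φ-+    = coefficient-++ g
    ; φ-*    = coefficient-· g
    }

  faithful : ∀ {v} → (∀ a → coordinate a v ≈ᶠ 0#) → v ≈ᴳ []
  faithful {v} eq g = transᶠ
    (coefficient-cong v {g} {element (index g)} (λ e → ≡.sym (element-index g e))) (eq (index g))

  -- The right translate of pᵢ by `element a`. Right translation commutes with left multiplication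
  -- by the shuffle element, so every translate stays in the eigenspace.
  eigenvector : ℕ → Fin order → R[G]
  eigenvector i a = fromFunction λ g → projection i (g ∙ element a ⁻¹)

  coefficient-eigenvector : ∀ i a g → coefficient g (eigenvector i a) ≈ᶠ projection i (g ∙ element a ⁻¹)
  coefficient-eigenvector i a = coefficient-fromFunction (λ g → projection i (g ∙ element a ⁻¹))
    λ {g} {h} g≈h → projection-cong i {g ∙ element a ⁻¹} {h ∙ element a ⁻¹} λ e → g≈h _

  -- This is v = (Σᵢ pᵢ) v, with `v` expanded over the listed group elements.
  eigenvector-resolution : ∀ v →
    v ≈ᴳ Sumᴹ.sum {suc (suc n)} (λ i → linearCombination (λ a → coordinate a v) (eigenvector (toℕ i)))
  eigenvector-resolution v g = symᶠ (begin
    coefficient g (Sumᴹ.sum {suc (suc n)} (λ i → linearCombination (λ a → coordinate a v) (eigenvector (toℕ i))))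
      ≈⟨ φ-sum {suc (suc n)} (λ i → linearCombination (λ a → coordinate a v) (eigenvector (toℕ i))) ⟩
    (sum {suc (suc n)} λ i → coefficient g (linearCombination (λ a → coordinate a v) (eigenvector (toℕ i))))
      ≈⟨ sum-cong-≋ {suc (suc n)} (λ i → transᶠ (φ-combination (λ a → coordinate a v) (eigenvector (toℕ i)))
           (sum-cong-≋ {order} λ a → *-congˡ {x = coordinate a v} (coefficient-eigenvector (toℕ i) a g))) ⟩
    (sum {suc (suc n)} λ i → sum {order} λ a → coordinate a v *ᶠ projection (toℕ i) (g ∙ element a ⁻¹))
      ≈⟨ ∑-comm {suc (suc n)} {order} (λ i a → coordinate a v *ᶠ projection (toℕ i) (g ∙ element a ⁻¹)) ⟩
    (sum {order} λ a → sum {suc (suc n)} λ i → coordinate a v *ᶠ projection (toℕ i) (g ∙ element a ⁻¹))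
      ≈⟨ sum-cong-≋ {order} (λ a → *-distribˡ-sum {suc (suc n)} (coordinate a v) (λ i → projection (toℕ i) (g ∙ element a ⁻¹))) ⟨
    (sum {order} λ a → coordinate a v *ᶠ sum {suc (suc n)} λ i → projection (toℕ i) (g ∙ element a ⁻¹))
      ≈⟨ sum-cong-≋ {order} (λ a → transᶠ
           (*-congˡ {x = coordinate a v} (transᶠ (projection-resolution (g ∙ element a ⁻¹)) (quotient-trivial a)))
           (*-comm (coordinate a v) [ element a ≟ g ])) ⟩
    (sum {order} λ a → [ element a ≟ g ] *ᶠ coordinate a v)
      ≈⟨ sum-delta {λ h → coefficient h v} (λ {x} {y} → coefficient-cong v {x} {y}) g ⟩
    coefficient g v ∎)
    where
    open Functional (coefficient-functional g)
    quotient-trivial : ∀ a → [ (g ∙ element a ⁻¹) ≟ ε ] ≈ᶠ [ element a ≟ g ]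
    quotient-trivial a = indicator-⇔ ((g ∙ element a ⁻¹) ≟ ε) (element a ≟ g)
      (λ eq e → ≡.sym (x∙y⁻¹≈ε⇒x≈y g (element a) eq e))
      (λ eq → x≈y⇒x∙y⁻¹≈ε {g} {element a} λ e → ≡.sym (eq e))

  -- The coefficient of a in pᵢ a is pᵢ(1) for every a, so the diagonal is constant.
  eigenvector-trace : ∀ i → sum (λ a → coordinate a (eigenvector i a)) ≈ᶠ cast order *ᶠ rowSum i (suc n)
  eigenvector-trace i = transᶠ
    (sum-cong-≋ {order} λ a → transᶠ (coefficient-eigenvector i a (element a)) (transᶠ
      (projection-cong i {element a ∙ element a ⁻¹} {ε} (Group.inverseʳ group (element a))) (projection-ε i)))
    (sum-const order (rowSum i (suc n)))

  -- `f` enters through its action on coefficients alone, which separates the spectrum from the way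
  -- the operator computes on lists.
  module Spectrum (f : R[G] → R[G]) (coefficient-f : ∀ v g → coefficient g (f v) ≈ᶠ X (λ h → coefficient h v) g) where

    f-operator : Operator f
    f-operator = record
      { f-cong = λ {u} {v} eq g → transᶠ (coefficient-f u g) (transᶠ (X-cong eq g) (symᶠ (coefficient-f v g)))
      ; f-+    = λ u v g → begin
          coefficient g (f (u List.++ v))                              ≈⟨ coefficient-f _ g ⟩
          X (λ h → coefficient h (u List.++ v)) g                      ≈⟨ X-cong (λ h → coefficient-++ h u v) g ⟩
          X (λ h → coefficient h u +ᶠ coefficient h v) g
            ≈⟨ X-+ (λ h → coefficient h u) (λ h → coefficient h v) g ⟩
          X (λ h → coefficient h u) g +ᶠ X (λ h → coefficient h v) g
            ≈⟨ +-cong (coefficient-f u g) (coefficient-f v g) ⟨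
          coefficient g (f u) +ᶠ coefficient g (f v)                             ≈⟨ coefficient-++ g (f u) (f v) ⟨
          coefficient g (f u List.++ f v)                              ∎
      ; f-*    = λ r v g → begin
          coefficient g (f (r · v))              ≈⟨ coefficient-f _ g ⟩
          X (λ h → coefficient h (r · v)) g      ≈⟨ X-cong (λ h → coefficient-· h r v) g ⟩
          X (λ h → r *ᶠ coefficient h v) g       ≈⟨ X-* r (λ h → coefficient h v) g ⟩
          r *ᶠ X (λ h → coefficient h v) g       ≈⟨ *-congˡ (coefficient-f v g) ⟨
          r *ᶠ coefficient g (f v)               ≈⟨ coefficient-· g r (f v) ⟨
          coefficient g (r · f v)                ∎
      }

    eigenvector-eigen : ∀ i a → Eigenspace f (eigenvalue i) (eigenvector i a)
    eigenvector-eigen i a g = begin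
      coefficient g (f (eigenvector i a))                        ≈⟨ coefficient-f (eigenvector i a) g ⟩
      X (λ h → coefficient h (eigenvector i a)) g                ≈⟨ X-cong (coefficient-eigenvector i a) g ⟩
      X (λ h → projection i (h ∙ element a ⁻¹)) g
        ≈⟨ sum-cong-≋ {suc n} (λ p → sum-cong-≋ {m} λ ρ → projection-cong i
             {(shuffle m n p ρ ⁻¹ ∙ g) ∙ element a ⁻¹} {shuffle m n p ρ ⁻¹ ∙ (g ∙ element a ⁻¹)} λ _ → ≡.refl) ⟩
      X (projection i) (g ∙ element a ⁻¹)                        ≈⟨ X-projection i (g ∙ element a ⁻¹) ⟩
      eigenvalue i *ᶠ projection i (g ∙ element a ⁻¹)            ≈⟨ *-congˡ (coefficient-eigenvector i a g) ⟨
      eigenvalue i *ᶠ coefficient g (eigenvector i a)            ≈⟨ coefficient-· g (eigenvalue i) (eigenvector i a) ⟨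
      coefficient g (eigenvalue i · eigenvector i a)             ∎

    open Decomposition f-operator coordinate (λ a → coefficient-functional (element a)) (λ {u} → faithful {u})
      {suc (suc n)} (λ i → eigenvalue (toℕ i)) (λ eq → Finₚ.toℕ-injective (eigenvalue-injective eq))
      (λ i → eigenvector (toℕ i)) (λ i → eigenvector-eigen (toℕ i)) eigenvector-resolution public

-- Binomial coefficients, stabilisers and counting by fixed points.

open import Data.Nat.Combinatorics using (_C_; nC1≡n; nCk+nC[k+1]≡[n+1]C[k+1]; k>n⇒nCk≡0)

-- Pascal's rule reduces the claim to the two claims one row lower. It gives the binomial
-- coefficients the recurrence of the fixed-point counts.
C-absorption : ∀ n k → suc k ℕ.* (suc n C suc k) ≡ suc n ℕ.* (n C k)
C-absorption zero    zero    = ≡.refl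
C-absorption zero    (suc k) = ≡.trans
  (≡.cong (suc (suc k) ℕ.*_) (k>n⇒nCk≡0 {1} {suc (suc k)} (ℕ.s≤s (ℕ.s≤s ℕ.z≤n))))
  (ℕₚ.*-zeroʳ (suc (suc k)))
C-absorption (suc n) zero    = ≡.trans (ℕₚ.*-identityˡ _) (≡.trans (nC1≡n (suc (suc n))) (≡.sym (ℕₚ.*-identityʳ _)))
C-absorption (suc n) (suc k) = begin
  suc (suc k) ℕ.* (suc (suc n) C suc (suc k))
    ≡⟨ ≡.cong (suc (suc k) ℕ.*_) (nCk+nC[k+1]≡[n+1]C[k+1] (suc n) (suc k)) ⟨
  suc (suc k) ℕ.* (c₁ ℕ.+ c₂)
    ≡⟨ ℕₚ.*-distribˡ-+ (suc (suc k)) c₁ c₂ ⟩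
  (c₁ ℕ.+ suc k ℕ.* c₁) ℕ.+ suc (suc k) ℕ.* c₂
    ≡⟨ ≡.cong₂ (λ x y → (c₁ ℕ.+ x) ℕ.+ y) (C-absorption n k) (C-absorption n (suc k)) ⟩
  (c₁ ℕ.+ suc n ℕ.* (n C k)) ℕ.+ suc n ℕ.* (n C suc k)
    ≡⟨ ℕₚ.+-assoc c₁ _ _ ⟩
  c₁ ℕ.+ (suc n ℕ.* (n C k) ℕ.+ suc n ℕ.* (n C suc k))
    ≡⟨ ≡.cong (c₁ ℕ.+_) (ℕₚ.*-distribˡ-+ (suc n) (n C k) (n C suc k)) ⟨
  c₁ ℕ.+ suc n ℕ.* (n C k ℕ.+ n C suc k)
    ≡⟨ ≡.cong (λ x → c₁ ℕ.+ suc n ℕ.* x) (nCk+nC[k+1]≡[n+1]C[k+1] n k) ⟩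
  suc (suc n) ℕ.* c₁ ∎
  where
  open ≡-Reasoning
  c₁ = suc n C suc k
  c₂ = suc n C suc (suc k)

module Stabiliser (m : ℕ) .{{_ : NonZero m}} (n : ℕ) where

  open Cyclic m using (C; 1ᶜ)
  private
    module S = ReflectionGroup m n
    module T = ReflectionGroup m (suc n)
    module SP = Positions m n
    module TP = Positions m (suc n)
    module C = Group (Cyclic.cyclicGroup m)
  open ≡-Reasoning

  module _ (x : Fin (suc n)) where

    private
      insertion : S.G → Permutation′ (suc n)
      insertion u = Perm.insert x x (SP.positions u)

      insertion-at : ∀ u → insertion u ⟨$⟩ʳ x ≡ x
      insertion-at u with x Finₚ.≟ x
      ... | yes _   = ≡.refl
      ... | no  x≢x = contradiction ≡.refl x≢x

    -- Identifies G(m,1,n) with the stabiliser of the point (x , 1), acting on the places other than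
    -- `x`.
    embed : S.G → T.G
    embed u = T.monomial (insertion u) (insertAt (SP.colour u) x 1ᶜ)

    embed-at : ∀ u → T.to (embed u) (x , 1ᶜ) ≡ (x , 1ᶜ)
    embed-at u = ≡.cong₂ _,_ (insertion-at u)
      (≡.trans (C.identityˡ _) (Vectorₚ.insertAt-lookup (SP.colour u) x 1ᶜ))

    embed-punchIn : ∀ u y → T.to (embed u) (punchIn x y , 1ᶜ) ≡ (punchIn x (SP.position u y) , SP.colour u y)
    embed-punchIn u y = ≡.cong₂ _,_ (Perm.insert-punchIn x x (SP.positions u) y)
      (≡.trans (C.identityˡ _) (Vectorₚ.insertAt-punchIn (SP.colour u) x 1ᶜ y))

    ≈-ext-punchIn : ∀ {g h} → T.to g (x , 1ᶜ) ≡ T.to h (x , 1ᶜ) →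
      (∀ y → T.to g (punchIn x y , 1ᶜ) ≡ T.to h (punchIn x y , 1ᶜ)) → g T.≈ h
    ≈-ext-punchIn {g} {h} at other = TP.≈-ext {g} {h} λ z → case x Finₚ.≟ z of λ where
      (yes ≡.refl) → at
      (no x≢z)     → ≡.subst (λ z → T.to g (z , 1ᶜ) ≡ T.to h (z , 1ᶜ)) (Finₚ.punchIn-punchOut x≢z) (other _)

    embed-cong : ∀ {u v} → u S.≈ v → embed u T.≈ embed v
    embed-cong {u} {v} u≈v = ≈-ext-punchIn {embed u} {embed v} (≡.trans (embed-at u) (≡.sym (embed-at v))) λ y → begin
      T.to (embed u) (punchIn x y , 1ᶜ)             ≡⟨ embed-punchIn u y ⟩
      (punchIn x (SP.position u y) , SP.colour u y)
        ≡⟨ ≡.cong₂ (λ z c → punchIn x z , c) (SP.position-cong {u} {v} u≈v y) (SP.colour-cong {u} {v} u≈v y) ⟩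
      (punchIn x (SP.position v y) , SP.colour v y) ≡⟨ embed-punchIn v y ⟨
      T.to (embed v) (punchIn x y , 1ᶜ)             ∎

    embed-injective : ∀ {u v} → embed u T.≈ embed v → u S.≈ v
    embed-injective {u} {v} eq = SP.≈-ext {u} {v} λ y →
      let eq′ = ≡.trans (≡.sym (embed-punchIn u y)) (≡.trans (eq (punchIn x y , 1ᶜ)) (embed-punchIn v y))
      in ≡.cong₂ _,_ (Finₚ.punchIn-injective x _ _ (≡.cong proj₁ eq′)) (≡.cong proj₂ eq′)

    embed-onto : ∀ {g} → T.to g (x , 1ᶜ) ≡ (x , 1ᶜ) → ∃[ u ] g T.≈ embed u
    embed-onto {g} fixed = u , ≈-ext-punchIn {g} {embed u} (≡.trans fixed (≡.sym (embed-at u))) λ y → begin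
      T.to g (punchIn x y , 1ᶜ)
        ≡⟨ ≡.cong (_, TP.colour g (punchIn x y)) (Perm.punchIn-permute (TP.positions g) x y) ⟩
      (punchIn (TP.position g x) (π ⟨$⟩ʳ y) , TP.colour g (punchIn x y))
        ≡⟨ ≡.cong₂ (λ z c → punchIn z (π ⟨$⟩ʳ y) , c) (≡.cong proj₁ fixed) (≡.sym (C.identityˡ _)) ⟩
      (punchIn x (SP.position u y) , SP.colour u y)
        ≡⟨ embed-punchIn u y ⟨
      T.to (embed u) (punchIn x y , 1ᶜ) ∎
      where
      π = Perm.remove x (TP.positions g)
      u : S.G
      u = S.monomial π (λ y → TP.colour g (punchIn x y))

  -- Representatives of the cosets of the stabiliser of (zero , 1), one for each image (y , ρ).
  translate : Fin (suc n) → C → T.G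
  translate y ρ = T.monomial (transpose zero y) (λ _ → ρ)

  translate-zero : ∀ y ρ → T.to (translate y ρ) (zero , 1ᶜ) ≡ (y , ρ)
  translate-zero y ρ = ≡.cong₂ _,_ (transpose-ˡ zero y) (C.identityˡ ρ)

module Counting (F : Field a ℓ) (m : ℕ) .{{_ : NonZero m}} where

  open Field F hiding (_≟_)
    renaming (_≈_ to _≈ᶠ_; _+_ to _+ᶠ_; _*_ to _*ᶠ_; refl to reflᶠ; trans to transᶠ; sym to symᶠ)
  open Sums F
  open Coefficients F m
  open import Relation.Binary.Reasoning.Setoid setoid

  cast-filter-tabulate : ∀ {A : Set b} {P : Pred A ℓ₁} (P? : Relation.Unary.Decidable P) {n} (f : Fin n → A) →
    cast (length (filter P? (tabulate f))) ≈ᶠ sum (λ i → [ P? (f i) ])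
  cast-filter-tabulate P? {zero}  f = reflᶠ
  cast-filter-tabulate P? {suc n} f with P? (f zero)
  ... | yes _ = +-congˡ (cast-filter-tabulate P? (f ∘ suc))
  ... | no _  = transᶠ (cast-filter-tabulate P? (f ∘ suc)) (symᶠ (+-identityˡ _))

  module Enumerated (n : ℕ) where

    open ReflectionGroup m n public
    open Enumeration F decSetoid elements elements-enumeration elements-unique public

    fixes? : ∀ x g → Dec (to g (x , 1ᶜ) ≡ (x , 1ᶜ))
    fixes? x g = to g (x , 1ᶜ) ≟ᴱ (x , 1ᶜ)

    cast-fixedPoints : ∀ g → cast (fixedPoints g) ≈ᶠ sum {n} (λ x → [ fixes? x g ])
    cast-fixedPoints g = cast-filter-tabulate (λ x → fixes? x g) {n} id

    fixedPoints-cong : ∀ {g h} → g ≈ h → fixedPoints g ≡ fixedPoints h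
    fixedPoints-cong {g} {h} g≈h = cast-injective _ _ (transᶠ (cast-fixedPoints g) (transᶠ
      (sum-cong-≋ {n} λ x → indicator-⇔ (fixes? x g) (fixes? x h)
        (λ eq → ≡.trans (≡.sym (g≈h (x , 1ᶜ))) eq) (λ eq → ≡.trans (g≈h (x , 1ᶜ)) eq))
      (symᶠ (cast-fixedPoints h))))

    fixedPoints≤n : ∀ g → fixedPoints g ℕ.≤ n
    fixedPoints≤n g = ℕₚ.≤-trans (Listₚ.length-filter (λ x → fixes? x g) (allFin n)) (ℕₚ.≤-reflexive (Listₚ.length-tabulate id))

    cast-withFixedPoints : ∀ i → cast (#withFixedPoints i) ≈ᶠ sum (λ a → [ fixedPoints (element a) ℕₚ.≟ i ])
    cast-withFixedPoints i = cast-filter (λ g → fixedPoints g ℕₚ.≟ i) elements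

    withFixedPoints-total : sum {suc n} (λ i → cast (#withFixedPoints (toℕ i))) ≈ᶠ cast order
    withFixedPoints-total = begin
      sum {suc n} (λ i → cast (#withFixedPoints (toℕ i)))
        ≈⟨ sum-cong-≋ {suc n} (λ i → cast-withFixedPoints (toℕ i)) ⟩
      (sum {suc n} λ i → sum {order} λ a → [ fixedPoints (element a) ℕₚ.≟ toℕ i ])
        ≈⟨ ∑-comm {suc n} {order} (λ i a → [ fixedPoints (element a) ℕₚ.≟ toℕ i ]) ⟩
      (sum {order} λ a → sum {suc n} λ i → [ fixedPoints (element a) ℕₚ.≟ toℕ i ])
        ≈⟨ sum-cong-≋ {order} (λ a → one (element a)) ⟩
      (sum {order} λ _ → 1#)
        ≈⟨ transᶠ (sum-const order 1#) (*-identityʳ _) ⟩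
      cast order ∎
      where
      one : ∀ g → (sum {suc n} λ i → [ fixedPoints g ℕₚ.≟ toℕ i ]) ≈ᶠ 1#
      one g = transᶠ
        (sum-single {R = commutativeRing} {n = suc n} i₀ λ j j≢ → indicator-no {R = commutativeRing} (fixedPoints g ℕₚ.≟ toℕ j)
          λ eq → j≢ (Finₚ.toℕ-injective (≡.trans (≡.sym eq) (≡.sym toℕ-i₀))))
        (indicator-yes {R = commutativeRing} (fixedPoints g ℕₚ.≟ toℕ i₀) (≡.sym toℕ-i₀))
        where
        i₀ = fromℕ< (ℕ.s≤s (fixedPoints≤n g))
        toℕ-i₀ : toℕ i₀ ≡ fixedPoints g
        toℕ-i₀ = Finₚ.toℕ-fromℕ< (ℕ.s≤s (fixedPoints≤n g))

  module Recurrences (n : ℕ) where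

    open Stabiliser m n
    private
      module S = Enumerated n
      module T = Enumerated (suc n)
    open ChangeOfVariables F T.decSetoid T.elements T.elements-enumeration T.elements-unique
                             S.decSetoid S.elements S.elements-enumeration S.elements-unique

    fixedPoints-embed : ∀ x u → T.fixedPoints (embed x u) ≡ suc (S.fixedPoints u)
    fixedPoints-embed x u = cast-injective _ _ (begin
      cast (T.fixedPoints (embed x u))                          ≈⟨ T.cast-fixedPoints (embed x u) ⟩
      sum {suc n} (λ z → [ T.fixes? z (embed x u) ])            ≈⟨ sum-remove {n} {x} (λ z → [ T.fixes? z (embed x u) ]) ⟩
      [ T.fixes? x (embed x u) ] +ᶠ sum {n} (λ y → [ T.fixes? (punchIn x y) (embed x u) ])
        ≈⟨ +-cong (indicator-yes {R = commutativeRing} (T.fixes? x (embed x u)) (embed-at x u))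
             (sum-cong-≋ {n} λ y → indicator-⇔ (T.fixes? (punchIn x y) (embed x u)) (S.fixes? y u) (restrict y) (extend y)) ⟩
      1# +ᶠ sum {n} (λ y → [ S.fixes? y u ])                    ≈⟨ +-congˡ (S.cast-fixedPoints u) ⟨
      cast (suc (S.fixedPoints u))                              ∎)
      where
      restrict : ∀ y → T.to (embed x u) (punchIn x y , T.1ᶜ) ≡ (punchIn x y , T.1ᶜ) → S.to u (y , S.1ᶜ) ≡ (y , S.1ᶜ)
      restrict y eq = let eq′ = ≡.trans (≡.sym (embed-punchIn x u y)) eq in
        ≡.cong₂ _,_ (Finₚ.punchIn-injective x _ _ (≡.cong proj₁ eq′)) (≡.cong proj₂ eq′)
      extend : ∀ y → S.to u (y , S.1ᶜ) ≡ (y , S.1ᶜ) → T.to (embed x u) (punchIn x y , T.1ᶜ) ≡ (punchIn x y , T.1ᶜ)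
      extend y eq = ≡.trans (embed-punchIn x u y) (≡.cong (λ (z , c) → punchIn x z , c) eq)

    -- Counts the pairs (g , x) in which g has 1 + i fixed points, x being one of them.
    withFixedPoints-suc : ∀ i → cast (suc i) *ᶠ cast (T.#withFixedPoints (suc i)) ≈ᶠ cast (suc n) *ᶠ cast (S.#withFixedPoints i)
    withFixedPoints-suc i = begin
      cast (suc i) *ᶠ cast (T.#withFixedPoints (suc i))
        ≈⟨ *-congˡ (T.cast-withFixedPoints (suc i)) ⟩
      cast (suc i) *ᶠ sum (λ a → [ T.fixedPoints (T.element a) ℕₚ.≟ suc i ])
        ≈⟨ *-distribˡ-sum {T.order} (cast (suc i)) (λ a → [ T.fixedPoints (T.element a) ℕₚ.≟ suc i ]) ⟩
      (sum {T.order} λ a → cast (suc i) *ᶠ [ T.fixedPoints (T.element a) ℕₚ.≟ suc i ])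
        ≈⟨ sum-cong-≋ {T.order} (λ a → points (T.element a)) ⟩
      (sum {T.order} λ a → sum {suc n} λ x → [ T.fixes? x (T.element a) ] *ᶠ [ T.fixedPoints (T.element a) ℕₚ.≟ suc i ])
        ≈⟨ ∑-comm {T.order} {suc n} (λ a x → [ T.fixes? x (T.element a) ] *ᶠ [ T.fixedPoints (T.element a) ℕₚ.≟ suc i ]) ⟩
      (sum {suc n} λ x → sum {T.order} λ a → [ T.fixes? x (T.element a) ] *ᶠ [ T.fixedPoints (T.element a) ℕₚ.≟ suc i ])
        ≈⟨ sum-cong-≋ {suc n} stabiliser ⟩
      (sum {suc n} λ _ → cast (S.#withFixedPoints i))
        ≈⟨ sum-const (suc n) (cast (S.#withFixedPoints i)) ⟩
      cast (suc n) *ᶠ cast (S.#withFixedPoints i) ∎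
      where
      points : ∀ g → cast (suc i) *ᶠ [ T.fixedPoints g ℕₚ.≟ suc i ] ≈ᶠ
        sum {suc n} (λ x → [ T.fixes? x g ] *ᶠ [ T.fixedPoints g ℕₚ.≟ suc i ])
      points g = transᶠ (agree (T.fixedPoints g ℕₚ.≟ suc i)) (transᶠ
        (*-congʳ (T.cast-fixedPoints g))
        (*-distribʳ-sum {suc n} [ T.fixedPoints g ℕₚ.≟ suc i ] (λ x → [ T.fixes? x g ])))
        where
        agree : ∀ (eq? : Dec (T.fixedPoints g ≡ suc i)) → cast (suc i) *ᶠ [ eq? ] ≈ᶠ cast (T.fixedPoints g) *ᶠ [ eq? ]
        agree (yes eq) = *-congʳ (reflexive (≡.cong cast (≡.sym eq)))
        agree (no _)   = transᶠ (zeroʳ _) (symᶠ (zeroʳ _))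
      stabiliser : ∀ x → (sum {T.order} λ a → [ T.fixes? x (T.element a) ] *ᶠ [ T.fixedPoints (T.element a) ℕₚ.≟ suc i ])
        ≈ᶠ cast (S.#withFixedPoints i)
      stabiliser x = begin
        (sum {T.order} λ a → [ T.fixes? x (T.element a) ] *ᶠ [ T.fixedPoints (T.element a) ℕₚ.≟ suc i ])
          ≈⟨ sum-image (T.fixes? x) (embed x)
               (λ {u} {v} → embed-injective x {u} {v}) (λ {u} {v} → embed-cong x {u} {v}) (λ {g} → embed-onto x {g})
               (λ u eq → ≡.trans (eq (x , T.1ᶜ)) (embed-at x u))
               {λ g → [ T.fixedPoints g ℕₚ.≟ suc i ]}
               (λ {g} {h} g≈h → reflexive (≡.cong (λ k → [ k ℕₚ.≟ suc i ]) (T.fixedPoints-cong {g} {h} g≈h))) ⟩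
        (sum {S.order} λ b → [ T.fixedPoints (embed x (S.element b)) ℕₚ.≟ suc i ])
          ≈⟨ sum-cong-≋ {S.order} (λ b → indicator-⇔
               (T.fixedPoints (embed x (S.element b)) ℕₚ.≟ suc i) (S.fixedPoints (S.element b) ℕₚ.≟ i)
               (λ eq → ℕₚ.suc-injective (≡.trans (≡.sym (fixedPoints-embed x (S.element b))) eq))
               (λ eq → ≡.trans (fixedPoints-embed x (S.element b)) (≡.cong suc eq))) ⟩
        (sum {S.order} λ b → [ S.fixedPoints (S.element b) ℕₚ.≟ i ])
          ≈⟨ S.cast-withFixedPoints i ⟨
        cast (S.#withFixedPoints i) ∎

    -- Orbit and stabiliser: the image of (zero , 1) splits the group into (n+1) m cosets, each in
    -- bijection with G(m,1,n) through `translate` and `embed zero`.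
    order-suc : cast T.order ≈ᶠ cast (suc n) *ᶠ (cast m *ᶠ cast S.order)
    order-suc = begin
      cast T.order                                  ≈⟨ transᶠ (sum-const T.order 1#) (*-identityʳ _) ⟨
      (sum {T.order} λ _ → 1#)                      ≈⟨ sum-cong-≋ {T.order} (λ a → partition (T.element a)) ⟩
      (sum {T.order} λ a → sum {suc n} λ y → sum {m} λ ρ → [ image? y ρ (T.element a) ])
        ≈⟨ ∑-comm {T.order} {suc n} (λ a y → sum {m} λ ρ → [ image? y ρ (T.element a) ]) ⟩
      (sum {suc n} λ y → sum {T.order} λ a → sum {m} λ ρ → [ image? y ρ (T.element a) ])
        ≈⟨ sum-cong-≋ {suc n} (λ y → ∑-comm {T.order} {m} (λ a ρ → [ image? y ρ (T.element a) ])) ⟩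
      (sum {suc n} λ y → sum {m} λ ρ → sum {T.order} λ a → [ image? y ρ (T.element a) ])
        ≈⟨ sum-cong-≋ {suc n} (λ y → sum-cong-≋ {m} λ ρ → coset y ρ) ⟩
      (sum {suc n} λ _ → sum {m} λ _ → cast S.order)
        ≈⟨ transᶠ (sum-const (suc n) _) (*-congˡ (sum-const m (cast S.order))) ⟩
      cast (suc n) *ᶠ (cast m *ᶠ cast S.order)      ∎
      where
      image? : ∀ y ρ g → Dec (T.to g (zero , T.1ᶜ) ≡ (y , ρ))
      image? y ρ g = T.to g (zero , T.1ᶜ) T.≟ᴱ (y , ρ)
      partition : ∀ g → 1# ≈ᶠ sum {suc n} λ y → sum {m} λ ρ → [ image? y ρ g ]
      partition g = symᶠ (transᶠ
        (sum-single {R = commutativeRing} {n = suc n} (proj₁ e) λ y y≢ → sum-zero {R = commutativeRing} {n = m} λ ρ →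
          indicator-no {R = commutativeRing} (image? y ρ g) λ eq → y≢ (≡.sym (≡.cong proj₁ eq)))
        (transᶠ
          (sum-single {R = commutativeRing} {n = m} (proj₂ e) λ ρ ρ≢ →
            indicator-no {R = commutativeRing} (image? (proj₁ e) ρ g) λ eq → ρ≢ (≡.sym (≡.cong proj₂ eq)))
          (indicator-yes {R = commutativeRing} (image? (proj₁ e) (proj₂ e) g) ≡.refl)))
        where
        e = T.to g (zero , T.1ᶜ)
      coset : ∀ y ρ → (sum {T.order} λ a → [ image? y ρ (T.element a) ]) ≈ᶠ cast S.order
      coset y ρ = begin
        (sum {T.order} λ a → [ image? y ρ (T.element a) ])
          ≈⟨ sum-cong-≋ {T.order} (λ a → *-identityʳ [ image? y ρ (T.element a) ]) ⟨
        (sum {T.order} λ a → [ image? y ρ (T.element a) ] *ᶠ 1#)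
          ≈⟨ sum-image (image? y ρ) (λ u → h T.∙ embed zero u)
               (λ {u} {v} eq → embed-injective zero {u} {v} (∙-cancelˡ h (embed zero u) (embed zero v) eq))
               (λ {u} {v} eq e → ≡.cong (T.to h) (embed-cong zero {u} {v} eq e))
               (λ {g} eq → let (u , eq′) = embed-onto zero {h T.⁻¹ T.∙ g} (fixed g eq) in
                 u , λ e → ≡.trans (≡.sym (T.G.strictlyInverseˡ h (T.to g e))) (≡.cong (T.to h) (eq′ e)))
               (λ u eq → ≡.trans (eq (zero , T.1ᶜ)) (≡.trans (≡.cong (T.to h) (embed-at zero u)) (translate-zero y ρ)))
               {λ _ → 1#} (λ _ → reflᶠ) ⟩
        (sum {S.order} λ _ → 1#)
          ≈⟨ transᶠ (sum-const S.order 1#) (*-identityʳ _) ⟩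
        cast S.order ∎
        where
        open import Algebra.Properties.Group T.group using (∙-cancelˡ)
        h = translate y ρ
        fixed : ∀ g → T.to g (zero , T.1ᶜ) ≡ (y , ρ) → T.from h (T.to g (zero , T.1ᶜ)) ≡ (zero , T.1ᶜ)
        fixed g eq = ≡.trans (≡.cong (T.from h) (≡.trans eq (≡.sym (translate-zero y ρ)))) (T.G.strictlyInverseʳ h (zero , T.1ᶜ))

open import Defs

-- Comparison of traces with fixed-point counts.

module FixedPointStatistics (F : Field a ℓ) (m : ℕ) .{{_ : NonZero m}} where

  open Field F
  open Sums F
  open Coefficients F m
  open Counting F m
  open import Relation.Binary.Reasoning.Setoid setoid

  private
    order : ℕ → ℕ
    order n = Enumerated.order n

    # : ℕ → ℕ → ℕ
    # n = ReflectionGroup.#withFixedPoints m n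

    Formula : ℕ → ℕ → Set ℓ
    Formula n i = cast (# n i) ≈ cast (order n) * rowSum i n

    -- Both families have the same total and agree at every positive index, so the entry at 0 is
    -- forced.
    formula-zero : ∀ n → (∀ i → Formula n (suc i)) → Formula n 0
    formula-zero n positive = ∙-cancelʳ (sum {n} λ i → cast (# n (suc (toℕ i)))) _ _ (begin
      sum {suc n} (λ i → cast (# n (toℕ i)))            ≈⟨ Enumerated.withFixedPoints-total n ⟩
      cast (order n)                                    ≈⟨ *-identityʳ _ ⟨
      cast (order n) * 1#                               ≈⟨ *-congˡ (rowSum-total n) ⟨
      cast (order n) * (sum {suc n} λ i → rowSum (toℕ i) n)  ≈⟨ *-distribˡ-sum {suc n} (cast (order n)) (λ i → rowSum (toℕ i) n) ⟩
      cast (order n) * rowSum 0 n + (sum {n} λ i → cast (order n) * rowSum (suc (toℕ i)) n)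
        ≈⟨ +-congˡ (sum-cong-≋ {n} λ i → positive (toℕ i)) ⟨
      cast (order n) * rowSum 0 n + (sum {n} λ i → cast (# n (suc (toℕ i)))) ∎)
      where open import Algebra.Properties.Group +-group using (∙-cancelʳ)

    -- Both sides are multiplied by (i+1) m: the factor i+1 serves the recurrence of the counts, the
    -- factor m the growth of the order, and their product lowers the row sum.
    formula-suc : ∀ n i → Formula n i → Formula (suc n) (suc i)
    formula-suc n i ih = *-cancelˡ-eigenvalue i (begin
      eigenvalue (suc i) * cast (# (suc n) (suc i))
        ≈⟨ *-congʳ (×1-homo-* (suc i) m) ⟩
      cast (suc i) * cast m * cast (# (suc n) (suc i))
        ≈⟨ solve 3 (λ i m x → i :* m :* x := m :* (i :* x)) refl (cast (suc i)) (cast m) (cast (# (suc n) (suc i))) ⟩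
      cast m * (cast (suc i) * cast (# (suc n) (suc i)))
        ≈⟨ *-congˡ (trans (Recurrences.withFixedPoints-suc n i) (*-congˡ ih)) ⟩
      cast m * (cast (suc n) * (cast (order n) * rowSum i n))
        ≈⟨ solve 4 (λ m n o r → m :* (n :* (o :* r)) := n :* (m :* o) :* r) refl (cast m) (cast (suc n)) (cast (order n)) (rowSum i n) ⟩
      cast (suc n) * (cast m * cast (order n)) * rowSum i n
        ≈⟨ *-cong (Recurrences.order-suc n) (rowSum-suc i n) ⟨
      cast (order (suc n)) * (eigenvalue (suc i) * rowSum (suc i) (suc n))
        ≈⟨ solve 3 (λ o e r → o :* (e :* r) := e :* (o :* r)) refl (cast (order (suc n))) (eigenvalue (suc i)) (rowSum (suc i) (suc n)) ⟩
      eigenvalue (suc i) * (cast (order (suc n)) * rowSum (suc i) (suc n)) ∎)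
      where open import Algebra.Solver.Ring.NaturalCoefficients.Default commutativeSemiring

    formula-0-suc : ∀ i → Formula 0 (suc i)
    formula-0-suc i = trans (Enumerated.cast-withFixedPoints 0 (suc i))
      (trans (sum-zero {R = commutativeRing} {n = order 0} λ _ → refl)
      (sym (trans (*-congˡ {x = cast (order 0)} (+-identityˡ 0#)) (zeroʳ _))))

  withFixedPoints-rowSum : ∀ n i → cast (ReflectionGroup.#withFixedPoints m n i) ≈ cast (Enumerated.order n) * rowSum i n
  withFixedPoints-rowSum zero    zero    = formula-zero 0 formula-0-suc
  withFixedPoints-rowSum zero    (suc i) = formula-0-suc i
  withFixedPoints-rowSum (suc n) zero    = formula-zero (suc n) λ i → formula-suc n i (withFixedPoints-rowSum n i)
  withFixedPoints-rowSum (suc n) (suc i) = formula-suc n i (withFixedPoints-rowSum n i)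

  #withFixedPoints-suc : ∀ n i → suc i ℕ.* ReflectionGroup.#withFixedPoints m (suc n) (suc i) ≡ suc n ℕ.* ReflectionGroup.#withFixedPoints m n i
  #withFixedPoints-suc n i = cast-injective _ _ (trans (×1-homo-* (suc i) (# (suc n) (suc i)))
    (trans (Recurrences.withFixedPoints-suc n i) (sym (×1-homo-* (suc n) (# n i)))))

module Derangements (F : Field a ℓ) (m : ℕ) .{{_ : NonZero m}} where

  open FixedPointStatistics F m
  open ≡-Reasoning

  -- The difference `n ∸ i` is unchanged when `n` and `i` rise together, so absorption and the
  -- recurrence of the counts supply equal factors `suc i` and `suc n`. At `i = 0` the claim is the
  -- definition of `d`.
  #withFixedPoints-derangements : ∀ n i → i ℕ.≤ n → (n C i) ℕ.* d m (n ℕ.∸ i) ≡ ReflectionGroup.#withFixedPoints m n i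
  #withFixedPoints-derangements n       zero    _           = ℕₚ.+-identityʳ _
  #withFixedPoints-derangements (suc n) (suc i) (ℕ.s≤s i≤n) = ℕₚ.*-cancelˡ-≡ _ _ (suc i) (begin
    suc i ℕ.* ((suc n C suc i) ℕ.* d m (n ℕ.∸ i))            ≡⟨ ℕₚ.*-assoc (suc i) (suc n C suc i) _ ⟨
    suc i ℕ.* (suc n C suc i) ℕ.* d m (n ℕ.∸ i)              ≡⟨ ≡.cong (ℕ._* d m (n ℕ.∸ i)) (C-absorption n i) ⟩
    suc n ℕ.* (n C i) ℕ.* d m (n ℕ.∸ i)                      ≡⟨ ℕₚ.*-assoc (suc n) (n C i) _ ⟩
    suc n ℕ.* ((n C i) ℕ.* d m (n ℕ.∸ i))                    ≡⟨ ≡.cong (suc n ℕ.*_) (#withFixedPoints-derangements n i i≤n) ⟩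
    suc n ℕ.* ReflectionGroup.#withFixedPoints m n i                 ≡⟨ #withFixedPoints-suc n i ⟨
    suc i ℕ.* ReflectionGroup.#withFixedPoints m (suc n) (suc i)     ∎)

-- The rationals as a field of characteristic zero.

module RationalField where

  open import Algebra.Definitions.RawMonoid ℚ.+-0-rawMonoid using () renaming (_×_ to _times_)

  -- Compared among unnormalised rationals, where adding fractions is an integer formula without
  -- reduction to lowest terms.
  fromℕ-suc : ∀ k → + suc k ℚ./ 1 ≡ 1ℚ ℚ.+ (+ k ℚ./ 1)
  fromℕ-suc k = ℚₚ.toℚᵘ-injective (begin
    ℚ.toℚᵘ (+ suc k ℚ./ 1)                         ≈⟨ ℚₚ.toℚᵘ-fromℚᵘ (ℚᵘ.mkℚᵘ (+ suc k) 0) ⟩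
    ℚᵘ.mkℚᵘ (+ suc k) 0                            ≈⟨ ℚᵘ.*≡* (≡.cong (λ i → (+ 1 ℤ.+ i) ℤ.* + 1) (≡.sym (ℤₚ.*-identityʳ (+ k)))) ⟩
    ℚᵘ.1ℚᵘ ℚᵘ.+ ℚᵘ.mkℚᵘ (+ k) 0                    ≈⟨ ℚᵘₚ.+-congʳ ℚᵘ.1ℚᵘ (ℚₚ.toℚᵘ-fromℚᵘ (ℚᵘ.mkℚᵘ (+ k) 0)) ⟨
    ℚᵘ.1ℚᵘ ℚᵘ.+ ℚ.toℚᵘ (+ k ℚ./ 1)                 ≈⟨ ℚₚ.toℚᵘ-homo-+ 1ℚ (+ k ℚ./ 1) ⟨
    ℚ.toℚᵘ (1ℚ ℚ.+ (+ k ℚ./ 1))                    ∎)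
    where open import Relation.Binary.Reasoning.Setoid ℚᵘₚ.≃-setoid

  times-1 : ∀ k → k times 1ℚ ≡ + k ℚ./ 1
  times-1 zero    = ≡.refl
  times-1 (suc k) = ≡.trans (≡.cong (1ℚ ℚ.+_) (times-1 k)) (≡.sym (fromℕ-suc k))

  fromℕ-injective : ∀ {j k} → + j ℚ./ 1 ≡ + k ℚ./ 1 → j ≡ k
  fromℕ-injective {j} {k} eq
    with ℚᵘ.*≡* eq′ ← ℚᵘₚ.≃-trans (ℚᵘₚ.≃-sym (ℚₚ.toℚᵘ-fromℚᵘ (ℚᵘ.mkℚᵘ (+ j) 0)))
           (ℚᵘₚ.≃-trans (ℚₚ.toℚᵘ-cong eq) (ℚₚ.toℚᵘ-fromℚᵘ (ℚᵘ.mkℚᵘ (+ k) 0)))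
    = ℤₚ.+-injective (ℤₚ.*-cancelʳ-≡ (+ j) (+ k) (+ 1) eq′)

  rationals : Field 0ℓ 0ℓ
  rationals = record
    { commutativeRing     = ℚₚ.+-*-commutativeRing
    ; _≟_                 = ℚₚ._≟_
    ; inverse             = λ x x≢0 → let instance _ = ℚ.≢-nonZero x≢0 in ℚ.1/ x , ℚₚ.*-inverseˡ x
    ; characteristic-zero = λ k eq → fromℕ-injective {k} {0} (≡.trans (≡.sym (times-1 k)) eq)
    }

open RationalField using (rationals; times-1; fromℕ-injective)

-- Coefficients of products with the shuffle element.

module ShuffleMultiplication (m : ℕ) .{{_ : NonZero m}} (n : ℕ) where

  open ReflectionGroup m (suc n)
  open Generators m n
  open FieldProperties rationals using ([_]; indicator-⇔)
  open Field rationals using (sum; sum-cong-≋)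
  open ShuffleOperator rationals m n using (X; X-+; X-*; X-cong)
  private
    module ℤ[] = GroupRing ℤₚ.+-*-commutativeRing group _≟_
    module ℚ[] = GroupRing ℚₚ.+-*-commutativeRing group _≟_
  open ≡-Reasoning

  listSum : ∀ {a} {A : Set a} → (A → ℚ) → List A → ℚ
  listSum f []       = 0ℚ
  listSum f (x ∷ xs) = f x ℚ.+ listSum f xs

  -- The linear extension of `f` to the group ring. Allowing arbitrary `f` turns multiplication by a
  -- group element into a translation of `f`; indicator functions give back the coefficients.
  evaluate : (G → ℚ) → ℤG m (suc n) → ℚ
  evaluate f = listSum λ (r , g) → (r ℚ./ 1) ℚ.* f g

  listSum-++ : ∀ {a} {A : Set a} (f : A → ℚ) xs ys → listSum f (xs List.++ ys) ≡ listSum f xs ℚ.+ listSum f ys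
  listSum-++ f []       ys = ≡.sym (ℚₚ.+-identityˡ _)
  listSum-++ f (x ∷ xs) ys = ≡.trans (≡.cong (f x ℚ.+_) (listSum-++ f xs ys)) (≡.sym (ℚₚ.+-assoc (f x) _ _))

  listSum-map : ∀ {a b} {A : Set a} {B : Set b} (f : B → ℚ) (h : A → B) xs → listSum f (map h xs) ≡ listSum (f ∘ h) xs
  listSum-map f h []       = ≡.refl
  listSum-map f h (x ∷ xs) = ≡.cong (f (h x) ℚ.+_) (listSum-map f h xs)

  listSum-cong : ∀ {a} {A : Set a} {f f′ : A → ℚ} → (∀ x → f x ≡ f′ x) → ∀ xs → listSum f xs ≡ listSum f′ xs
  listSum-cong eq []       = ≡.refl
  listSum-cong eq (x ∷ xs) = ≡.cong₂ ℚ._+_ (eq x) (listSum-cong eq xs)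

  listSum-applyUpTo : ∀ {a} {A : Set a} (f : A → ℚ) (h : ℕ → A) k → listSum f (applyUpTo h k) ≡ sum {k} (λ i → f (h (toℕ i)))
  listSum-applyUpTo f h zero    = ≡.refl
  listSum-applyUpTo f h (suc k) = ≡.cong (f (h 0) ℚ.+_) (listSum-applyUpTo f (h ∘ suc) k)

  listSum-tails : ∀ f {k} (h : Fin k → G) → listSum f (map product (tails (tabulate h))) ≡ sum {suc k} (λ p → f (productFrom m n h p))
  listSum-tails f {zero}  h = ≡.refl
  listSum-tails f {suc k} h = ≡.cong (f (product (tabulate h)) ℚ.+_) (listSum-tails f (h ∘ suc))

  evaluate-Σᴳ : ∀ f gs → evaluate f (ℤ[].Σᴳ gs) ≡ listSum f gs
  evaluate-Σᴳ f []       = ≡.refl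
  evaluate-Σᴳ f (g ∷ gs) = ≡.cong₂ ℚ._+_ (ℚₚ.*-identityˡ (f g)) (evaluate-Σᴳ f gs)

  evaluate-Σᴳ-* : ∀ f gs y → evaluate f (ℤ[].Σᴳ gs ℤ[].*ᴳ y) ≡ listSum (λ g → evaluate (λ h → f (g ∙ h)) y) gs
  evaluate-Σᴳ-* f []       y = ≡.refl
  evaluate-Σᴳ-* f (g ∷ gs) y = ≡.trans
    (listSum-++ (λ (r , g) → (r ℚ./ 1) ℚ.* f g) (map (λ (r , h) → + 1 ℤ.* r , g ∙ h) y) (ℤ[].Σᴳ gs ℤ[].*ᴳ y))
    (≡.cong₂ ℚ._+_
      (≡.trans (listSum-map (λ (r , g) → (r ℚ./ 1) ℚ.* f g) (λ (r , h) → + 1 ℤ.* r , g ∙ h) y)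
               (listSum-cong (λ (r , h) → ≡.cong (λ r → (r ℚ./ 1) ℚ.* f (g ∙ h)) (ℤₚ.*-identityˡ r)) y))
      (evaluate-Σᴳ-* f gs y))

  evaluate-*-⟦⟧ : ∀ f xs u → evaluate f (xs ℤ[].*ᴳ ℤ[].⟦ u ⟧) ≡ evaluate (λ g → f (g ∙ u)) xs
  evaluate-*-⟦⟧ f []             u = ≡.refl
  evaluate-*-⟦⟧ f ((r , g) ∷ xs) u = ≡.cong₂ ℚ._+_
    (≡.cong (λ r → (r ℚ./ 1) ℚ.* f (g ∙ u)) (ℤₚ.*-identityʳ r)) (evaluate-*-⟦⟧ f xs u)

  evaluate-Sh : ∀ f → evaluate f (Sh m (suc n)) ≡ sum {suc n} λ p → sum {m} λ ρ → f (shuffle m n p ρ)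
  evaluate-Sh f = ≡.trans (evaluate-Σᴳ-* f (map product (tails (tabulate s))) y)
    (≡.trans (listSum-tails (λ g → evaluate (λ h → f (g ∙ h)) y) s)
    (sum-cong-≋ {suc n} λ p → ≡.trans (evaluate-Σᴳ (λ h → f (cycle m n p ∙ h)) (applyUpTo (t (fromℕ n) ^_) m))
      (listSum-applyUpTo (λ h → f (cycle m n p ∙ h)) (t (fromℕ n) ^_) m)))
    where
    y = ℤ[].Σᴳ (applyUpTo (t (fromℕ n) ^_) m)

  coefficient-ℤG⇒ℚG : ∀ g xs → ℚ[].coefficient g (ℤG⇒ℚG m (suc n) xs) ≡ evaluate (λ h → [ h ≟ g ]) xs
  coefficient-ℤG⇒ℚG g []             = ≡.refl
  coefficient-ℤG⇒ℚG g ((r , h) ∷ xs) = ≡.cong₂ ℚ._+_ (head (does (h ≟ g))) (coefficient-ℤG⇒ℚG g xs)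
    where
    head : ∀ t → (if t then r ℚ./ 1 else 0ℚ) ≡ (r ℚ./ 1) ℚ.* (if t then 1ℚ else 0ℚ)
    head true  = ≡.sym (ℚₚ.*-identityʳ (r ℚ./ 1))
    head false = ≡.sym (ℚₚ.*-zeroʳ (r ℚ./ 1))

  coefficient-Sh-⟦⟧ : ∀ u g → ℚ[].coefficient g (ℤG⇒ℚG m (suc n) (L m (suc n) ℤ[].⟦ u ⟧)) ≡ X (λ h → [ u ≟ h ]) g
  coefficient-Sh-⟦⟧ u g = begin
    ℚ[].coefficient g (ℤG⇒ℚG m (suc n) (Sh m (suc n) ℤ[].*ᴳ ℤ[].⟦ u ⟧))  ≡⟨ coefficient-ℤG⇒ℚG g (Sh m (suc n) ℤ[].*ᴳ ℤ[].⟦ u ⟧) ⟩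
    evaluate (λ h → [ h ≟ g ]) (Sh m (suc n) ℤ[].*ᴳ ℤ[].⟦ u ⟧)           ≡⟨ evaluate-*-⟦⟧ (λ h → [ h ≟ g ]) (Sh m (suc n)) u ⟩
    evaluate (λ h → [ h ∙ u ≟ g ]) (Sh m (suc n))                        ≡⟨ evaluate-Sh (λ h → [ h ∙ u ≟ g ]) ⟩
    (sum {suc n} λ p → sum {m} λ ρ → [ shuffle m n p ρ ∙ u ≟ g ])
      ≡⟨ sum-cong-≋ {suc n} (λ p → sum-cong-≋ {m} λ ρ → let h = shuffle m n p ρ in
           indicator-⇔ (h ∙ u ≟ g) (u ≟ h ⁻¹ ∙ g)
             (λ eq e → ≡.trans (≡.sym (G.strictlyInverseʳ h (to u e))) (≡.cong (from h) (eq e)))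
             (λ eq e → ≡.trans (≡.cong (to h) (eq e)) (G.strictlyInverseˡ h (to g e)))) ⟩
    X (λ h → [ u ≟ h ]) g                                                ∎

  -- Both sides are linear in `v`, so the case of a single group element suffices.
  coefficient-extendScalars : ∀ v g →
    ℚ[].coefficient g (extendScalars m (suc n) (L m (suc n)) v) ≡ X (λ h → ℚ[].coefficient h v) g
  coefficient-extendScalars [] g = begin
    -- The zero function is 0 times itself, so homogeneity of `X` shows that its image vanishes.
    0ℚ                         ≡⟨ ℚₚ.*-zeroˡ (X (λ _ → 0ℚ) g) ⟨
    0ℚ ℚ.* X (λ _ → 0ℚ) g      ≡⟨ X-* 0ℚ (λ _ → 0ℚ) g ⟨
    X (λ _ → 0ℚ ℚ.* 0ℚ) g      ≡⟨⟩
    X (λ _ → 0ℚ) g             ∎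
  coefficient-extendScalars ((q , u) ∷ v) g = begin
    ℚ[].coefficient g (y List.++ extendScalars m (suc n) (L m (suc n)) v)
      ≡⟨ ℚ[].coefficient-++ g y (extendScalars m (suc n) (L m (suc n)) v) ⟩
    ℚ[].coefficient g y ℚ.+ ℚ[].coefficient g (extendScalars m (suc n) (L m (suc n)) v)
      ≡⟨ ≡.cong₂ ℚ._+_ (≡.trans (ℚ[].coefficient-· g q (ℤG⇒ℚG m (suc n) (L m (suc n) ℤ[].⟦ u ⟧))) (≡.cong (q ℚ.*_) (coefficient-Sh-⟦⟧ u g))) (coefficient-extendScalars v g) ⟩
    q ℚ.* X (λ h → [ u ≟ h ]) g ℚ.+ X (λ h → ℚ[].coefficient h v) g
      ≡⟨ ≡.cong (ℚ._+ X (λ h → ℚ[].coefficient h v) g) (X-* q (λ h → [ u ≟ h ]) g) ⟨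
    X (λ h → q ℚ.* [ u ≟ h ]) g ℚ.+ X (λ h → ℚ[].coefficient h v) g
      ≡⟨ X-+ (λ h → q ℚ.* [ u ≟ h ]) (λ h → ℚ[].coefficient h v) g ⟨
    X (λ h → q ℚ.* [ u ≟ h ] ℚ.+ ℚ[].coefficient h v) g
      ≡⟨ X-cong (λ h → ≡.cong (ℚ._+ ℚ[].coefficient h v) (head (does (u ≟ h)))) g ⟩
    X (λ h → ℚ[].coefficient h ((q , u) ∷ v)) g ∎
    where
    y = q ℚ[].· ℤG⇒ℚG m (suc n) (L m (suc n) ℤ[].⟦ u ⟧)
    head : ∀ t → q ℚ.* (if t then 1ℚ else 0ℚ) ≡ (if t then q else 0ℚ)
    head true  = ℚₚ.*-identityʳ q
    head false = ℚₚ.*-zeroʳ q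

open import Data.Nat.Base using (_*_; _∸_; _≤_)
open import Data.Rational.Base using (_/_)

-- The spectrum of the shuffle operator.

module ShuffleSpectrum (m : ℕ) .{{_ : NonZero m}} (n : ℕ) where

  open Coefficients rationals m using (eigenvalue)
  open FieldProperties rationals using (cast-injective)
  open ReflectionGroup m (suc n) using (#withFixedPoints)
  open LinearAlgebra (ℚG-leftModule m (suc n))
  open Eigenspaces rationals (ℚG-leftModule m (suc n)) using (hasDimension⇒nonzero; nonzero⇒dimension≢0)

  Lℚ : ℚG m (suc n) → ℚG m (suc n)
  Lℚ = extendScalars m (suc n) (L m (suc n))

  open RegularRepresentation rationals m n using (eigenvector-trace)
  open RegularRepresentation.Spectrum rationals m n Lℚ (ShuffleMultiplication.coefficient-extendScalars m n)
    using (dimension; basis; basis-isBasis; dimension≈trace; diagonalizable; eigenvalue-listed) public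

  multiplicity : ℕ → ℕ
  multiplicity i = (suc n C i) * d m (suc n ∸ i)

  multiplicity≡ : ∀ i → i ≤ suc n → multiplicity i ≡ #withFixedPoints i
  multiplicity≡ = Derangements.#withFixedPoints-derangements rationals m (suc n)

  dimension≡ : ∀ i → dimension i ≡ #withFixedPoints (toℕ i)
  dimension≡ i = cast-injective _ _ (≡.trans (dimension≈trace i) (≡.trans (eigenvector-trace (toℕ i))
    (≡.sym (FixedPointStatistics.withFixedPoints-rowSum rationals m (suc n) (toℕ i)))))

  eigenspace-dimension : ∀ i → i ≤ suc n → HasMultiplicity Lℚ (+ (i * m) / 1) (multiplicity i)
  eigenspace-dimension i i≤ = ≡.subst₂ (HasMultiplicity Lℚ)
    (≡.trans (≡.cong eigenvalue toℕ-i′) (times-1 (i * m)))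
    (≡.trans (dimension≡ i′) (≡.trans (≡.cong #withFixedPoints toℕ-i′) (≡.sym (multiplicity≡ i i≤))))
    (basis i′ , basis-isBasis i′)
    where
    i′ = fromℕ< (ℕ.s≤s i≤)
    toℕ-i′ : toℕ i′ ≡ i
    toℕ-i′ = Finₚ.toℕ-fromℕ< (ℕ.s≤s i≤)

  -- A listed value need not be an eigenvalue, for instance when m = 1 and `i` is one less than the
  -- degree. The given eigenvector itself shows that the multiplicity is nonzero.
  eigenvalue⇒ : ∀ μ → IsEigenvalue Lℚ μ → ∃[ i ] (i ≤ suc n × μ ≡ + (i * m) / 1 × multiplicity i ≢ 0)
  eigenvalue⇒ μ (v , v≉0 , fv) = toℕ i , i≤ , μ≡ ,
    nonzero⇒dimension≢0 {U = Eigenspace Lℚ (+ (toℕ i * m) / 1)} {v = v} (eigenspace-dimension (toℕ i) i≤) v≉0 (≡.subst (λ μ → Eigenspace Lℚ μ v) μ≡ fv)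
    where
    listed = eigenvalue-listed {μ} (v , v≉0 , fv)
    i = proj₁ listed
    i≤ : toℕ i ≤ suc n
    i≤ = ℕ.s≤s⁻¹ (Finₚ.toℕ<n i)
    μ≡ : μ ≡ + (toℕ i * m) / 1
    μ≡ = ≡.trans (≡.sym (proj₂ listed)) (times-1 (toℕ i * m))

  eigenvalue⇐ : ∀ μ → ∃[ i ] (i ≤ suc n × μ ≡ + (i * m) / 1 × multiplicity i ≢ 0) → IsEigenvalue Lℚ μ
  eigenvalue⇐ μ (i , i≤ , ≡.refl , mult≢0) = hasDimension⇒nonzero {U = Eigenspace Lℚ (+ (i * m) / 1)} (eigenspace-dimension i i≤) mult≢0

theorem3 : ∀ (m n : ℕ) .{{_ : NonZero m}} .{{_ : NonZero n}} →
    let open LinearAlgebra (ℚG-leftModule m n)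
        Lℚ = extendScalars m n (L m n)
        multiplicity = λ (i : ℕ) → (n C i) * d m (n ∸ i)
    in
      Diagonalizable Lℚ
    × (∀ μ → IsEigenvalue Lℚ μ ⇔ (∃[ i ] (i ≤ n × μ ≡ + (i * m) / 1 × multiplicity i ≢ 0)))
    × (∀ i → i ≤ n →
          HasMultiplicity Lℚ (+ (i * m) / 1) (multiplicity i)
        × multiplicity i ≡ ReflectionGroup.#withFixedPoints m n i)
theorem3 m (suc n) =
    diagonalizable
  , (λ μ → mk⇔ (eigenvalue⇒ μ) (eigenvalue⇐ μ))
  , λ i i≤n → eigenspace-dimension i i≤n , multiplicity≡ i i≤n
  where
  open ShuffleSpectrum m n
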